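{- Let $T$ be a tree on $n\geq 4$ vertices. Then the node reliability polynomial $\mathrm{nRel}(T;p)$ has at least one point of inflection in $(0,1)$ (a point in $(0,1)$ at which the second derivative changes sign).
   Context: For a graph $G$ on $n$ vertices, a connected set is a nonempty vertex subset $C$ such that the induced subgraph $G[C]$ is connected. The node reliability of $G$ is the polynomial \[ \mathrm{nRel}(G;p)=\sum_{C}p^{|C|}(1-p)^{n-|C|}, \] the sum over all connected sets $C$ of $G$. -}

module Defs where

open import Data.Fin using (Fin; toℕ)
open import Data.Fin.Properties using (toℕ-injective; toℕ<n; any?; all?) renaming (_≟_ to _≟ᶠ_)
open import Data.Fin.Subset using (Subset; Nonempty; ⊤; inside; outside; ∣_∣) renaming (_∈_ to _∈ˢ_)
open import Data.Fin.Subset.Properties using (_∈?_; nonempty?)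
open import Data.List using (List; []; _∷_; _∷ʳ_; _++_; map; filter; foldr)
open import Data.List.Relation.Unary.Linked using (Linked)
open import Data.List.Relation.Unary.Unique.Propositional using (Unique)
open import Data.Nat as ℕ using (ℕ; zero; suc)
import Data.Nat.Properties as ℕ
open import Data.Product using (∃; ∃-syntax; _×_; _,_; proj₁; proj₂)
open import Data.Rational as ℚ using (ℚ; 0ℚ; 1ℚ; ½)
import Data.Rational.Properties as ℚ
open import Data.Rational.Solver using (module +-*-Solver)
open import Data.Sum using (_⊎_; inj₁; inj₂)
open import Data.Vec using ([]; _∷_)
open import Level using (0ℓ)
open import Relation.Binary using (Rel; Decidable; Symmetric; Irreflexive)
open import Relation.Binary.Construct.Closure.ReflexiveTransitive using (Star; ε; _◅_; _◅◅_)
open import Relation.Binary.PropositionalEquality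
open import Relation.Nullary using (¬_)
open import Relation.Nullary.Decidable using (map′; _×-dec_; _⊎-dec_; _→-dec_)
open import Relation.Unary as Unary using ()

------------------------------------------------------------------------
-- Decidability of reachability for a decidable relation on Fin n
-- (Floyd–Warshall)

module Reachability {n : ℕ} {R : Rel (Fin n) 0ℓ} (R? : Decidable R) where

  -- There is a path from u to v all of whose interior vertices are < k.
  Via : ℕ → Rel (Fin n) 0ℓ
  Via zero    u v = u ≡ v ⊎ R u v
  Via (suc k) u v = Via k u v ⊎ ∃ λ w → toℕ w ≡ k × Via k u w × Via k w v

  via? : ∀ k → Decidable (Via k)
  via? zero    u v = (u ≟ᶠ v) ⊎-dec R? u v
  via? (suc k) u v =
    via? k u v ⊎-dec any? (λ w → (toℕ w ℕ.≟ k) ×-dec via? k u w ×-dec via? k w v)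

  via⇒star : ∀ k {u v} → Via k u v → Star R u v
  via⇒star zero    (inj₁ refl) = ε
  via⇒star zero    (inj₂ r)    = r ◅ ε
  via⇒star (suc k) (inj₁ p)    = via⇒star k p
  via⇒star (suc k) (inj₂ (_ , _ , p , q)) = via⇒star k p ◅◅ via⇒star k q

  via-lift : ∀ k {u v} → Via zero u v → Via k u v
  via-lift zero    p = p
  via-lift (suc k) p = inj₁ (via-lift k p)

  via-trans : ∀ k {u w v} → toℕ w ℕ.< k → Via k u w → Via k w v → Via k u v
  via-trans (suc k) {u} {w} {v} w<1+k = go (ℕ.m≤n⇒m<n∨m≡n (ℕ.≤-pred w<1+k))
    where
    go : toℕ w ℕ.< k ⊎ toℕ w ≡ k → Via (suc k) u w → Via (suc k) w v → Via (suc k) u v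
    go (inj₁ w<k) (inj₁ p) (inj₁ q) = inj₁ (via-trans k w<k p q)
    go (inj₂ w≡k) (inj₁ p) (inj₁ q) = inj₂ (w , w≡k , p , q)
    go (inj₁ w<k) (inj₁ p) (inj₂ (z , z≡k , wz , zv)) =
      inj₂ (z , z≡k , via-trans k w<k p wz , zv)
    go (inj₂ w≡k) (inj₁ p) (inj₂ (z , z≡k , wz , zv))
      with refl ← toℕ-injective (trans w≡k (sym z≡k)) = inj₂ (z , z≡k , p , zv)
    go (inj₁ w<k) (inj₂ (z , z≡k , uz , zw)) (inj₁ q) =
      inj₂ (z , z≡k , uz , via-trans k w<k zw q)
    go (inj₂ w≡k) (inj₂ (z , z≡k , uz , zw)) (inj₁ q)
      with refl ← toℕ-injective (trans w≡k (sym z≡k)) = inj₂ (z , z≡k , uz , q)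
    go _ (inj₂ (z , z≡k , uz , _)) (inj₂ (z′ , z′≡k , _ , z′v))
      with refl ← toℕ-injective (trans z≡k (sym z′≡k)) = inj₂ (z , z≡k , uz , z′v)

  star⇒via : ∀ {u v} → Star R u v → Via n u v
  star⇒via ε = via-lift n (inj₁ refl)
  star⇒via (_◅_ {j = w} r rs) = via-trans n (toℕ<n w) (via-lift n (inj₂ r)) (star⇒via rs)

  star? : Decidable (Star R)
  star? u v = map′ (via⇒star n) star⇒via (via? n u v)

------------------------------------------------------------------------
-- Finite simple graphs, connected sets, trees

record Graph (n : ℕ) : Set₁ where
  field
    Adj        : Rel (Fin n) 0ℓ
    adj?       : Decidable Adj
    adj-sym    : Symmetric Adj
    adj-irrefl : Irreflexive _≡_ Adj

module _ {n : ℕ} (G : Graph n) where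
  open Graph G

  -- Adjacency in the induced subgraph G[C].
  InducedAdj : Subset n → Rel (Fin n) 0ℓ
  InducedAdj C u v = u ∈ˢ C × v ∈ˢ C × Adj u v

  ConnectedSet : Subset n → Set
  ConnectedSet C =
    Nonempty C × (∀ u v → u ∈ˢ C → v ∈ˢ C → Star (InducedAdj C) u v)

  connectedSet? : Unary.Decidable ConnectedSet
  connectedSet? C = nonempty? C ×-dec
    all? (λ u → all? (λ v → (u ∈? C) →-dec ((v ∈? C) →-dec star? u v)))
    where
    open Reachability (λ u v → (u ∈? C) ×-dec (v ∈? C) ×-dec adj? u v)

  -- At least three pairwise distinct vertices, consecutive ones adjacent
  -- and the last one adjacent to the first.
  record Cycle : Set where
    field
      first last  : Fin n
      interior    : List (Fin n)
      interior≢[] : interior ≢ []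

    vertices : List (Fin n)
    vertices = first ∷ (interior ∷ʳ last)

    field
      distinct : Unique vertices
      path     : Linked Adj vertices
      closing  : Adj last first

  record IsTree : Set where
    field
      connected : ConnectedSet ⊤
      acyclic   : ¬ Cycle

------------------------------------------------------------------------
-- Polynomials over ℚ, as coefficient lists with the constant term first
-- (trailing zeros allowed)

Poly : Set
Poly = List ℚ

infixl 6 _⊕_
infixr 7 _·_
infixl 7 _⊗_
infixr 8 _^ᵖ_

_⊕_ : Poly → Poly → Poly
[]      ⊕ q       = q
(a ∷ p) ⊕ []      = a ∷ p
(a ∷ p) ⊕ (b ∷ q) = (a ℚ.+ b) ∷ (p ⊕ q)

_·_ : ℚ → Poly → Poly
a · p = map (a ℚ.*_) p

_⊗_ : Poly → Poly → Poly
[]      ⊗ q = []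
(a ∷ p) ⊗ q = a · q ⊕ (0ℚ ∷ (p ⊗ q))

_^ᵖ_ : Poly → ℕ → Poly
p ^ᵖ zero  = 1ℚ ∷ []
p ^ᵖ suc k = p ⊗ p ^ᵖ k

-- (a + X q)′ = q + X q′
deriv : Poly → Poly
deriv []      = []
deriv (a ∷ q) = q ⊕ (0ℚ ∷ deriv q)

sumᵖ : List Poly → Poly
sumᵖ = foldr _⊕_ []

------------------------------------------------------------------------
-- Node reliability

allSubsets : ∀ n → List (Subset n)
allSubsets zero    = [] ∷ []
allSubsets (suc n) =
  map (inside ∷_) (allSubsets n) ++ map (outside ∷_) (allSubsets n)

connectedSets : ∀ {n} → Graph n → List (Subset n)
connectedSets {n} G = filter (connectedSet? G) (allSubsets n)

X 1-X : Poly
X   = 0ℚ ∷ 1ℚ ∷ []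
1-X = 1ℚ ∷ ℚ.- 1ℚ ∷ []

nRel : ∀ {n} → Graph n → Poly
nRel {n} G =
  sumᵖ (map (λ C → X ^ᵖ ∣ C ∣ ⊗ 1-X ^ᵖ (n ℕ.∸ ∣ C ∣)) (connectedSets G))

------------------------------------------------------------------------
-- Real numbers as Cauchy sequences of rationals.  Equality of reals is not
-- needed below: everything is expressed through _<ℝ_, which is invariant
-- under equivalence of Cauchy sequences.

IsCauchy : (ℕ → ℚ) → Set
IsCauchy x = ∀ δ → 0ℚ ℚ.< δ →
  ∃ λ N → ∀ m n → N ℕ.≤ m → N ℕ.≤ n → ℚ.∣ x m ℚ.- x n ∣ ℚ.< δ

record ℝ : Set where
  constructor mkℝ
  field
    seq    : ℕ → ℚ
    cauchy : IsCauchy seq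

open ℝ public

infix 4 _<ℝ_

_<ℝ_ : Rel ℝ 0ℓ
x <ℝ y = ∃ λ δ → 0ℚ ℚ.< δ × ∃ λ N → ∀ n → N ℕ.≤ n → seq x n ℚ.+ δ ℚ.≤ seq y n

private
  half-pos : ∀ {δ} → 0ℚ ℚ.< δ → 0ℚ ℚ.< ½ ℚ.* δ
  half-pos {δ} 0<δ = ℚ.positive⁻¹ (½ ℚ.* δ) {{ℚ.pos*pos⇒pos ½ δ {{ℚ.positive 0<δ}}}}

  halves : ∀ δ → ½ ℚ.* δ ℚ.+ ½ ℚ.* δ ≡ δ
  halves δ = trans (sym (ℚ.*-distribʳ-+ δ ½ ½)) (ℚ.*-identityˡ δ)

const-cauchy : ∀ a → IsCauchy (λ _ → a)
const-cauchy a δ 0<δ = 0 , λ _ _ _ _ →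
  subst (λ d → ℚ.∣ d ∣ ℚ.< δ) (sym (ℚ.+-inverseʳ a)) 0<δ

+-cauchy : ∀ {x y} → IsCauchy x → IsCauchy y → IsCauchy (λ n → x n ℚ.+ y n)
+-cauchy {x} {y} cx cy δ 0<δ = M ℕ.⊔ N , bound
  where
  open ℚ.≤-Reasoning
  M N : ℕ
  M = proj₁ (cx (½ ℚ.* δ) (half-pos 0<δ))
  N = proj₁ (cy (½ ℚ.* δ) (half-pos 0<δ))

  rearrange : ∀ a b c d → (a ℚ.+ b) ℚ.- (c ℚ.+ d) ≡ (a ℚ.- c) ℚ.+ (b ℚ.- d)
  rearrange = solve 4 (λ a b c d →
    (a :+ b) :- (c :+ d) := (a :- c) :+ (b :- d)) refl
    where open +-*-Solver

  bound : ∀ m n → M ℕ.⊔ N ℕ.≤ m → M ℕ.⊔ N ℕ.≤ n →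
          ℚ.∣ (x m ℚ.+ y m) ℚ.- (x n ℚ.+ y n) ∣ ℚ.< δ
  bound m n ≤m ≤n = begin-strict
    ℚ.∣ (x m ℚ.+ y m) ℚ.- (x n ℚ.+ y n) ∣
      ≡⟨ cong ℚ.∣_∣ (rearrange (x m) (y m) (x n) (y n)) ⟩
    ℚ.∣ (x m ℚ.- x n) ℚ.+ (y m ℚ.- y n) ∣
      ≤⟨ ℚ.∣p+q∣≤∣p∣+∣q∣ (x m ℚ.- x n) (y m ℚ.- y n) ⟩
    ℚ.∣ x m ℚ.- x n ∣ ℚ.+ ℚ.∣ y m ℚ.- y n ∣
      <⟨ ℚ.+-mono-<
           (proj₂ (cx (½ ℚ.* δ) (half-pos 0<δ)) m n
             (ℕ.m⊔n≤o⇒m≤o M N ≤m) (ℕ.m⊔n≤o⇒m≤o M N ≤n))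
           (proj₂ (cy (½ ℚ.* δ) (half-pos 0<δ)) m n
             (ℕ.m⊔n≤o⇒n≤o M N ≤m) (ℕ.m⊔n≤o⇒n≤o M N ≤n)) ⟩
    ½ ℚ.* δ ℚ.+ ½ ℚ.* δ
      ≡⟨ halves δ ⟩
    δ ∎

cauchy-bounded : ∀ {x} → IsCauchy x →
  ∃ λ B → 0ℚ ℚ.< B × ∃ λ N → ∀ n → N ℕ.≤ n → ℚ.∣ x n ∣ ℚ.≤ B
cauchy-bounded {x} cx = 1ℚ ℚ.+ ℚ.∣ x N ∣ , 0<B , N , bound
  where
  open ℚ.≤-Reasoning
  0<1 : 0ℚ ℚ.< 1ℚ
  0<1 = ℚ.positive⁻¹ 1ℚ

  N : ℕ
  N = proj₁ (cx 1ℚ 0<1)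

  0<B : 0ℚ ℚ.< 1ℚ ℚ.+ ℚ.∣ x N ∣
  0<B = ℚ.+-mono-<-≤ 0<1 (ℚ.0≤∣p∣ (x N))

  telescope : ∀ a b → a ≡ (a ℚ.- b) ℚ.+ b
  telescope = solve 2 (λ a b → a := (a :- b) :+ b) refl
    where open +-*-Solver

  bound : ∀ n → N ℕ.≤ n → ℚ.∣ x n ∣ ℚ.≤ 1ℚ ℚ.+ ℚ.∣ x N ∣
  bound n N≤n = begin
    ℚ.∣ x n ∣                       ≡⟨ cong ℚ.∣_∣ (telescope (x n) (x N)) ⟩
    ℚ.∣ (x n ℚ.- x N) ℚ.+ x N ∣     ≤⟨ ℚ.∣p+q∣≤∣p∣+∣q∣ (x n ℚ.- x N) (x N) ⟩
    ℚ.∣ x n ℚ.- x N ∣ ℚ.+ ℚ.∣ x N ∣ ≤⟨ ℚ.+-monoˡ-≤ ℚ.∣ x N ∣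
                                         (ℚ.<⇒≤ (proj₂ (cx 1ℚ 0<1) n N N≤n ℕ.≤-refl)) ⟩
    1ℚ ℚ.+ ℚ.∣ x N ∣ ∎

private
  product-difference : ∀ a b c d →
    a ℚ.* b ℚ.- c ℚ.* d ≡ a ℚ.* (b ℚ.- d) ℚ.+ d ℚ.* (a ℚ.- c)
  product-difference = solve 4 (λ a b c d →
    a :* b :- c :* d := a :* (b :- d) :+ d :* (a :- c)) refl
    where open +-*-Solver

  split-δ : ∀ A B δ → 0ℚ ℚ.< A → 0ℚ ℚ.< B → 0ℚ ℚ.< δ →
            ∃ λ η → 0ℚ ℚ.< η × A ℚ.* η ℚ.+ B ℚ.* η ≡ δ
  split-δ A B δ 0<A 0<B 0<δ = go (A ℚ.+ B) refl (ℚ.+-mono-< 0<A 0<B)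
    where
    go : ∀ C → A ℚ.+ B ≡ C → 0ℚ ℚ.< C →
         ∃ λ η → 0ℚ ℚ.< η × A ℚ.* η ℚ.+ B ℚ.* η ≡ δ
    go C A+B≡C 0<C = η , 0<η , (begin
      A ℚ.* η ℚ.+ B ℚ.* η    ≡⟨ ℚ.*-distribʳ-+ η A B ⟨
      (A ℚ.+ B) ℚ.* η        ≡⟨ cong (ℚ._* η) A+B≡C ⟩
      C ℚ.* (1/C ℚ.* δ)      ≡⟨ ℚ.*-assoc C 1/C δ ⟨
      (C ℚ.* 1/C) ℚ.* δ      ≡⟨ cong (ℚ._* δ) (ℚ.*-inverseʳ C {{C≢0}}) ⟩
      1ℚ ℚ.* δ               ≡⟨ ℚ.*-identityˡ δ ⟩
      δ                      ∎)
      where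
      open ≡-Reasoning
      C≢0 : ℚ.NonZero C
      C≢0 = ℚ.pos⇒nonZero C {{ℚ.positive 0<C}}
      1/C η : ℚ
      1/C = ℚ.1/_ C {{C≢0}}
      η = 1/C ℚ.* δ
      0<η : 0ℚ ℚ.< η
      0<η = ℚ.positive⁻¹ η
        {{ℚ.pos*pos⇒pos 1/C {{ℚ.1/pos⇒pos C {{ℚ.positive 0<C}}}} δ {{ℚ.positive 0<δ}}}}

  ∣*∣-mono : ∀ p q s t → 0ℚ ℚ.< s → ℚ.∣ p ∣ ℚ.≤ s → ℚ.∣ q ∣ ℚ.< t →
             ℚ.∣ p ℚ.* q ∣ ℚ.< s ℚ.* t
  ∣*∣-mono p q s t 0<s p≤s q<t = begin-strict
    ℚ.∣ p ℚ.* q ∣       ≡⟨ ℚ.∣p*q∣≡∣p∣*∣q∣ p q ⟩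
    ℚ.∣ p ∣ ℚ.* ℚ.∣ q ∣ ≤⟨ ℚ.*-monoʳ-≤-nonNeg ℚ.∣ q ∣ {{ℚ.∣-∣-nonNeg q}} p≤s ⟩
    s ℚ.* ℚ.∣ q ∣       <⟨ ℚ.*-monoʳ-<-pos s {{ℚ.positive 0<s}} q<t ⟩
    s ℚ.* t             ∎
    where open ℚ.≤-Reasoning

*-cauchy : ∀ {x y} → IsCauchy x → IsCauchy y → IsCauchy (λ n → x n ℚ.* y n)
*-cauchy {x} {y} cx cy δ 0<δ = combine (cauchy-bounded cx) (cauchy-bounded cy)
  where
  combine :
    (∃ λ A → 0ℚ ℚ.< A × ∃ λ K → ∀ n → K ℕ.≤ n → ℚ.∣ x n ∣ ℚ.≤ A) →
    (∃ λ B → 0ℚ ℚ.< B × ∃ λ L → ∀ n → L ℕ.≤ n → ℚ.∣ y n ∣ ℚ.≤ B) →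
    ∃ λ N → ∀ m n → N ℕ.≤ m → N ℕ.≤ n → ℚ.∣ x m ℚ.* y m ℚ.- x n ℚ.* y n ∣ ℚ.< δ
  combine (A , 0<A , K , x≤A) (B , 0<B , L , y≤B) = go (split-δ A B δ 0<A 0<B 0<δ)
    where
    go : (∃ λ η → 0ℚ ℚ.< η × A ℚ.* η ℚ.+ B ℚ.* η ≡ δ) →
         ∃ λ N → ∀ m n → N ℕ.≤ m → N ℕ.≤ n → ℚ.∣ x m ℚ.* y m ℚ.- x n ℚ.* y n ∣ ℚ.< δ
    go (η , 0<η , Aη+Bη≡δ) = N , bound
      where
      open ℚ.≤-Reasoning
      P Q N : ℕ
      P = proj₁ (cx η 0<η)
      Q = proj₁ (cy η 0<η)
      N = (K ℕ.⊔ L) ℕ.⊔ (P ℕ.⊔ Q)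

      K≤ : ∀ {k} → N ℕ.≤ k → K ℕ.≤ k
      K≤ le = ℕ.m⊔n≤o⇒m≤o K L (ℕ.m⊔n≤o⇒m≤o (K ℕ.⊔ L) (P ℕ.⊔ Q) le)
      L≤ : ∀ {k} → N ℕ.≤ k → L ℕ.≤ k
      L≤ le = ℕ.m⊔n≤o⇒n≤o K L (ℕ.m⊔n≤o⇒m≤o (K ℕ.⊔ L) (P ℕ.⊔ Q) le)
      P≤ : ∀ {k} → N ℕ.≤ k → P ℕ.≤ k
      P≤ le = ℕ.m⊔n≤o⇒m≤o P Q (ℕ.m⊔n≤o⇒n≤o (K ℕ.⊔ L) (P ℕ.⊔ Q) le)
      Q≤ : ∀ {k} → N ℕ.≤ k → Q ℕ.≤ k
      Q≤ le = ℕ.m⊔n≤o⇒n≤o P Q (ℕ.m⊔n≤o⇒n≤o (K ℕ.⊔ L) (P ℕ.⊔ Q) le)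

      bound : ∀ m n → N ℕ.≤ m → N ℕ.≤ n → ℚ.∣ x m ℚ.* y m ℚ.- x n ℚ.* y n ∣ ℚ.< δ
      bound m n N≤m N≤n = begin-strict
        ℚ.∣ x m ℚ.* y m ℚ.- x n ℚ.* y n ∣
          ≡⟨ cong ℚ.∣_∣ (product-difference (x m) (y m) (x n) (y n)) ⟩
        ℚ.∣ x m ℚ.* (y m ℚ.- y n) ℚ.+ y n ℚ.* (x m ℚ.- x n) ∣
          ≤⟨ ℚ.∣p+q∣≤∣p∣+∣q∣ (x m ℚ.* (y m ℚ.- y n)) (y n ℚ.* (x m ℚ.- x n)) ⟩
        ℚ.∣ x m ℚ.* (y m ℚ.- y n) ∣ ℚ.+ ℚ.∣ y n ℚ.* (x m ℚ.- x n) ∣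
          <⟨ ℚ.+-mono-<
               (∣*∣-mono (x m) (y m ℚ.- y n) A η 0<A
                 (x≤A m (K≤ N≤m)) (proj₂ (cy η 0<η) m n (Q≤ N≤m) (Q≤ N≤n)))
               (∣*∣-mono (y n) (x m ℚ.- x n) B η 0<B
                 (y≤B n (L≤ N≤n)) (proj₂ (cx η 0<η) m n (P≤ N≤m) (P≤ N≤n))) ⟩
        A ℚ.* η ℚ.+ B ℚ.* η
          ≡⟨ Aη+Bη≡δ ⟩
        δ ∎

infixl 6 _+ℝ_
infixl 7 _*ℝ_

fromℚ : ℚ → ℝ
fromℚ a = mkℝ (λ _ → a) (const-cauchy a)

_+ℝ_ : ℝ → ℝ → ℝ
x +ℝ y = mkℝ (λ n → seq x n ℚ.+ seq y n) (+-cauchy {seq x} {seq y} (cauchy x) (cauchy y))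

_*ℝ_ : ℝ → ℝ → ℝ
x *ℝ y = mkℝ (λ n → seq x n ℚ.* seq y n) (*-cauchy {seq x} {seq y} (cauchy x) (cauchy y))

0ℝ 1ℝ : ℝ
0ℝ = fromℚ 0ℚ
1ℝ = fromℚ 1ℚ

------------------------------------------------------------------------
-- Points of inflection

eval : Poly → ℝ → ℝ
eval []      x = 0ℝ
eval (a ∷ p) x = fromℚ a +ℝ x *ℝ eval p x

ChangesSignAt : (ℝ → ℝ) → ℝ → Set
ChangesSignAt f c = ∃[ a ] ∃[ b ] (a <ℝ c × c <ℝ b ×
  (  (∀ x → a <ℝ x → x <ℝ c → f x <ℝ 0ℝ) × (∀ x → c <ℝ x → x <ℝ b → 0ℝ <ℝ f x)
   ⊎ (∀ x → a <ℝ x → x <ℝ c → 0ℝ <ℝ f x) × (∀ x → c <ℝ x → x <ℝ b → f x <ℝ 0ℝ)))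

InflectionPoint : Poly → ℝ → Set
InflectionPoint p = ChangesSignAt (eval (deriv (deriv p)))

{-# OPTIONS --safe #-}

-- Let f = nRel T.  Then f(0) = 0, f(1) = 1, f′(0) ≥ 2, and f′(1) is the number of cut
-- vertices of T.  If there are at least two of them, then the mean slope 1 of f on [0, 1]
-- is smaller than f′(0) and f′(1).  Otherwise T is a star; then all sets containing its
-- centre and at least one further set are connected, so f(½) > ½ and the mean slope of f
-- on [½, 1] is smaller than 1 ≤ f′(1).  In both cases f″ takes a negative and then a
-- positive value at rational points a < b of [0, 1].
--
-- Bisection of [a, b] gives a root c of p = f″.  For a constructive sign change one has to
-- know which Taylor coefficients of p at c vanish.  They are values at c of rational
-- polynomials, and such a value can be decided because c is algebraic: by induction on the
-- degree of a polynomial with root c, using only division with remainder.  The first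
-- nonzero coefficient gives strict signs on both sides of c, and the signs of p at the
-- end points of the bisection intervals show that they are − on the left and + on the right.

module Submission where

open import Defs
open import Data.Bool using (true; false; if_then_else_)
open import Data.Empty using (⊥; ⊥-elim)
open import Data.Fin using (Fin; zero; suc)
import Data.Fin.Properties as Fin
open import Data.Fin.Subset as Subset using (Subset; Nonempty; ⊤; ⁅_⁆; ∁; inside; outside)
import Data.Fin.Subset.Properties as Subset
import Data.Integer as ℤ
import Data.Integer.Properties as ℤ
open import Data.List using (List; []; _∷_; _∷ʳ_; _++_; map; length; filter)
open import Data.List.Membership.Propositional using (_∈_)
import Data.List.Properties as List
open import Data.List.Relation.Unary.All using (All; []; _∷_)
import Data.List.Relation.Unary.All.Properties as All
open import Data.List.Relation.Unary.AllPairs using ([]; _∷_)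
import Data.List.Relation.Unary.Any as Any
open import Data.List.Relation.Unary.Linked using (Linked; [-]; _∷_)
open import Data.List.Relation.Unary.Unique.Propositional using (Unique)
open import Data.Nat using (ℕ; zero; suc; _≤_; _<_)
import Data.Nat as ℕ
import Data.Nat.Induction as ℕ
import Data.Nat.Properties as ℕ
open import Data.Product using (∃-syntax; _×_; _,_; proj₁; proj₂)
open import Data.Rational
  using (ℚ; mkℚ; 0ℚ; 1ℚ; ½; _+_; _*_; _-_; -_; ∣_∣; 1/_; toℚᵘ)
  renaming (_≤_ to _≤ℚ_; _<_ to _<ℚ_)
import Data.Rational as ℚ
import Data.Rational.Properties as ℚ
import Data.Rational.Unnormalised as ℚᵘ
import Data.Rational.Unnormalised.Properties as ℚᵘ
import Data.Sign as Sign
open import Data.Sign using (Sign)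
open import Data.Sum using (_⊎_; inj₁; inj₂; [_,_]′)
open import Data.Vec as Vec using (Vec; []; _∷_; there)
import Data.Vec.Properties as Vec
open import Function using (_∘_; id)
open import Relation.Binary.Construct.Closure.ReflexiveTransitive as Star
  using (Star; _◅_; _◅◅_)
open import Relation.Binary.Definitions using (Tri; tri<; tri≈; tri>)
open import Relation.Binary.PropositionalEquality
open import Relation.Nullary using (¬_; Dec; yes; no; does; contradiction)
open import Relation.Nullary.Decidable using (dec⇒maybe; decidable-stable; ¬?; _×-dec_)
open import Tactic.RingSolver using (solve-∀)
open import Tactic.RingSolver.Core.AlmostCommutativeRing
  using (AlmostCommutativeRing; fromCommutativeRing)

-- The obstacle is the notion of real number: a real is a Cauchy sequence, its order is undecidable,
-- and a strict inequality between reals has to exhibit a rational gap. A sign on one side of c is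
-- therefore useless unless it is uniform: for each δ there must be a κ such that |p| is at least κ
-- at all points whose distance from c lies between δ and a fixed radius. Such bounds are proved at
-- rational points and carried over termwise. Bisection alone does not supply them. It neither
-- isolates a root nor tells its multiplicity, and no finite precision separates a Taylor
-- coefficient that is zero from one that is merely tiny. The algebraic decision procedure exists
-- for this purpose only. The mean value theorem is affected too: it is replaced by a search for a
-- rational point with a derivative of the right sign, which is enough since only the sign is used
-- afterwards.

ℚ-ring : AlmostCommutativeRing _ _
ℚ-ring = fromCommutativeRing ℚ.+-*-commutativeRing (λ x → dec⇒maybe (0ℚ ℚ.≟ x))

-- Ordered field arithmetic

≤-cert : ∀ {a b} d → 0ℚ ≤ℚ d → b ≡ a + d → a ≤ℚ b
≤-cert {a} d 0≤d refl = subst (_≤ℚ a + d) (ℚ.+-identityʳ a) (ℚ.+-monoʳ-≤ a 0≤d)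

<-cert : ∀ {a b} d → 0ℚ <ℚ d → b ≡ a + d → a <ℚ b
<-cert {a} d 0<d refl = subst (_<ℚ a + d) (ℚ.+-identityʳ a) (ℚ.+-monoʳ-< a 0<d)

≤⇒0≤- : ∀ {a b} → a ≤ℚ b → 0ℚ ≤ℚ b - a
≤⇒0≤- {a} {b} a≤b = subst (_≤ℚ b - a) (ℚ.+-inverseʳ a) (ℚ.+-monoˡ-≤ (- a) a≤b)

<⇒0<- : ∀ {a b} → a <ℚ b → 0ℚ <ℚ b - a
<⇒0<- {a} {b} a<b = subst (_<ℚ b - a) (ℚ.+-inverseʳ a) (ℚ.+-monoˡ-< (- a) a<b)

+-nonNeg : ∀ {a b} → 0ℚ ≤ℚ a → 0ℚ ≤ℚ b → 0ℚ ≤ℚ a + b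
+-nonNeg 0≤a 0≤b = ℚ.+-mono-≤ 0≤a 0≤b

+-pos-nonNeg : ∀ {a b} → 0ℚ <ℚ a → 0ℚ ≤ℚ b → 0ℚ <ℚ a + b
+-pos-nonNeg 0<a 0≤b = ℚ.+-mono-<-≤ 0<a 0≤b

*-nonNeg : ∀ {a b} → 0ℚ ≤ℚ a → 0ℚ ≤ℚ b → 0ℚ ≤ℚ a * b
*-nonNeg {a} {b} 0≤a 0≤b = ℚ.nonNegative⁻¹ (a * b)
  {{ℚ.nonNeg*nonNeg⇒nonNeg a {{ℚ.nonNegative 0≤a}} b {{ℚ.nonNegative 0≤b}}}}

*-pos : ∀ {a b} → 0ℚ <ℚ a → 0ℚ <ℚ b → 0ℚ <ℚ a * b
*-pos {a} {b} 0<a 0<b = ℚ.positive⁻¹ (a * b)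
  {{ℚ.pos*pos⇒pos a {{ℚ.positive 0<a}} b {{ℚ.positive 0<b}}}}

*-monoʳ : ∀ {a b c} → 0ℚ ≤ℚ a → b ≤ℚ c → a * b ≤ℚ a * c
*-monoʳ {a} 0≤a = ℚ.*-monoˡ-≤-nonNeg a {{ℚ.nonNegative 0≤a}}

*-mono : ∀ {a b c d} → 0ℚ ≤ℚ a → 0ℚ ≤ℚ d → a ≤ℚ b → c ≤ℚ d → a * c ≤ℚ b * d
*-mono {a} {d = d} 0≤a 0≤d a≤b c≤d =
  ℚ.≤-trans (*-monoʳ 0≤a c≤d) (ℚ.*-monoʳ-≤-nonNeg d {{ℚ.nonNegative 0≤d}} a≤b)

*-cancelˡ-≤ : ∀ {a b c} → 0ℚ <ℚ a → a * b ≤ℚ a * c → b ≤ℚ c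
*-cancelˡ-≤ {a} 0<a = ℚ.*-cancelˡ-≤-pos a {{ℚ.positive 0<a}}

0<1 : 0ℚ <ℚ 1ℚ
0<1 = ℚ.positive⁻¹ 1ℚ

0≤1 : 0ℚ ≤ℚ 1ℚ
0≤1 = ℚ.<⇒≤ 0<1

0<½ : 0ℚ <ℚ ½
0<½ = ℚ.positive⁻¹ ½

half-pos : ∀ {a} → 0ℚ <ℚ a → 0ℚ <ℚ ½ * a
half-pos = *-pos 0<½

≤∣∣ : ∀ a → a ≤ℚ ∣ a ∣
≤∣∣ a with ℚ.≤-total 0ℚ a
... | inj₁ 0≤a = ℚ.≤-reflexive (sym (ℚ.0≤p⇒∣p∣≡p 0≤a))
... | inj₂ a≤0 = ℚ.≤-trans a≤0 (ℚ.0≤∣p∣ a)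

-≤∣∣ : ∀ a → - a ≤ℚ ∣ a ∣
-≤∣∣ a = subst (- a ≤ℚ_) (ℚ.∣-p∣≡∣p∣ a) (≤∣∣ (- a))

∣∣≤ : ∀ {a b} → a ≤ℚ b → - a ≤ℚ b → ∣ a ∣ ≤ℚ b
∣∣≤ {a} {b} a≤b -a≤b with ℚ.∣p∣≡p∨∣p∣≡-p a
... | inj₁ eq = subst (_≤ℚ b) (sym eq) a≤b
... | inj₂ eq = subst (_≤ℚ b) (sym eq) -a≤b

∣*∣≤ : ∀ {a b c d} → ∣ a ∣ ≤ℚ c → ∣ b ∣ ≤ℚ d → ∣ a * b ∣ ≤ℚ c * d
∣*∣≤ {a} {b} {c} {d} a≤c b≤d = subst (_≤ℚ c * d) (sym (ℚ.∣p*q∣≡∣p∣*∣q∣ a b))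
  (*-mono (ℚ.0≤∣p∣ a) (ℚ.≤-trans (ℚ.0≤∣p∣ b) b≤d) a≤c b≤d)

∣+∣≤ : ∀ {a b c d} → ∣ a ∣ ≤ℚ c → ∣ b ∣ ≤ℚ d → ∣ a + b ∣ ≤ℚ c + d
∣+∣≤ {a} {b} a≤c b≤d = ℚ.≤-trans (ℚ.∣p+q∣≤∣p∣+∣q∣ a b) (ℚ.+-mono-≤ a≤c b≤d)

abstract
  reciprocal : ∀ {a} → a ≢ 0ℚ → ∃[ b ] a * b ≡ 1ℚ
  reciprocal {a} a≢0 = 1/_ a {{ℚ.≢-nonZero a≢0}} , ℚ.*-inverseʳ a {{ℚ.≢-nonZero a≢0}}

abstract
  pos-reciprocal : ∀ {a} → 0ℚ <ℚ a → ∃[ b ] (0ℚ <ℚ b × a * b ≡ 1ℚ)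
  pos-reciprocal {a} 0<a = 1/_ a {{nz}} ,
    ℚ.positive⁻¹ (1/_ a {{nz}}) {{ℚ.1/pos⇒pos a {{ℚ.positive 0<a}}}} , ℚ.*-inverseʳ a {{nz}}
    where
    nz : ℚ.NonZero a
    nz = ℚ.pos⇒nonZero a {{ℚ.positive 0<a}}

abstract
  scale-down : ∀ {A ε} → 0ℚ <ℚ A → 0ℚ <ℚ ε → ∃[ η ] (0ℚ <ℚ η × A * η ≡ ε)
  scale-down {A} {ε} 0<A 0<ε with pos-reciprocal 0<A
  ... | b , 0<b , Ab≡1 = b * ε , *-pos 0<b 0<ε ,
    trans (sym (ℚ.*-assoc A b ε)) (trans (cong (_* ε) Ab≡1) (ℚ.*-identityˡ ε))

*-≢0 : ∀ {a b} → a ≢ 0ℚ → b ≢ 0ℚ → a * b ≢ 0ℚ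
*-≢0 {a} {b} a≢0 b≢0 ab≡0 with reciprocal a≢0
... | c , ac≡1 = b≢0 (begin
  b             ≡⟨ ℚ.*-identityˡ b ⟨
  1ℚ * b        ≡⟨ cong (_* b) ac≡1 ⟨
  (a * c) * b   ≡⟨ regroup a b c ⟩
  c * (a * b)   ≡⟨ cong (c *_) ab≡0 ⟩
  c * 0ℚ        ≡⟨ ℚ.*-zeroʳ c ⟩
  0ℚ            ∎)
  where
  open ≡-Reasoning
  regroup : ∀ a b c → (a * c) * b ≡ c * (a * b)
  regroup = solve-∀ ℚ-ring

fromℕ : ℕ → ℚ
fromℕ zero    = 0ℚ
fromℕ (suc n) = 1ℚ + fromℕ n

fromℕ-nonNeg : ∀ n → 0ℚ ≤ℚ fromℕ n
fromℕ-nonNeg zero    = ℚ.≤-refl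
fromℕ-nonNeg (suc n) = +-nonNeg 0≤1 (fromℕ-nonNeg n)

fromℕ-mono : ∀ {m n} → m ≤ n → fromℕ m ≤ℚ fromℕ n
fromℕ-mono {n = n} ℕ.z≤n = fromℕ-nonNeg n
fromℕ-mono (ℕ.s≤s m≤n)   = ℚ.+-monoʳ-≤ 1ℚ (fromℕ-mono m≤n)

toℚᵘ-fromℕ : ∀ n → toℚᵘ (fromℕ n) ℚᵘ.≃ ℚᵘ.mkℚᵘ (ℤ.+ n) 0
toℚᵘ-fromℕ zero    = ℚᵘ.≃-refl
toℚᵘ-fromℕ (suc n) = ℚᵘ.≃-trans (ℚ.toℚᵘ-homo-+ 1ℚ (fromℕ n))
  (ℚᵘ.≃-trans (ℚᵘ.+-congʳ ℚᵘ.1ℚᵘ (toℚᵘ-fromℕ n))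
    (ℚᵘ.*≡* (cong (λ k → (ℤ.1ℤ ℤ.+ k) ℤ.* ℤ.1ℤ) (ℤ.*-identityʳ (ℤ.+ n)))))

abstract
  archimedean : ∀ {ε} → 0ℚ <ℚ ε → ∃[ N ] 1ℚ ≤ℚ fromℕ N * ε
  archimedean {mkℚ (ℤ.+ zero) _ _} (ℚ.*<* (ℤ.+<+ ()))
  archimedean {mkℚ ℤ.-[1+ _ ] _ _} (ℚ.*<* ())
  -- The denominator of ε serves as N: the product is then the numerator, which is at least 1.
  archimedean {ε@(mkℚ (ℤ.+ (suc a)) d _)} _ = suc d , ℚ.toℚᵘ-cancel-≤
    (ℚᵘ.≤-respʳ-≃ (ℚᵘ.≃-sym (ℚᵘ.≃-trans (ℚ.toℚᵘ-homo-* (fromℕ (suc d)) ε)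
        (ℚᵘ.*-congʳ {toℚᵘ ε} (toℚᵘ-fromℕ (suc d)))))
      (ℚᵘ.*≤* (ℤ.+≤+ (subst₂ _≤_ (sym (ℕ.+-identityʳ _)) (sym (ℕ.*-identityʳ _)) bound))))
    where
    bound : 1 ℕ.* suc d ≤ suc d ℕ.* suc a
    bound = subst (_≤ suc d ℕ.* suc a) (sym (ℕ.*-identityˡ (suc d))) (ℕ.m≤m*n (suc d) (suc a))

-- Evaluation and calculus of polynomials at rational points

ev : Poly → ℚ → ℚ
ev []      t = 0ℚ
ev (a ∷ p) t = a + t * ev p t

-- This lets every estimate be made at rational points.
eval-seq : ∀ p x n → seq (eval p x) n ≡ ev p (seq x n)
eval-seq []      x n = refl
eval-seq (a ∷ p) x n = cong (λ v → a + seq x n * v) (eval-seq p x n)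

ev-⊕ : ∀ p q t → ev (p ⊕ q) t ≡ ev p t + ev q t
ev-⊕ []      q       t = sym (ℚ.+-identityˡ (ev q t))
ev-⊕ (a ∷ p) []      t = sym (ℚ.+-identityʳ (ev (a ∷ p) t))
ev-⊕ (a ∷ p) (b ∷ q) t =
  trans (cong (λ v → a + b + t * v) (ev-⊕ p q t)) (regroup a b t (ev p t) (ev q t))
  where
  regroup : ∀ a b t x y → a + b + t * (x + y) ≡ a + t * x + (b + t * y)
  regroup = solve-∀ ℚ-ring

ev-· : ∀ a p t → ev (a · p) t ≡ a * ev p t
ev-· a []      t = sym (ℚ.*-zeroʳ a)
ev-· a (b ∷ p) t =
  trans (cong (λ v → a * b + t * v) (ev-· a p t)) (regroup a b t (ev p t))
  where
  regroup : ∀ a b t x → a * b + t * (a * x) ≡ a * (b + t * x)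
  regroup = solve-∀ ℚ-ring

ev-⊗ : ∀ p q t → ev (p ⊗ q) t ≡ ev p t * ev q t
ev-⊗ []      q t = sym (ℚ.*-zeroˡ (ev q t))
ev-⊗ (a ∷ p) q t = begin
  ev (a · q ⊕ (0ℚ ∷ p ⊗ q)) t                ≡⟨ ev-⊕ (a · q) (0ℚ ∷ p ⊗ q) t ⟩
  ev (a · q) t + (0ℚ + t * ev (p ⊗ q) t)     ≡⟨ cong₂ (λ u v → u + (0ℚ + t * v)) (ev-· a q t) (ev-⊗ p q t) ⟩
  a * ev q t + (0ℚ + t * (ev p t * ev q t))  ≡⟨ regroup a t (ev p t) (ev q t) ⟩
  (a + t * ev p t) * ev q t                  ∎
  where
  open ≡-Reasoning
  regroup : ∀ a t x y → a * y + (0ℚ + t * (x * y)) ≡ (a + t * x) * y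
  regroup = solve-∀ ℚ-ring

ev′ : Poly → ℚ → ℚ
ev′ p = ev (deriv p)

ev′-∷ : ∀ a p t → ev′ (a ∷ p) t ≡ ev p t + t * ev′ p t
ev′-∷ a p t = trans (ev-⊕ p (0ℚ ∷ deriv p) t) (cong (ev p t +_) (ℚ.+-identityˡ (t * ev′ p t)))

ev′-⊕ : ∀ p q t → ev′ (p ⊕ q) t ≡ ev′ p t + ev′ q t
ev′-⊕ []      q       t = sym (ℚ.+-identityˡ (ev′ q t))
ev′-⊕ (a ∷ p) []      t = sym (ℚ.+-identityʳ (ev′ (a ∷ p) t))
ev′-⊕ (a ∷ p) (b ∷ q) t = begin
  ev′ (a + b ∷ p ⊕ q) t                                 ≡⟨ ev′-∷ (a + b) (p ⊕ q) t ⟩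
  ev (p ⊕ q) t + t * ev′ (p ⊕ q) t                      ≡⟨ cong₂ (λ u v → u + t * v) (ev-⊕ p q t) (ev′-⊕ p q t) ⟩
  ev p t + ev q t + t * (ev′ p t + ev′ q t)             ≡⟨ regroup t (ev p t) (ev q t) (ev′ p t) (ev′ q t) ⟩
  ev p t + t * ev′ p t + (ev q t + t * ev′ q t)         ≡⟨ cong₂ _+_ (ev′-∷ a p t) (ev′-∷ b q t) ⟨
  ev′ (a ∷ p) t + ev′ (b ∷ q) t                         ∎
  where
  open ≡-Reasoning
  regroup : ∀ t x y u v → x + y + t * (u + v) ≡ x + t * u + (y + t * v)
  regroup = solve-∀ ℚ-ring

ev′-· : ∀ a p t → ev′ (a · p) t ≡ a * ev′ p t
ev′-· a []      t = sym (ℚ.*-zeroʳ a)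
ev′-· a (b ∷ p) t = begin
  ev′ (a * b ∷ a · p) t              ≡⟨ ev′-∷ (a * b) (a · p) t ⟩
  ev (a · p) t + t * ev′ (a · p) t   ≡⟨ cong₂ (λ u v → u + t * v) (ev-· a p t) (ev′-· a p t) ⟩
  a * ev p t + t * (a * ev′ p t)     ≡⟨ regroup a t (ev p t) (ev′ p t) ⟩
  a * (ev p t + t * ev′ p t)         ≡⟨ cong (a *_) (ev′-∷ b p t) ⟨
  a * ev′ (b ∷ p) t                  ∎
  where
  open ≡-Reasoning
  regroup : ∀ a t x y → a * x + t * (a * y) ≡ a * (x + t * y)
  regroup = solve-∀ ℚ-ring

ev′-⊗ : ∀ p q t → ev′ (p ⊗ q) t ≡ ev′ p t * ev q t + ev p t * ev′ q t
ev′-⊗ []      q t = zeros (ev q t) (ev′ q t)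
  where
  zeros : ∀ x y → 0ℚ ≡ 0ℚ * x + 0ℚ * y
  zeros = solve-∀ ℚ-ring
ev′-⊗ (a ∷ p) q t = begin
  ev′ (a · q ⊕ (0ℚ ∷ p ⊗ q)) t
    ≡⟨ ev′-⊕ (a · q) (0ℚ ∷ p ⊗ q) t ⟩
  ev′ (a · q) t + ev′ (0ℚ ∷ p ⊗ q) t
    ≡⟨ cong₂ _+_ (ev′-· a q t) (ev′-∷ 0ℚ (p ⊗ q) t) ⟩
  a * ev′ q t + (ev (p ⊗ q) t + t * ev′ (p ⊗ q) t)
    ≡⟨ cong₂ (λ u v → a * ev′ q t + (u + t * v)) (ev-⊗ p q t) (ev′-⊗ p q t) ⟩
  a * ev′ q t + (ev p t * ev q t + t * (ev′ p t * ev q t + ev p t * ev′ q t))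
    ≡⟨ regroup a t (ev p t) (ev q t) (ev′ p t) (ev′ q t) ⟩
  (ev p t + t * ev′ p t) * ev q t + (a + t * ev p t) * ev′ q t
    ≡⟨ cong (λ u → u * ev q t + ev (a ∷ p) t * ev′ q t) (ev′-∷ a p t) ⟨
  ev′ (a ∷ p) t * ev q t + ev (a ∷ p) t * ev′ q t ∎
  where
  open ≡-Reasoning
  regroup : ∀ a t x y u v →
    a * v + (x * y + t * (u * y + x * v)) ≡ (x + t * u) * y + (a + t * x) * v
  regroup = solve-∀ ℚ-ring

-- Lipschitz and tangent estimates on the unit interval

Unit : ℚ → Set
Unit t = 0ℚ ≤ℚ t × t ≤ℚ 1ℚ

Unit⇒∣∣≤1 : ∀ {t} → Unit t → ∣ t ∣ ≤ℚ 1ℚ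
Unit⇒∣∣≤1 (0≤t , t≤1) = subst (_≤ℚ 1ℚ) (sym (ℚ.0≤p⇒∣p∣≡p 0≤t)) t≤1

norm : Poly → ℚ
norm []      = 0ℚ
norm (a ∷ p) = ∣ a ∣ + norm p

∣ev∣≤norm : ∀ p {t} → ∣ t ∣ ≤ℚ 1ℚ → ∣ ev p t ∣ ≤ℚ norm p
∣ev∣≤norm []      _   = ℚ.≤-refl
∣ev∣≤norm (a ∷ p) {t} t≤1 = subst (λ b → ∣ ev (a ∷ p) t ∣ ≤ℚ ∣ a ∣ + b) (ℚ.*-identityˡ (norm p))
  (∣+∣≤ {a} {t * ev p t} ℚ.≤-refl (∣*∣≤ t≤1 (∣ev∣≤norm p t≤1)))

norm-nonNeg : ∀ p → 0ℚ ≤ℚ norm p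
norm-nonNeg []      = ℚ.≤-refl
norm-nonNeg (a ∷ p) = +-nonNeg (ℚ.0≤∣p∣ a) (norm-nonNeg p)

-- Lipschitz constant on [0, 1] from the Horner step: for a + X q the difference of values is y
-- (q(y) - q(x)) + (y - x) q(x).
lip : Poly → ℚ
lip []      = 0ℚ
lip (a ∷ p) = lip p + norm p

lip-nonNeg : ∀ p → 0ℚ ≤ℚ lip p
lip-nonNeg []      = ℚ.≤-refl
lip-nonNeg (a ∷ p) = +-nonNeg (lip-nonNeg p) (norm-nonNeg p)

lipschitz : ∀ p {x y} → Unit x → Unit y → ∣ ev p y - ev p x ∣ ≤ℚ lip p * ∣ y - x ∣
lipschitz []      {x} {y} _ _ = ℚ.≤-reflexive (sym (ℚ.*-zeroˡ ∣ y - x ∣))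
lipschitz (a ∷ p) {x} {y} ux uy =
  subst₂ _≤ℚ_ (cong ∣_∣ (expand a x y (ev p x) (ev p y))) (factor (lip p) (norm p) ∣ y - x ∣)
    (∣+∣≤ (∣*∣≤ (Unit⇒∣∣≤1 uy) (lipschitz p ux uy))
          (∣*∣≤ {c = ∣ y - x ∣} ℚ.≤-refl (∣ev∣≤norm p (Unit⇒∣∣≤1 ux))))
  where
  expand : ∀ a x y u v → y * (v - u) + (y - x) * u ≡ a + y * v - (a + x * u)
  expand = solve-∀ ℚ-ring
  factor : ∀ l n d → 1ℚ * (l * d) + d * n ≡ (l + n) * d
  factor = solve-∀ ℚ-ring

-- Constant of the quadratic tangent error: the error of a + X q is y times that of q plus (y - x)²
-- q′(x).
lip₂ : Poly → ℚ
lip₂ []      = 0ℚ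
lip₂ (a ∷ p) = lip₂ p + norm (deriv p)

lip₂-nonNeg : ∀ p → 0ℚ ≤ℚ lip₂ p
lip₂-nonNeg []      = ℚ.≤-refl
lip₂-nonNeg (a ∷ p) = +-nonNeg (lip₂-nonNeg p) (norm-nonNeg (deriv p))

tangent-error : ∀ p {x y} → Unit x → Unit y →
  ∣ ev p y - ev p x - (y - x) * ev′ p x ∣ ≤ℚ lip₂ p * (∣ y - x ∣ * ∣ y - x ∣)
tangent-error []      {x} {y} _ _ =
  ℚ.≤-reflexive (trans (cong ∣_∣ (vanish (y - x))) (sym (ℚ.*-zeroˡ (∣ y - x ∣ * ∣ y - x ∣))))
  where
  vanish : ∀ d → 0ℚ - 0ℚ - d * 0ℚ ≡ 0ℚ
  vanish = solve-∀ ℚ-ring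
tangent-error (a ∷ p) {x} {y} ux uy =
  subst₂ _≤ℚ_
    (cong ∣_∣ (trans (expand a x y (ev p x) (ev p y) (ev′ p x))
      (cong (λ d → ev (a ∷ p) y - ev (a ∷ p) x - (y - x) * d) (sym (ev′-∷ a p x)))))
    (factor (lip₂ p) (norm (deriv p)) ∣ y - x ∣)
    (∣+∣≤ (∣*∣≤ (Unit⇒∣∣≤1 uy) (tangent-error p ux uy))
          (∣*∣≤ (∣*∣≤ {y - x} {y - x} ℚ.≤-refl ℚ.≤-refl) (∣ev∣≤norm (deriv p) (Unit⇒∣∣≤1 ux))))
  where
  expand : ∀ a x y u v d →
    y * (v - u - (y - x) * d) + (y - x) * (y - x) * d ≡
    a + y * v - (a + x * u) - (y - x) * (u + x * d)
  expand = solve-∀ ℚ-ring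
  factor : ∀ l n d → 1ℚ * (l * (d * d)) + d * d * n ≡ (l + n) * (d * d)
  factor = solve-∀ ℚ-ring

-- A rational substitute for the mean value theorem

steeper-part : ∀ κ x m z u v w → κ * (z - x) ≤ℚ w - u →
  κ * (m - x) ≤ℚ v - u ⊎ κ * (z - m) ≤ℚ w - v
steeper-part κ x m z u v w steep with ℚ.≤-total (κ * (m - x)) (v - u)
... | inj₁ left = inj₁ left
... | inj₂ flat = inj₂ (≤-cert (w - u - κ * (z - x) + (κ * (m - x) - (v - u)))
  (+-nonNeg (≤⇒0≤- steep) (≤⇒0≤- flat)) (expand κ x m z u v w))
  where
  expand : ∀ κ x m z u v w →
    w - v ≡ κ * (z - m) + (w - u - κ * (z - x) + (κ * (m - x) - (v - u)))
  expand = solve-∀ ℚ-ring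

abstract
  midpoint : ∀ {x z} → x <ℚ z →
    ∃[ m ] (x <ℚ m × m <ℚ z × m - x ≡ ½ * (z - x) × z - m ≡ ½ * (z - x))
  midpoint {x} {z} x<z = ½ * (x + z) ,
    <-cert (½ * (z - x)) (half-pos (<⇒0<- x<z)) (lower x z) ,
    <-cert (½ * (z - x)) (half-pos (<⇒0<- x<z)) (upper x z) , left x z , right x z
    where
    lower : ∀ x z → ½ * (x + z) ≡ x + ½ * (z - x)
    lower = solve-∀ ℚ-ring
    upper : ∀ x z → z ≡ ½ * (x + z) + ½ * (z - x)
    upper = solve-∀ ℚ-ring
    left : ∀ x z → ½ * (x + z) - x ≡ ½ * (z - x)
    left = solve-∀ ℚ-ring
    right : ∀ x z → z - ½ * (x + z) ≡ ½ * (z - x)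
    right = solve-∀ ℚ-ring

narrow-half : ∀ N {w w′} → 0ℚ ≤ℚ w → w′ ≡ ½ * w → fromℕ (suc N) * w ≤ℚ 1ℚ →
  fromℕ (suc (suc N)) * w′ ≤ℚ 1ℚ
narrow-half N {w} 0≤w refl small = ℚ.≤-trans
  (≤-cert (½ * fromℕ N * w) (*-nonNeg (*-nonNeg (ℚ.<⇒≤ 0<½) (fromℕ-nonNeg N)) 0≤w)
    (expand (fromℕ N) w))
  small
  where
  expand : ∀ n w → (1ℚ + n) * w ≡ (1ℚ + (1ℚ + n)) * (½ * w) + ½ * n * w
  expand = solve-∀ ℚ-ring

-- Obtained by halving and keeping a half whose mean slope is still at least κ. Halving would give
-- width 2⁻ᴺ; the weaker 1/(N + 1) is recorded because it can be compared directly with the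
-- Archimedean property.
SteepSubinterval : (ℚ → ℚ) → ℚ → ℚ → ℚ → ℕ → Set
SteepSubinterval F κ x z N = ∃[ x′ ] ∃[ z′ ] (x ≤ℚ x′ × x′ <ℚ z′ × z′ ≤ℚ z
  × κ * (z′ - x′) ≤ℚ F z′ - F x′ × fromℕ (suc N) * (z′ - x′) ≤ℚ 1ℚ)

steep-half : ∀ F {κ x z} N → x <ℚ z → κ * (z - x) ≤ℚ F z - F x →
  fromℕ (suc N) * (z - x) ≤ℚ 1ℚ → SteepSubinterval F κ x z (suc N)
steep-half F {κ} {x} {z} N x<z steep small =
  choose (midpoint x<z)
  where
  0≤w : 0ℚ ≤ℚ z - x
  0≤w = ℚ.<⇒≤ (<⇒0<- x<z)

  choose : ∃[ m ] (x <ℚ m × m <ℚ z × m - x ≡ ½ * (z - x) × z - m ≡ ½ * (z - x)) →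
    SteepSubinterval F κ x z (suc N)
  choose (m , x<m , m<z , m-x , z-m) =
    [ (λ left → x , m , ℚ.≤-refl , x<m , ℚ.<⇒≤ m<z , left ,
        narrow-half N {z - x} {m - x} 0≤w m-x small)
    , (λ right → m , z , ℚ.<⇒≤ x<m , m<z , ℚ.≤-refl , right ,
        narrow-half N {z - x} {z - m} 0≤w z-m small)
    ]′ (steeper-part κ x m z (F x) (F m) (F z) steep)

steep-refine : ∀ F {κ x z} N → SteepSubinterval F κ x z N → SteepSubinterval F κ x z (suc N)
steep-refine F {κ} N (x₁ , z₁ , x≤x₁ , x₁<z₁ , z₁≤z , steep₁ , small₁) =
  let x₂ , z₂ , x₁≤x₂ , x₂<z₂ , z₂≤z₁ , steep₂ , small₂ =
        steep-half F {κ} {x₁} {z₁} N x₁<z₁ steep₁ small₁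
  in x₂ , z₂ , ℚ.≤-trans x≤x₁ x₁≤x₂ , x₂<z₂ , ℚ.≤-trans z₂≤z₁ z₁≤z , steep₂ , small₂

steep-subinterval : ∀ F {κ x z} N → x <ℚ z → z - x ≤ℚ 1ℚ → κ * (z - x) ≤ℚ F z - F x →
  SteepSubinterval F κ x z N
steep-subinterval F {x = x} {z} zero x<z w≤1 steep =
  x , z , ℚ.≤-refl , x<z , ℚ.≤-refl , steep , subst (_≤ℚ 1ℚ) (sym (ℚ.*-identityˡ (z - x))) w≤1
steep-subinterval F {κ} {x} {z} (suc N) x<z w≤1 steep =
  steep-refine F {κ} {x} {z} N (steep-subinterval F {κ} {x} {z} N x<z w≤1 steep)

-- For width h ≤ η the tangent error costs at most `lip₂ p` · η in slope, so a chord of slope (1 +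
-- `lip₂ p`) η leaves at least η for the derivative.
steep⇒deriv-large : ∀ p {x z κ η} → 0ℚ ≤ℚ x → x <ℚ z → z ≤ℚ 1ℚ → (1ℚ + lip₂ p) * η ≡ κ →
  z - x ≤ℚ η → κ * (z - x) ≤ℚ ev p z - ev p x → η ≤ℚ ev′ p x
steep⇒deriv-large p {x} {z} {_} {η} 0≤x x<z z≤1 refl h≤η steep =
  *-cancelˡ-≤ {h} {η} {ev′ p x} 0<h
    (≤-cert (K * (h * h) - (Δ - h * ev′ p x) + (Δ - (1ℚ + K) * η * h) + K * h * (η - h))
      (+-nonNeg (+-nonNeg (≤⇒0≤- error) (≤⇒0≤- steep))
        (*-nonNeg (*-nonNeg (lip₂-nonNeg p) (ℚ.<⇒≤ 0<h)) (≤⇒0≤- h≤η)))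
      (expand K h η (ev′ p x) Δ))
  where
  h K Δ : ℚ
  h = z - x
  K = lip₂ p
  Δ = ev p z - ev p x

  0<h : 0ℚ <ℚ h
  0<h = <⇒0<- x<z

  error : Δ - h * ev′ p x ≤ℚ K * (h * h)
  error = subst (λ d → Δ - h * ev′ p x ≤ℚ K * (d * d))
    (ℚ.0≤p⇒∣p∣≡p (ℚ.<⇒≤ 0<h))
    (ℚ.≤-trans (≤∣∣ (Δ - h * ev′ p x)) (tangent-error p {x} {z}
      (0≤x , ℚ.≤-trans (ℚ.<⇒≤ x<z) z≤1) (ℚ.≤-trans 0≤x (ℚ.<⇒≤ x<z) , z≤1)))

  expand : ∀ K h η d Δ →
    h * d ≡ h * η + (K * (h * h) - (Δ - h * d) + (Δ - (1ℚ + K) * η * h) + K * h * (η - h))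
  expand = solve-∀ ℚ-ring

archimedean-≤ : ∀ N {h η} → 0ℚ ≤ℚ η → 1ℚ ≤ℚ fromℕ N * η → fromℕ (suc N) * h ≤ℚ 1ℚ → h ≤ℚ η
archimedean-≤ N {h} {η} 0≤η 1≤Nη small =
  *-cancelˡ-≤ {fromℕ (suc N)} {h} {η} (+-pos-nonNeg 0<1 (fromℕ-nonNeg N))
    (ℚ.≤-trans small (ℚ.≤-trans 1≤Nη (≤-cert η 0≤η (expand (fromℕ N) η))))
  where
  expand : ∀ n η → (1ℚ + n) * η ≡ n * η + η
  expand = solve-∀ ℚ-ring

-- Take κ to be the mean slope and η = κ / (1 + `lip₂ p`). A subinterval of width at most η and
-- slope at least κ has derivative at least η at its left end.
increase⇒0<ev′ : ∀ p {x z} → 0ℚ ≤ℚ x → x <ℚ z → z ≤ℚ 1ℚ → ev p x <ℚ ev p z →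
  ∃[ b ] (x ≤ℚ b × b ≤ℚ z × 0ℚ <ℚ ev′ p b)
increase⇒0<ev′ p {x} {z} 0≤x x<z z≤1 px<pz =
  let κ , 0<κ , wκ≡Δ = scale-down {z - x} {ev p z - ev p x} (<⇒0<- x<z) (<⇒0<- px<pz)
      η , 0<η , Kη≡κ = scale-down {1ℚ + lip₂ p} {κ} (+-pos-nonNeg 0<1 (lip₂-nonNeg p)) 0<κ
      N , 1≤Nη = archimedean 0<η
      x′ , z′ , x≤x′ , x′<z′ , z′≤z , steep , small =
        steep-subinterval (ev p) {κ} {x} {z} N x<z
          (≤-cert (1ℚ - z + x) (+-nonNeg (≤⇒0≤- z≤1) 0≤x) (split x z))
          (ℚ.≤-reflexive (trans (ℚ.*-comm κ (z - x)) wκ≡Δ))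
  in x′ , x≤x′ , ℚ.≤-trans (ℚ.<⇒≤ x′<z′) z′≤z ,
     ℚ.<-≤-trans 0<η (steep⇒deriv-large p {x′} {z′} {κ} {η} (ℚ.≤-trans 0≤x x≤x′) x′<z′
       (ℚ.≤-trans z′≤z z≤1) Kη≡κ (archimedean-≤ N (ℚ.<⇒≤ 0<η) 1≤Nη small) steep)
  where
  split : ∀ x z → 1ℚ ≡ z - x + (1ℚ - z + x)
  split = solve-∀ ℚ-ring

-- Bracketing a sign change

-- Synthetic division: the entries are the intermediate values of Horner's scheme. Dividing `a ∷ p`
-- by X - m gives `quotient m p`, because a cancels in the difference from the value at m.
quotient : ℚ → Poly → Poly
quotient m []      = []
quotient m (a ∷ p) = ev (a ∷ p) m ∷ quotient m p

length-quotient : ∀ m p → length (quotient m p) ≡ length p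
length-quotient m []      = refl
length-quotient m (a ∷ p) = cong suc (length-quotient m p)

ev-quotient : ∀ m a p t → ev (a ∷ p) t - ev (a ∷ p) m ≡ (t - m) * ev (quotient m p) t
ev-quotient m a []      t = constant a m t
  where
  constant : ∀ a m t → a + t * 0ℚ - (a + m * 0ℚ) ≡ (t - m) * 0ℚ
  constant = solve-∀ ℚ-ring
ev-quotient m a (b ∷ p) t = begin
  a + t * P t - (a + m * P m)                            ≡⟨ expand a m t (P t) (P m) ⟩
  (t - m) * P m + t * (P t - P m)                        ≡⟨ cong (λ d → (t - m) * P m + t * d) (ev-quotient m b p t) ⟩
  (t - m) * P m + t * ((t - m) * ev (quotient m p) t)    ≡⟨ factor m t (P m) (ev (quotient m p) t) ⟩
  (t - m) * (P m + t * ev (quotient m p) t)              ∎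
  where
  open ≡-Reasoning
  P : ℚ → ℚ
  P = ev (b ∷ p)
  expand : ∀ a m t u v → a + t * u - (a + m * v) ≡ (t - m) * v + t * (u - v)
  expand = solve-∀ ℚ-ring
  factor : ∀ m t v w → (t - m) * v + t * ((t - m) * w) ≡ (t - m) * (v + t * w)
  factor = solve-∀ ℚ-ring

<⇒-≢0 : ∀ {a b} → a <ℚ b → b - a ≢ 0ℚ
<⇒-≢0 {a} {b} a<b eq = ℚ.<-irrefl (sym eq) (<⇒0<- a<b)

abstract
  -- If the midpoint m is a root, X - m is divided out and the search goes on to the right of m,
  -- where t - m cannot vanish. The quotient is still nonzero at `t₀` and is shorter, so the search
  -- ends.
  nonroot : ∀ p {t₀} → ev p t₀ ≢ 0ℚ → ∀ {x y} → x <ℚ y → ∃[ t ] (x <ℚ t × t <ℚ y × ev p t ≢ 0ℚ)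
  nonroot p = go (length p) p refl
    where
    go : ∀ n p → length p ≡ n → ∀ {t₀} → ev p t₀ ≢ 0ℚ → ∀ {x y} → x <ℚ y →
         ∃[ t ] (x <ℚ t × t <ℚ y × ev p t ≢ 0ℚ)
    go _       []      _  pt₀≢0 _ = contradiction refl pt₀≢0
    go (suc n) (a ∷ p) eq {t₀} pt₀≢0 {x} {y} x<y =
      let m , x<m , m<y , _ = midpoint x<y in try m x<m m<y (ev (a ∷ p) m ℚ.≟ 0ℚ)
      where
      try : ∀ m → x <ℚ m → m <ℚ y → Dec (ev (a ∷ p) m ≡ 0ℚ) →
            ∃[ t ] (x <ℚ t × t <ℚ y × ev (a ∷ p) t ≢ 0ℚ)
      try m x<m m<y (no pm≢0)  = m , x<m , m<y , pm≢0
      try m x<m m<y (yes pm≡0) =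
        let t , m<t , t<y , qt≢0 = go n (quotient m p)
                                     (trans (length-quotient m p) (ℕ.suc-injective eq)) {t₀} qt₀≢0 m<y
        in t , ℚ.<-trans x<m m<t , t<y ,
           λ pt≡0 → *-≢0 (<⇒-≢0 m<t) qt≢0 (trans (sym (factorise t)) pt≡0)
        where
        factorise : ∀ t → ev (a ∷ p) t ≡ (t - m) * ev (quotient m p) t
        factorise t = trans (sym (drop (ev (a ∷ p) t)))
          (trans (cong (λ v → ev (a ∷ p) t - v) (sym pm≡0)) (ev-quotient m a p t))
          where
          drop : ∀ v → v - 0ℚ ≡ v
          drop = solve-∀ ℚ-ring
        qt₀≢0 : ev (quotient m p) t₀ ≢ 0ℚ
        qt₀≢0 qt₀≡0 = pt₀≢0 (trans (factorise t₀) (trans (cong ((t₀ - m) *_) qt₀≡0) (ℚ.*-zeroʳ (t₀ - m))))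

record Bracket (p : Poly) : Set where
  field
    lo hi : ℚ
    0≤lo  : 0ℚ ≤ℚ lo
    lo<hi : lo <ℚ hi
    hi≤1  : hi ≤ℚ 1ℚ
    neg   : ev p lo <ℚ 0ℚ
    pos   : 0ℚ <ℚ ev p hi

  width : ℚ
  width = hi - lo

  0<width : 0ℚ <ℚ width
  0<width = <⇒0<- lo<hi

  unit-lo : Unit lo
  unit-lo = 0≤lo , ℚ.≤-trans (ℚ.<⇒≤ lo<hi) hi≤1

  unit-hi : Unit hi
  unit-hi = ℚ.≤-trans 0≤lo (ℚ.<⇒≤ lo<hi) , hi≤1

open Bracket

¾ : ℚ
¾ = ½ + ½ * ½

-- Cutting at a point of the middle half (rather than at the midpoint) makes
-- it possible to avoid the roots of p.
record Refinement {p} (b : Bracket p) : Set where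
  field
    refined : Bracket p
    lo-mono : lo b ≤ℚ lo refined
    hi-mono : hi refined ≤ℚ hi b
    shrink  : width refined ≤ℚ ¾ * width b

open Refinement

refine : ∀ {p} (b : Bracket p) → Refinement b
refine {p} b =
  let m , l<m , m<r , m-l , r-m = midpoint (lo<hi b)
      -- `x` and `y` are the quarter points; a cut between them leaves at most three quarters of the
      -- width on either side.
      x , l<x , x<m , _ , m-x = midpoint l<m
      y , m<y , y<r , y-m , _ = midpoint m<r
      t , x<t , t<y , pt≢0 = nonroot p {lo b} (λ eq → ℚ.<-irrefl eq (neg b)) (ℚ.<-trans x<m m<y)
  in cut t (ℚ.<-trans l<x x<t) (ℚ.<-trans t<y y<r)
       (left-part m-l y-m (ℚ.<⇒≤ t<y)) (right-part r-m m-x (ℚ.<⇒≤ x<t))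
       pt≢0 (ℚ.<-cmp (ev p t) 0ℚ)
  where
  left-part : ∀ {m y t} → m - lo b ≡ ½ * width b → y - m ≡ ½ * (hi b - m) → t ≤ℚ y →
              t - lo b ≤ℚ ¾ * width b
  left-part {m} {y} {t} m-l y-m t≤y = ≤-cert (y - t) (≤⇒0≤- t≤y) (begin
    ¾ * width b                                         ≡⟨ expand (width b) ⟩
    ½ * width b + ½ * (width b - ½ * width b)           ≡⟨ cong (λ v → v + ½ * (width b - v)) m-l ⟨
    (m - lo b) + ½ * (width b - (m - lo b))             ≡⟨ regroup m (lo b) (hi b) ⟩
    (m - lo b) + ½ * (hi b - m)                         ≡⟨ cong (m - lo b +_) y-m ⟨
    (m - lo b) + (y - m)                                ≡⟨ regroup′ m (lo b) y t ⟩
    t - lo b + (y - t)                                  ∎)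
    where
    open ≡-Reasoning
    expand : ∀ w → (½ + ½ * ½) * w ≡ ½ * w + ½ * (w - ½ * w)
    expand = solve-∀ ℚ-ring
    regroup : ∀ m l r → (m - l) + ½ * (r - l - (m - l)) ≡ (m - l) + ½ * (r - m)
    regroup = solve-∀ ℚ-ring
    regroup′ : ∀ m l y t → (m - l) + (y - m) ≡ t - l + (y - t)
    regroup′ = solve-∀ ℚ-ring

  right-part : ∀ {m x t} → hi b - m ≡ ½ * width b → m - x ≡ ½ * (m - lo b) → x ≤ℚ t →
               hi b - t ≤ℚ ¾ * width b
  right-part {m} {x} {t} r-m m-x x≤t = ≤-cert (t - x) (≤⇒0≤- x≤t) (begin
    ¾ * width b                                         ≡⟨ expand (width b) ⟩
    ½ * width b + ½ * (width b - ½ * width b)           ≡⟨ cong (λ v → v + ½ * (width b - v)) r-m ⟨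
    (hi b - m) + ½ * (width b - (hi b - m))             ≡⟨ regroup m (lo b) (hi b) ⟩
    (hi b - m) + ½ * (m - lo b)                         ≡⟨ cong (hi b - m +_) m-x ⟨
    (hi b - m) + (m - x)                                ≡⟨ regroup′ m (hi b) x t ⟩
    hi b - t + (t - x)                                  ∎)
    where
    open ≡-Reasoning
    expand : ∀ w → (½ + ½ * ½) * w ≡ ½ * w + ½ * (w - ½ * w)
    expand = solve-∀ ℚ-ring
    regroup : ∀ m l r → (r - m) + ½ * (r - l - (r - m)) ≡ (r - m) + ½ * (m - l)
    regroup = solve-∀ ℚ-ring
    regroup′ : ∀ m r x t → (r - m) + (m - x) ≡ r - t + (t - x)
    regroup′ = solve-∀ ℚ-ring

  cut : ∀ t → lo b <ℚ t → t <ℚ hi b → t - lo b ≤ℚ ¾ * width b → hi b - t ≤ℚ ¾ * width b →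
        ev p t ≢ 0ℚ → Tri (ev p t <ℚ 0ℚ) (ev p t ≡ 0ℚ) (0ℚ <ℚ ev p t) → Refinement b
  cut t l<t t<r _ right _ (tri< pt<0 _ _) = record
    { refined = record
      { lo = t ; hi = hi b ; 0≤lo = ℚ.≤-trans (0≤lo b) (ℚ.<⇒≤ l<t) ; lo<hi = t<r
      ; hi≤1 = hi≤1 b ; neg = pt<0 ; pos = pos b }
    ; lo-mono = ℚ.<⇒≤ l<t ; hi-mono = ℚ.≤-refl ; shrink = right }
  cut _ _ _ _ _ pt≢0 (tri≈ _ pt≡0 _) = contradiction pt≡0 pt≢0
  cut t l<t t<r left _ _ (tri> _ _ 0<pt) = record
    { refined = record
      { lo = lo b ; hi = t ; 0≤lo = 0≤lo b ; lo<hi = l<t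
      ; hi≤1 = ℚ.≤-trans (ℚ.<⇒≤ t<r) (hi≤1 b) ; neg = neg b ; pos = 0<pt }
    ; lo-mono = ℚ.≤-refl ; hi-mono = ℚ.<⇒≤ t<r ; shrink = left }

Eventually : (ℕ → Set) → Set
Eventually P = ∃[ N ] ∀ n → N ≤ n → P n

eventually-× : ∀ {P Q} → Eventually P → Eventually Q → Eventually (λ n → P n × Q n)
eventually-× (M , p) (N , q) = M ℕ.⊔ N , λ n ≤n →
  p n (ℕ.m⊔n≤o⇒m≤o M N ≤n) , q n (ℕ.m⊔n≤o⇒n≤o M N ≤n)

eventually-map : ∀ {P Q} → (∀ {n} → P n → Q n) → Eventually P → Eventually Q
eventually-map f (N , p) = N , λ n ≤n → f (p n ≤n)

module Bisection {p} (b₀ : Bracket p) where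

  bracket : ℕ → Bracket p
  bracket zero    = b₀
  bracket (suc n) = refined (refine (bracket n))

  lower upper gap : ℕ → ℚ
  lower n = lo (bracket n)
  upper n = hi (bracket n)
  gap   n = width (bracket n)

  lower-mono : ∀ {m n} → m ≤ n → lower m ≤ℚ lower n
  lower-mono m≤n = go (ℕ.≤⇒≤′ m≤n)
    where
    go : ∀ {m n} → m ℕ.≤′ n → lower m ≤ℚ lower n
    go ℕ.≤′-refl           = ℚ.≤-refl
    go (ℕ.≤′-step {n} m≤n) = ℚ.≤-trans (go m≤n) (lo-mono (refine (bracket n)))

  upper-mono : ∀ {m n} → m ≤ n → upper n ≤ℚ upper m
  upper-mono m≤n = go (ℕ.≤⇒≤′ m≤n)
    where
    go : ∀ {m n} → m ℕ.≤′ n → upper n ≤ℚ upper m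
    go ℕ.≤′-refl           = ℚ.≤-refl
    go (ℕ.≤′-step {n} m≤n) = ℚ.≤-trans (hi-mono (refine (bracket n))) (go m≤n)

  lower<upper : ∀ m n → lower m <ℚ upper n
  lower<upper m n = ℚ.≤-<-trans (lower-mono (ℕ.m≤m⊔n m n))
    (ℚ.<-≤-trans (lo<hi (bracket (m ℕ.⊔ n))) (upper-mono (ℕ.m≤n⊔m m n)))

  -- (n + 3) (3/4)ⁿ is decreasing.
  gap-bound : ∀ n → fromℕ (3 ℕ.+ n) * gap n ≤ℚ fromℕ 3
  gap-bound zero    = subst (fromℕ 3 * gap 0 ≤ℚ_) (ℚ.*-identityʳ (fromℕ 3))
    (*-monoʳ {fromℕ 3} {gap 0} {1ℚ} (fromℕ-nonNeg 3) (≤-cert (1ℚ - hi b₀ + lo b₀)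
      (+-nonNeg (≤⇒0≤- (hi≤1 b₀)) (0≤lo b₀)) (split (lo b₀) (hi b₀))))
    where
    split : ∀ x z → 1ℚ ≡ z - x + (1ℚ - z + x)
    split = solve-∀ ℚ-ring
  gap-bound (suc n) = ℚ.≤-trans
    (*-monoʳ {fromℕ (4 ℕ.+ n)} (fromℕ-nonNeg (4 ℕ.+ n)) (shrink (refine (bracket n))))
    (ℚ.≤-trans
      (≤-cert (½ * ½ * fromℕ n * gap n)
        (*-nonNeg (*-nonNeg (*-nonNeg (ℚ.<⇒≤ 0<½) (ℚ.<⇒≤ 0<½)) (fromℕ-nonNeg n))
          (ℚ.<⇒≤ (0<width (bracket n))))
        (expand (fromℕ n) (gap n)))
      (gap-bound n))
    where
    expand : ∀ n w → (1ℚ + (1ℚ + (1ℚ + n))) * w ≡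
      (1ℚ + (1ℚ + (1ℚ + (1ℚ + n)))) * ((½ + ½ * ½) * w) + ½ * ½ * n * w
    expand = solve-∀ ℚ-ring

  -- Geometric decay enters only through the bound 3 / (n + 3), which is below η = 3 θ as soon as n
  -- ≥ N and N θ ≥ 1.
  gap-small : ∀ {η} → 0ℚ <ℚ η → Eventually (λ n → gap n ≤ℚ η)
  gap-small {η} 0<η =
    let θ , 0<θ , 3θ≡η = scale-down {fromℕ 3} {η} (+-pos-nonNeg 0<1 (fromℕ-nonNeg 2)) 0<η
        N , 1≤Nθ = archimedean 0<θ
    in N , λ n N≤n → *-cancelˡ-≤ {fromℕ (3 ℕ.+ n)} {gap n} {η}
         (+-pos-nonNeg 0<1 (fromℕ-nonNeg (2 ℕ.+ n)))
         (ℚ.≤-trans (gap-bound n) (bound n θ N N≤n (ℚ.<⇒≤ 0<θ) 3θ≡η 1≤Nθ))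
    where
    bound : ∀ n θ N → N ≤ n → 0ℚ ≤ℚ θ → fromℕ 3 * θ ≡ η → 1ℚ ≤ℚ fromℕ N * θ →
      fromℕ 3 ≤ℚ fromℕ (3 ℕ.+ n) * η
    bound n θ N N≤n 0≤θ refl 1≤Nθ = subst (_≤ℚ fromℕ (3 ℕ.+ n) * (fromℕ 3 * θ))
      (ℚ.*-identityʳ (fromℕ 3))
      (ℚ.≤-trans
        (*-monoʳ {fromℕ 3} (fromℕ-nonNeg 3) (ℚ.≤-trans 1≤Nθ
          (*-mono {fromℕ N} {fromℕ (3 ℕ.+ n)} {θ} {θ} (fromℕ-nonNeg N) 0≤θ
            (fromℕ-mono (ℕ.≤-trans N≤n (ℕ.m≤n+m n 3))) ℚ.≤-refl)))
        (ℚ.≤-reflexive (commute (fromℕ 3) (fromℕ (3 ℕ.+ n)) θ)))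
      where
      commute : ∀ a b c → a * (b * c) ≡ b * (a * c)
      commute = solve-∀ ℚ-ring

  lower-close : ∀ N {m} → N ≤ m → ∀ {n} → N ≤ n → ∣ lower m - lower n ∣ ≤ℚ gap N
  lower-close N {m} N≤m {n} N≤n = ∣∣≤ (one-sided N≤m N≤n)
    (subst (_≤ℚ gap N) (flip (lower m) (lower n)) (one-sided N≤n N≤m))
    where
    flip : ∀ a b → b - a ≡ - (a - b)
    flip = solve-∀ ℚ-ring
    one-sided : ∀ {i j} → N ≤ i → N ≤ j → lower i - lower j ≤ℚ gap N
    one-sided {i} {j} N≤i N≤j = ℚ.+-mono-≤ (ℚ.<⇒≤ (lower<upper i N))
      (ℚ.neg-antimono-≤ (lower-mono N≤j))

  lower-cauchy : IsCauchy lower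
  lower-cauchy δ 0<δ =
    let N , small = gap-small (half-pos 0<δ)
    in N , λ m n N≤m N≤n → ℚ.≤-<-trans (lower-close N N≤m N≤n)
         (ℚ.≤-<-trans (small N ℕ.≤-refl) (<-cert (½ * δ) (half-pos 0<δ) (double δ)))
    where
    double : ∀ x → x ≡ ½ * x + ½ * x
    double = solve-∀ ℚ-ring

  -- The lower ends are a convenient representative: they increase, stay in [0, 1], and p is
  -- strictly negative at each of them.
  root : ℝ
  root = mkℝ lower lower-cauchy

-- Null sequences and sequences apart from zero

Seq : Set
Seq = ℕ → ℚ

-- For Cauchy sequences `Null` says that the limit is zero and `Apart` that it is nonzero with an
-- explicit bound, so `Decided` is a genuine decision. `Settles` is the Cauchy property relative to
-- a single index.
Null Apart Bounded Settles Decided : Seq → Set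
Null z    = ∀ ε → 0ℚ <ℚ ε → Eventually (λ n → ∣ z n ∣ ≤ℚ ε)
Apart z   = ∃[ ε ] (0ℚ <ℚ ε × Eventually (λ n → ε ≤ℚ ∣ z n ∣))
Bounded z = ∃[ B ] (0ℚ ≤ℚ B × ∀ n → ∣ z n ∣ ≤ℚ B)
Settles z = ∀ {ε} → 0ℚ <ℚ ε → ∃[ N ] ∀ n → N ≤ n → ∣ z N - z n ∣ ≤ℚ ε
Decided z = Null z ⊎ Apart z

infixl 6 _+ˢ_
infixl 7 _*ˢ_

_+ˢ_ _*ˢ_ : Seq → Seq → Seq
(y +ˢ z) n = y n + z n
(y *ˢ z) n = y n * z n

halves : ∀ x → ½ * x + ½ * x ≡ x
halves = solve-∀ ℚ-ring

null-≗ : ∀ {y z} → (∀ n → y n ≡ z n) → Null y → Null z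
null-≗ y≗z null ε 0<ε =
  eventually-map (λ {n} → subst (λ v → ∣ v ∣ ≤ℚ ε) (y≗z n)) (null ε 0<ε)

apart-≗ : ∀ {y z} → (∀ n → y n ≡ z n) → Apart y → Apart z
apart-≗ y≗z (ε , 0<ε , apart) =
  ε , 0<ε , eventually-map (λ {n} → subst (λ v → ε ≤ℚ ∣ v ∣) (y≗z n)) apart

null-0 : ∀ {z} → (∀ n → z n ≡ 0ℚ) → Null z
null-0 z≗0 ε 0<ε = 0 , λ n _ → subst (λ v → ∣ v ∣ ≤ℚ ε) (sym (z≗0 n)) (ℚ.<⇒≤ 0<ε)

null-+ : ∀ {y z} → Null y → Null z → Null (y +ˢ z)
null-+ {y} {z} null-y null-z ε 0<ε =
  eventually-map (λ {n} (y≤ , z≤) → subst (∣ y n + z n ∣ ≤ℚ_) (halves ε) (∣+∣≤ {y n} {z n} y≤ z≤))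
    (eventually-× (null-y (½ * ε) (half-pos 0<ε)) (null-z (½ * ε) (half-pos 0<ε)))

null-* : ∀ {y z} → Bounded y → Null z → Null (y *ˢ z)
null-* {y} {z} (B , 0≤B , bound) null ε 0<ε =
  let η , 0<η , eq = scale-down {1ℚ + B} {ε} (+-pos-nonNeg 0<1 0≤B) 0<ε
  in eventually-map (λ {n} z≤ → subst (∣ y n * z n ∣ ≤ℚ_) eq
       (∣*∣≤ {y n} {z n} (ℚ.≤-trans (bound n) (≤-cert 1ℚ 0≤1 (ℚ.+-comm 1ℚ B))) z≤))
     (null η 0<η)

apart-*⁻ : ∀ {y z} → Bounded y → Apart (y *ˢ z) → Apart z
apart-*⁻ {y} {z} (B , 0≤B , bound) (ε , 0<ε , apart) =
  let η , 0<η , eq = scale-down {1ℚ + B} {ε} 0<1+B 0<ε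
  in η , 0<η , eventually-map (λ {n} ε≤ → *-cancelˡ-≤ {1ℚ + B} {η} {∣ z n ∣} 0<1+B
       (subst (_≤ℚ (1ℚ + B) * ∣ z n ∣) (sym eq) (ℚ.≤-trans ε≤
         (∣*∣≤ {y n} {z n} (ℚ.≤-trans (bound n) (≤-cert 1ℚ 0≤1 (ℚ.+-comm 1ℚ B))) ℚ.≤-refl))))
     apart
  where
  0<1+B : 0ℚ <ℚ 1ℚ + B
  0<1+B = +-pos-nonNeg 0<1 0≤B

null-cancel : ∀ {y z} → Apart y → Null (y *ˢ z) → Null z
null-cancel {y} {z} (ε , 0<ε , apart) null η 0<η =
  eventually-map (λ {n} (ε≤ , yz≤) → *-cancelˡ-≤ {ε} {∣ z n ∣} {η} 0<ε
      (ℚ.≤-trans (*-mono {ε} {∣ y n ∣} {∣ z n ∣} {∣ z n ∣} (ℚ.<⇒≤ 0<ε) (ℚ.0≤∣p∣ (z n)) ε≤ ℚ.≤-refl)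
        (subst (_≤ℚ ε * η) (ℚ.∣p*q∣≡∣p∣*∣q∣ (y n) (z n)) yz≤)))
    (eventually-× apart (null (ε * η) (*-pos 0<ε 0<η)))

null-square : ∀ {z} → Null (z *ˢ z) → Null z
null-square {z} null ε 0<ε = eventually-map (λ {n} → root-≤ n) (null (ε * ε) (*-pos 0<ε 0<ε))
  where
  root-≤ : ∀ n → ∣ z n * z n ∣ ≤ℚ ε * ε → ∣ z n ∣ ≤ℚ ε
  root-≤ n sq with ℚ.≤-total (∣ z n ∣) ε
  ... | inj₁ le = le
  ... | inj₂ ε≤ = *-cancelˡ-≤ {ε} {∣ z n ∣} {ε} 0<ε
    (ℚ.≤-trans (*-mono {ε} {∣ z n ∣} {∣ z n ∣} {∣ z n ∣} (ℚ.<⇒≤ 0<ε) (ℚ.0≤∣p∣ (z n)) ε≤ ℚ.≤-refl)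
      (subst (_≤ℚ ε * ε) (ℚ.∣p*q∣≡∣p∣*∣q∣ (z n) (z n)) sq))

apart-dominated : ∀ {w x y} → (∀ n → ∣ w n ∣ ≤ℚ ∣ x n ∣ + ∣ y n ∣) → Null x → Apart w → Apart y
apart-dominated {w} {x} {y} w≤ null (ε , 0<ε , apart) =
  ½ * ε , half-pos 0<ε ,
  eventually-map (λ {n} (ε≤ , x≤) →
      ≤-cert (∣ w n ∣ - ε + (½ * ε - ∣ x n ∣) + (∣ x n ∣ + ∣ y n ∣ - ∣ w n ∣))
        (+-nonNeg (+-nonNeg (≤⇒0≤- ε≤) (≤⇒0≤- x≤)) (≤⇒0≤- (w≤ n)))
        (expand ε (∣ w n ∣) (∣ x n ∣) (∣ y n ∣)))
    (eventually-× apart (null (½ * ε) (half-pos 0<ε)))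
  where
  expand : ∀ ε w x y → y ≡ ½ * ε + (w - ε + (½ * ε - x) + (x + y - w))
  expand = solve-∀ ℚ-ring

constant-bounded : ∀ k → Bounded (λ _ → k)
constant-bounded k = ∣ k ∣ , ℚ.0≤∣p∣ k , λ _ → ℚ.≤-refl

constant-apart : ∀ {k} → k ≢ 0ℚ → Apart (λ _ → k)
constant-apart {k} k≢0 = ∣ k ∣ ,
  ℚ.≰⇒> (λ k≤0 → k≢0 (ℚ.∣p∣≡0⇒p≡0 k (ℚ.≤-antisym k≤0 (ℚ.0≤∣p∣ k)))) , 0 , λ _ _ → ℚ.≤-refl

apart-*⁺ : ∀ {y z} → Apart y → Apart z → Apart (y *ˢ z)
apart-*⁺ {y} {z} (ε , 0<ε , y≥) (η , 0<η , z≥) = ε * η , *-pos 0<ε 0<η ,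
  eventually-map (λ {n} (ε≤ , η≤) → subst (ε * η ≤ℚ_) (sym (ℚ.∣p*q∣≡∣p∣*∣q∣ (y n) (z n)))
      (*-mono {ε} {∣ y n ∣} {η} {∣ z n ∣} (ℚ.<⇒≤ 0<ε) (ℚ.0≤∣p∣ (z n)) ε≤ η≤))
    (eventually-× y≥ z≥)

∣summand∣≤ : ∀ {a b d} → a ≡ b + d → ∣ d ∣ ≤ℚ ∣ a ∣ + ∣ b ∣
∣summand∣≤ {b = b} {d} refl =
  subst (λ w → ∣ w ∣ ≤ℚ ∣ b + d ∣ + ∣ b ∣) (expand b d) (ℚ.∣p-q∣≤∣p∣+∣q∣ (b + d) b)
  where
  expand : ∀ b d → b + d - b ≡ d
  expand = solve-∀ ℚ-ring

settled-apart : ∀ {z ε} → 0ℚ <ℚ ε → ∀ N → (∀ n → N ≤ n → ∣ z N - z n ∣ ≤ℚ ½ * ε) →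
  ε ≤ℚ ∣ z N ∣ → Apart z
settled-apart {z} {ε} 0<ε N close ε≤ = ½ * ε , half-pos 0<ε , N , λ n N≤n →
  ≤-cert (∣ z N - z n ∣ + ∣ z n ∣ - ∣ z N ∣ + (∣ z N ∣ - ε) + (½ * ε - ∣ z N - z n ∣))
    (+-nonNeg (+-nonNeg (≤⇒0≤- (triangle n)) (≤⇒0≤- ε≤)) (≤⇒0≤- (close n N≤n)))
    (expand ε (∣ z N - z n ∣) (∣ z n ∣) (∣ z N ∣))
  where
  cancel : ∀ a b → a - b + b ≡ a
  cancel = solve-∀ ℚ-ring
  triangle : ∀ n → ∣ z N ∣ ≤ℚ ∣ z N - z n ∣ + ∣ z n ∣
  triangle n = subst (λ v → ∣ v ∣ ≤ℚ ∣ z N - z n ∣ + ∣ z n ∣) (cancel (z N) (z n))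
    (ℚ.∣p+q∣≤∣p∣+∣q∣ (z N - z n) (z n))
  expand : ∀ ε d v V → v ≡ ½ * ε + (d + v - V + (V - ε) + (½ * ε - d))
  expand = solve-∀ ℚ-ring

settles-at : ∀ z → Settles z → ∀ {ε} → 0ℚ <ℚ ε →
  ∃[ N ] ∀ M → N ≤ M → ∀ n → M ≤ n → ∣ z M - z n ∣ ≤ℚ ε
settles-at z settles {ε} 0<ε =
  let N , close = settles (half-pos 0<ε)
  in N , λ M N≤M n M≤n → subst₂ _≤ℚ_ (cong ∣_∣ (telescope (z N) (z M) (z n))) (halves ε)
       (∣+∣≤ {z N - z n} { - (z N - z M)} (close n (ℕ.≤-trans N≤M M≤n))
         (subst (_≤ℚ ½ * ε) (sym (ℚ.∣-p∣≡∣p∣ (z N - z M))) (close M N≤M)))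
  where
  telescope : ∀ a b c → a - c + - (a - b) ≡ b - c
  telescope = solve-∀ ℚ-ring

-- The choice is made at one late index N, where one of the two rationals has absolute value at
-- least ε / 2; later terms move by at most ε / 4, so the choice persists.
apart-either : ∀ {w x y} → (∀ n → ∣ w n ∣ ≤ℚ ∣ x n ∣ + ∣ y n ∣) → Settles x → Settles y →
  Apart w → Apart x ⊎ Apart y
apart-either {w} {x} {y} w≤ settles-x settles-y (ε , 0<ε , N₀ , apart) =
  let N₁ , close-x = settles-at x settles-x (half-pos (half-pos 0<ε))
      N₂ , close-y = settles-at y settles-y (half-pos (half-pos 0<ε))
  in at (N₀ ℕ.⊔ (N₁ ℕ.⊔ N₂)) (ℕ.m≤m⊔n N₀ (N₁ ℕ.⊔ N₂))
       (close-x _ (ℕ.≤-trans (ℕ.m≤m⊔n N₁ N₂) (ℕ.m≤n⊔m N₀ (N₁ ℕ.⊔ N₂))))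
       (close-y _ (ℕ.≤-trans (ℕ.m≤n⊔m N₁ N₂) (ℕ.m≤n⊔m N₀ (N₁ ℕ.⊔ N₂))))
  where
  at : ∀ N → N₀ ≤ N → (∀ n → N ≤ n → ∣ x N - x n ∣ ≤ℚ ½ * (½ * ε)) →
       (∀ n → N ≤ n → ∣ y N - y n ∣ ≤ℚ ½ * (½ * ε)) → Apart x ⊎ Apart y
  at N N₀≤N close-x close-y with ℚ.≤-total (½ * ε) (∣ x N ∣)
  ... | inj₁ x≥ = inj₁ (settled-apart {x} (half-pos 0<ε) N close-x x≥)
  ... | inj₂ x≤ = inj₂ (settled-apart {y} (half-pos 0<ε) N close-y
    (≤-cert (∣ w N ∣ - ε + (½ * ε - ∣ x N ∣) + (∣ x N ∣ + ∣ y N ∣ - ∣ w N ∣))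
      (+-nonNeg (+-nonNeg (≤⇒0≤- (apart N N₀≤N)) (≤⇒0≤- x≤)) (≤⇒0≤- (w≤ N)))
      (expand ε (∣ w N ∣) (∣ x N ∣) (∣ y N ∣))))
    where
    expand : ∀ ε w x y → y ≡ ½ * ε + (w - ε + (½ * ε - x) + (x + y - w))
    expand = solve-∀ ℚ-ring

-- Division by monic polynomials

-- Storing only the coefficients below the top makes d the exact degree of `monic v`, although
-- coefficient lists in general may end in zeros.
lead : ∀ {d} → Vec ℚ d → ℚ → Poly
lead []      k = k ∷ []
lead (a ∷ v) k = a ∷ lead v k

monic : ∀ {d} → Vec ℚ d → Poly
monic v = lead v 1ℚ

length-lead : ∀ {d} (v : Vec ℚ d) k → length (lead v k) ≡ suc d
length-lead []      k = refl
length-lead (a ∷ v) k = cong suc (length-lead v k)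

Zero : Poly → Set
Zero = All (_≡ 0ℚ)

ev-zero : ∀ {p} → Zero p → ∀ t → ev p t ≡ 0ℚ
ev-zero []           t = refl
ev-zero (refl ∷ zs)  t = trans (ℚ.+-identityˡ _) (trans (cong (t *_) (ev-zero zs t)) (ℚ.*-zeroʳ t))

monic-≢0 : ∀ {d} (v : Vec ℚ d) → ¬ Zero (monic v)
monic-≢0 []      (() ∷ _)
monic-≢0 (a ∷ v) (_ ∷ zs) = monic-≢0 v zs

record MonicPart (p : Poly) : Set where
  field
    {degree} : ℕ
    degree<  : degree < length p
    low      : Vec ℚ degree
    scale    : ℚ
    scale≢0  : scale ≢ 0ℚ
    ev-monic : ∀ t → ev p t ≡ scale * ev (monic low) t

abstract
  normalise : ∀ p → Zero p ⊎ MonicPart p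
  normalise []      = inj₁ []
  normalise (a ∷ p) = extend (normalise p)
    where
    constant : Zero p → Dec (a ≡ 0ℚ) → Zero (a ∷ p) ⊎ MonicPart (a ∷ p)
    constant zs (yes a≡0) = inj₁ (a≡0 ∷ zs)
    constant zs (no a≢0)  = inj₂ record
      { degree< = ℕ.s≤s ℕ.z≤n ; low = [] ; scale = a ; scale≢0 = a≢0
      ; ev-monic = λ t → trans (cong (λ v → a + t * v) (ev-zero zs t)) (expand a t) }
      where
      expand : ∀ a t → a + t * 0ℚ ≡ a * (1ℚ + t * 0ℚ)
      expand = solve-∀ ℚ-ring

    shift : MonicPart p → MonicPart (a ∷ p)
    shift m =
      let b , kb≡1 = reciprocal scale≢0
      in record
        { degree< = ℕ.s≤s degree< ; low = a * b ∷ low ; scale = scale ; scale≢0 = scale≢0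
        ; ev-monic = λ t → trans (cong (λ v → a + t * v) (ev-monic t))
            (trans (cong (_+ t * (scale * ev (monic low) t))
                     (trans (sym (ℚ.*-identityʳ a)) (cong (a *_) (sym kb≡1))))
                   (expand a b scale t (ev (monic low) t))) }
      where
      open MonicPart m
      expand : ∀ a b k t M → a * (k * b) + t * (k * M) ≡ k * (a * b + t * M)
      expand = solve-∀ ℚ-ring

    extend : Zero p ⊎ MonicPart p → Zero (a ∷ p) ⊎ MonicPart (a ∷ p)
    extend (inj₁ zs) = constant zs (a ℚ.≟ 0ℚ)
    extend (inj₂ m)  = inj₂ (shift m)

coefficients : ∀ {d} → Vec ℚ d → Poly
coefficients = Vec.toList

split-lead : ∀ {d} (v : Vec ℚ (suc d)) → ∃[ u ] ∃[ k ] coefficients v ≡ lead {d} u k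
split-lead (a ∷ [])      = [] , a , refl
split-lead (a ∷ b ∷ v) =
  let u , k , eq = split-lead (b ∷ v) in a ∷ u , k , cong (a ∷_) eq

-- One elimination step of long division: the lower coefficients that remain after k times the monic
-- divisor has cancelled the top term.
reduce : ∀ {d} → ℚ → Vec ℚ d → Vec ℚ d → Vec ℚ d
reduce k = Vec.zipWith (λ a b → a - k * b)

ev-reduce : ∀ {d} k (u v : Vec ℚ d) t →
  ev (lead u k) t ≡ k * ev (monic v) t + ev (coefficients (reduce k u v)) t
ev-reduce k []      []      t = expand k t
  where
  expand : ∀ k t → k + t * 0ℚ ≡ k * (1ℚ + t * 0ℚ) + 0ℚ
  expand = solve-∀ ℚ-ring
ev-reduce k (a ∷ u) (b ∷ v) t =
  trans (cong (λ w → a + t * w) (ev-reduce k u v t))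
    (expand a b k t (ev (monic v) t) (ev (coefficients (reduce k u v)) t))
  where
  expand : ∀ a b k t M R → a + t * (k * M + R) ≡ k * (b + t * M) + (a - k * b + t * R)
  expand = solve-∀ ℚ-ring

reduce-zero : ∀ {d} {k} (u v : Vec ℚ d) → k ≡ 0ℚ → Zero (coefficients (reduce k u v)) →
  Zero (lead u k)
reduce-zero []      []      k≡0 []         = k≡0 ∷ []
reduce-zero {k = k} (a ∷ u) (b ∷ v) k≡0 (z ∷ zs) =
  trans (trans (expand a b) (cong (λ h → a - h * b) (sym k≡0))) z ∷ reduce-zero u v k≡0 zs
  where
  expand : ∀ a b → a ≡ a - 0ℚ * b
  expand = solve-∀ ℚ-ring

-- `length-quot` makes degrees drop in the later induction. `zero-division` is about coefficients,
-- since values at the single point c could not show that p itself is zero.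
record Division {d} (p : Poly) (v : Vec ℚ d) : Set where
  field
    quot : Poly
    rem  : Vec ℚ d
    ev-division : ∀ t → ev p t ≡ ev quot t * ev (monic v) t + ev (coefficients rem) t
    length-quot : length quot ≡ ℕ.pred (length p)
    zero-division : Zero quot → Zero (coefficients rem) → Zero p

zeros : ∀ {d} → Vec ℚ d
zeros {zero}  = []
zeros {suc d} = 0ℚ ∷ zeros

ev-zeros : ∀ {d} t → ev (coefficients (zeros {d})) t ≡ 0ℚ
ev-zeros {zero}  t = refl
ev-zeros {suc d} t = trans (cong (λ w → 0ℚ + t * w) (ev-zeros {d} t)) (expand t)
  where
  expand : ∀ t → 0ℚ + t * 0ℚ ≡ 0ℚ
  expand = solve-∀ ℚ-ring

abstract
  divide : ∀ {d} p (v : Vec ℚ (suc d)) → Division p v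
  divide {d} []      v = record
    { quot = [] ; rem = zeros ; length-quot = refl ; zero-division = λ _ _ → []
    ; ev-division = λ t → sym (trans (cong (0ℚ * ev (monic v) t +_) (ev-zeros {suc d} t))
                                     (expand (ev (monic v) t))) }
    where
    expand : ∀ M → 0ℚ * M + 0ℚ ≡ 0ℚ
    expand = solve-∀ ℚ-ring
  -- A constant is its own remainder. The general step would give it a quotient of length 1, against
  -- `length-quot`.
  divide {d} (a ∷ []) v = record
    { quot = [] ; rem = a ∷ zeros ; length-quot = refl
    ; zero-division = λ { _ (z ∷ _) → z ∷ [] }
    ; ev-division = λ t → sym (trans (cong (λ w → 0ℚ * ev (monic v) t + (a + t * w)) (ev-zeros {d} t))
                                     (expand a t (ev (monic v) t))) }
    where
    expand : ∀ a t M → 0ℚ * M + (a + t * 0ℚ) ≡ a + t * 0ℚ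
    expand = solve-∀ ℚ-ring
  -- If p = q M + r for the monic divisor M, then a + X p = X q M + (a + X r). The last bracket may
  -- reach the degree of M; its top coefficient k becomes the constant coefficient of the new
  -- quotient.
  divide {d} (a ∷ p@(_ ∷ _)) v = shift (divide p v)
    where
    shift : Division p v → Division (a ∷ p) v
    shift D =
      let u , k , eq = split-lead (a ∷ rem)
      in record
        { quot = k ∷ quot
        ; rem = reduce k u v
        ; length-quot = cong suc length-quot
        ; ev-division = λ t → let M = ev (monic v) t in
            trans (cong (λ w → a + t * w) (ev-division t))
              (trans (regroup a t (ev quot t) M (ev (coefficients rem) t))
                (trans (cong (t * ev quot t * M +_)
                         (trans (cong (λ q → ev q t) eq) (ev-reduce k u v t)))
                  (collect k t (ev quot t) M (ev (coefficients (reduce k u v)) t))))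
        ; zero-division = λ { (k≡0 ∷ quot≡0) rem≡0 →
            uncons (subst Zero (sym eq) (reduce-zero u v k≡0 rem≡0)) quot≡0 }
        }
      where
      open Division D
      uncons : Zero (a ∷ coefficients rem) → Zero quot → Zero (a ∷ p)
      uncons (a≡0 ∷ rem≡0) quot≡0 = a≡0 ∷ zero-division quot≡0 rem≡0
      regroup : ∀ a t s M u → a + t * (s * M + u) ≡ t * s * M + (a + t * u)
      regroup = solve-∀ ℚ-ring
      collect : ∀ k t s M r → t * s * M + (k * M + r) ≡ (k + t * s) * M + r
      collect = solve-∀ ℚ-ring

-- Deciding whether a polynomial vanishes at a root of another one

module AtPoint (c : Seq) (unit : ∀ n → Unit (c n)) (c-cauchy : IsCauchy c) where

  at : Poly → Seq
  at p n = ev p (c n)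

  at-bounded : ∀ p → Bounded (at p)
  at-bounded p = norm p , norm-nonNeg p , λ n → ∣ev∣≤norm p (Unit⇒∣∣≤1 (unit n))

  at-settles : ∀ p → Settles (at p)
  at-settles p {ε} 0<ε =
    let η , 0<η , eq = scale-down {1ℚ + lip p} {ε} (+-pos-nonNeg 0<1 (lip-nonNeg p)) 0<ε
        N , close = c-cauchy η 0<η
    in N , λ n N≤n → ℚ.≤-trans (lipschitz p (unit n) (unit N))
         (subst (lip p * ∣ c N - c n ∣ ≤ℚ_) eq
           (*-mono {lip p} {1ℚ + lip p} {∣ c N - c n ∣} {η} (lip-nonNeg p) (ℚ.<⇒≤ 0<η)
             (≤-cert 1ℚ 0≤1 (ℚ.+-comm 1ℚ (lip p)))
             (ℚ.<⇒≤ (close N n ℕ.≤-refl N≤n))))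

  one-apart : Apart (at (monic []))
  one-apart = 1ℚ , 0<1 , 0 , λ n _ → ℚ.≤-reflexive (sym (cong ∣_∣ (expand (c n))))
    where
    expand : ∀ t → 1ℚ + t * 0ℚ ≡ 1ℚ
    expand = solve-∀ ℚ-ring

  ¬null-one : ¬ Null (at (monic []))
  ¬null-one null =
    let ε , 0<ε , M , apart = one-apart
        N , small = null (½ * ε) (half-pos 0<ε)
    in ℚ.<-irrefl refl (ℚ.<-≤-trans
         (<-cert (½ * ε) (half-pos 0<ε) (sym (halves ε)))
         (ℚ.≤-trans (apart (M ℕ.⊔ N) (ℕ.m≤m⊔n M N)) (small (M ℕ.⊔ N) (ℕ.m≤n⊔m M N))))

  module _ {p} (m : MonicPart p) where
    open MonicPart m

    null-monic : Null (at p) → Null (at (monic low))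
    null-monic null = null-cancel (constant-apart scale≢0) (null-≗ (λ n → ev-monic (c n)) null)

    decided-monic : Decided (at (monic low)) → Decided (at p)
    decided-monic (inj₁ null)  = inj₁ (null-≗ (λ n → sym (ev-monic (c n)))
      (null-* (constant-bounded scale) null))
    decided-monic (inj₂ apart) = inj₂ (apart-≗ (λ n → sym (ev-monic (c n)))
      (apart-*⁺ (constant-apart scale≢0) apart))

  -- Working with the minimal polynomial of c would call for factorisation over ℚ. Any monic
  -- polynomial vanishing at c is accepted instead; one of smaller degree found on the way is handed
  -- to the induction hypothesis.
  DecidedByRoot : ℕ → Set
  DecidedByRoot d = (v : Vec ℚ d) → Null (at (monic v)) → ∀ q → Decided (at q)

  -- For P monic of degree d vanishing at c and R monic of smaller positive degree,
  -- expand P = T R² + W R + V in base R.  Either one of V, W, T R is a nonzero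
  -- polynomial of degree < d vanishing at c, or V and W are apart from zero or
  -- identically zero, and then R is decided from the expansion.
  module Step {d} (below : ∀ {e} → e < d → DecidedByRoot e)
              (P : Vec ℚ d) (P-null : Null (at (monic P))) where

    decided-below : ∀ {p} → MonicPart p → length p ≤ d → Null (at p) → ∀ q → Decided (at q)
    decided-below m p≤d null =
      below (ℕ.<-≤-trans degree< p≤d) low (null-monic m null)
      where open MonicPart m

    length-coefficients≤ : ∀ {e m} (v : Vec ℚ e) → e ≤ m → length (coefficients v) ≤ m
    length-coefficients≤ {m = m} v = subst (_≤ m) (sym (Vec.length-toList v))

    -- `decide-small` is the inner induction hypothesis: `V` and `W` are remainders modulo R, hence
    -- of smaller degree than R.
    module Expansion {e} (e<d : suc e < d) (R : Vec ℚ (suc e))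
             (decide-small : ∀ (w : Vec ℚ (suc e)) → Decided (at (coefficients w))) where

      D : Division (monic P) R
      D = divide (monic P) R

      S : Poly
      S = Division.quot D

      E : Division S R
      E = divide S R

      T V W : Poly
      T = Division.quot E
      V = coefficients (Division.rem D)
      W = coefficients (Division.rem E)

      r : Seq
      r = at (monic R)

      P≡ : ∀ n → at (monic P) n ≡ at S n * r n + at V n
      P≡ n = Division.ev-division D (c n)

      S≡ : ∀ n → at S n ≡ at T n * r n + at W n
      S≡ n = Division.ev-division E (c n)

      length-S : length S ≤ d
      length-S = ℕ.≤-reflexive (trans (Division.length-quot D) (cong ℕ.pred (length-lead P 1ℚ)))

      length-rem : ∀ (w : Vec ℚ (suc e)) → length (coefficients w) ≤ d
      length-rem w = length-coefficients≤ w (ℕ.<⇒≤ e<d)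

      -- P = S R + V is null at c, so S R is as far from zero as V; since S is bounded, R is apart
      -- from zero as well.
      V-apart : Apart (at V) → Decided r
      V-apart apart = inj₂ (apart-*⁻ (at-bounded S)
        (apart-dominated (λ n → ∣summand∣≤ (P≡ n)) P-null apart))

      module _ (V-zero : Zero V) where

        Sr-null : Null (at S *ˢ r)
        Sr-null = null-≗
          (λ n → trans (P≡ n) (trans (cong (at S n * r n +_) (ev-zero V-zero (c n)))
                                     (ℚ.+-identityʳ (at S n * r n))))
          P-null

        -- Since S = T R + W, either S or T R is apart from zero. In the first case R is null
        -- because S R is; in the second R is apart because T is bounded.
        W-apart : Apart (at W) → Decided r
        W-apart apart =
          [ (λ S-apart → inj₁ (null-cancel {at S} {r} S-apart Sr-null))
          , (λ Tr-apart → inj₂ (apart-*⁻ {at T} {r} (at-bounded T) Tr-apart))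
          ]′ (apart-either {at W} {at S} {at T *ˢ r} W≤ (at-settles S) Tr-settles apart)
          where
          W≤ : ∀ n → ∣ at W n ∣ ≤ℚ ∣ at S n ∣ + ∣ at T n * r n ∣
          W≤ n = ∣summand∣≤ {at S n} {at T n * r n} {at W n} (S≡ n)

          Tr-settles : Settles (at T *ˢ r)
          Tr-settles 0<ε =
            let N , close = at-settles (T ⊗ monic R) 0<ε
            in N , λ n N≤n → subst (λ w → ∣ w ∣ ≤ℚ _)
                 (cong₂ _-_ (ev-⊗ T (monic R) (c N)) (ev-⊗ T (monic R) (c n))) (close n N≤n)

        -- Here S = T R, so S² = T (S R) vanishes at c.
        W-zero : Zero W → Decided r
        W-zero zero-W = decide (normalise S)
          where
          S-null : Null (at S)
          S-null = null-square (null-≗ square (null-* (at-bounded T) Sr-null))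
            where
            square : ∀ n → at T n * (at S n * r n) ≡ at S n * at S n
            square n = trans (regroup (at T n) (at S n) (r n))
              (cong (_* at S n) (sym (trans (S≡ n)
                (trans (cong (at T n * r n +_) (ev-zero zero-W (c n))) (ℚ.+-identityʳ (at T n * r n))))))
              where
              regroup : ∀ t s r → t * (s * r) ≡ (t * r) * s
              regroup = solve-∀ ℚ-ring

          decide : Zero S ⊎ MonicPart S → Decided r
          decide (inj₁ S-zero) = contradiction (Division.zero-division D S-zero V-zero) (monic-≢0 P)
          decide (inj₂ m)      = decided-below m length-S S-null (monic R)

        V-zero-case : Decided r
        V-zero-case =
          [ (λ W-null → [ W-zero
                        , (λ m → decided-below m (length-rem (Division.rem E)) W-null (monic R))
                        ]′ (normalise W))
          , W-apart
          ]′ (decide-small (Division.rem E))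

      decided : Decided r
      decided =
        [ (λ V-null → [ V-zero-case
                      , (λ m → decided-below m (length-rem (Division.rem D)) V-null (monic R))
                      ]′ (normalise V))
        , V-apart
        ]′ (decide-small (Division.rem D))

    -- `m` bounds a degree here and a length in `decide-short`. The two alternate: remainders modulo
    -- a polynomial of degree e have length e, and a nonzero list of length at most m + 1 has degree
    -- at most m. Degree 0 leaves only the constant 1.
    decide-monic : ∀ m → m < d → ∀ {e} → e ≤ m → (R : Vec ℚ e) → Decided (at (monic R))
    decide-short : ∀ m → m ≤ d → ∀ u → length u ≤ m → Decided (at u)

    decide-monic m       m<d {zero}  _         []  = inj₂ one-apart
    decide-monic (suc m) m<d {suc e} (ℕ.s≤s e≤m) R = Expansion.decided (ℕ.≤-<-trans (ℕ.s≤s e≤m) m<d) R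
      (λ w → decide-short (suc m) (ℕ.<⇒≤ m<d) (coefficients w)
               (length-coefficients≤ w (ℕ.s≤s e≤m)))

    decide-short zero    _   []      _   = inj₁ (null-0 (λ _ → refl))
    decide-short (suc m) m<d u       u≤m =
      [ (λ u-zero → inj₁ (null-0 (λ n → ev-zero u-zero (c n))))
      , (λ mp → decided-monic mp (decide-monic m m<d
                  (ℕ.≤-pred (ℕ.<-≤-trans (MonicPart.degree< mp) u≤m)) (MonicPart.low mp)))
      ]′ (normalise u)

  -- As P vanishes at c, q agrees there with its remainder modulo P, of degree below that of P. In
  -- degree 0 the polynomial is 1 and has no root.
  decided-by-root : ∀ d → DecidedByRoot d
  decided-by-root = ℕ.<-rec DecidedByRoot step
    where
    step : ∀ d → (∀ {e} → e < d → DecidedByRoot e) → DecidedByRoot d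
    step zero    _     []  null _ = contradiction null ¬null-one
    step (suc d) below P P-null q =
      [ (λ u-null → inj₁ (null-≗ (λ n → sym (ev-division (c n))) (null-+ sP-null u-null)))
      , (λ u-apart → inj₂ (apart-dominated
          (λ n → subst (∣ at (coefficients rem) n ∣ ≤ℚ_)
                   (ℚ.+-comm (∣ at q n ∣) (∣ at quot n * at (monic P) n ∣))
                   (∣summand∣≤ (ev-division (c n))))
          sP-null u-apart))
      ]′ (Step.decide-short below P P-null (suc d) ℕ.≤-refl (coefficients rem)
            (ℕ.≤-reflexive (Vec.length-toList rem)))
      where
      open Division (divide q P)
      sP-null : Null (at quot *ˢ at (monic P))
      sP-null = null-* (at-bounded quot) P-null

  decide-at-root : ∀ {p} → ¬ Zero p → Null (at p) → ∀ q → Decided (at q)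
  decide-at-root {p} p≢0 null =
    [ (λ p-zero → contradiction p-zero p≢0)
    , (λ m → decided-by-root (MonicPart.degree m) (MonicPart.low m) (null-monic m null))
    ]′ (normalise p)

-- Local sign of a polynomial around a root

signed : Sign → ℚ → ℚ
signed Sign.+ x = x
signed Sign.- x = - x

signed-+ : ∀ σ x y → signed σ (x + y) ≡ signed σ x + signed σ y
signed-+ Sign.+ x y = refl
signed-+ Sign.- x y = ℚ.neg-distrib-+ x y

signed≤∣∣ : ∀ σ x → - signed σ x ≤ℚ ∣ x ∣
signed≤∣∣ Sign.+ x = -≤∣∣ x
signed≤∣∣ Sign.- x = subst (_≤ℚ ∣ x ∣) (sym (expand x)) (≤∣∣ x)
  where
  expand : ∀ x → - (- x) ≡ x
  expand = solve-∀ ℚ-ring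

∣signed∣ : ∀ σ x → ∣ signed σ x ∣ ≡ ∣ x ∣
∣signed∣ Sign.+ x = refl
∣signed∣ Sign.- x = ℚ.∣-p∣≡∣p∣ x

signed-* : ∀ ι σ h f → signed (ι Sign.* σ) (signed ι h * f) ≡ h * signed σ f
signed-* Sign.+ Sign.+ h f = refl
signed-* Sign.+ Sign.- h f = expand h f
  where
  expand : ∀ h f → - (h * f) ≡ h * (- f)
  expand = solve-∀ ℚ-ring
signed-* Sign.- Sign.+ h f = expand h f
  where
  expand : ∀ h f → - ((- h) * f) ≡ h * f
  expand = solve-∀ ℚ-ring
signed-* Sign.- Sign.- h f = expand h f
  where
  expand : ∀ h f → (- h) * f ≡ h * (- f)
  expand = solve-∀ ℚ-ring

signed-sum-≥ : ∀ σ {x y A B} → A + B ≤ℚ signed σ x → ∣ y ∣ ≤ℚ B → A ≤ℚ signed σ (x + y)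
signed-sum-≥ σ {x} {y} {A} {B} A+B≤ y≤B =
  ≤-cert (signed σ x - (A + B) + (B - ∣ y ∣) + (∣ y ∣ - - signed σ y))
    (+-nonNeg (+-nonNeg (≤⇒0≤- A+B≤) (≤⇒0≤- y≤B)) (≤⇒0≤- (signed≤∣∣ σ y)))
    (trans (signed-+ σ x y) (expand A B (signed σ x) (signed σ y) (∣ y ∣)))
  where
  expand : ∀ A B u v w → u + v ≡ A + (u - (A + B) + (B - w) + (w - - v))
  expand = solve-∀ ℚ-ring

-- The sign is read off at one index, after which the terms move by at most half the distance from
-- zero.
apart-signed : ∀ z → Settles z → Apart z →
  ∃[ σ ] ∃[ ε ] (0ℚ <ℚ ε × Eventually (λ n → ε ≤ℚ signed σ (z n)))
apart-signed z settles (ε , 0<ε , N₀ , apart) =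
  let N₁ , close = settles-at z settles (half-pos 0<ε)
  in at (N₀ ℕ.⊔ N₁) (apart _ (ℕ.m≤m⊔n N₀ N₁)) (close _ (ℕ.m≤n⊔m N₀ N₁))
  where
  cancel : ∀ a b → a + (b - a) ≡ b
  cancel = solve-∀ ℚ-ring

  at : ∀ N → ε ≤ℚ ∣ z N ∣ → (∀ n → N ≤ n → ∣ z N - z n ∣ ≤ℚ ½ * ε) →
       ∃[ σ ] ∃[ ε ] (0ℚ <ℚ ε × Eventually (λ n → ε ≤ℚ signed σ (z n)))
  at N ε≤ close =
    [ (λ eq → sign Sign.+ (subst (ε ≤ℚ_) eq ε≤))
    , (λ eq → sign Sign.- (subst (ε ≤ℚ_) eq ε≤))
    ]′ (ℚ.∣p∣≡p∨∣p∣≡-p (z N))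
    where
    sign : ∀ σ → ε ≤ℚ signed σ (z N) →
           ∃[ σ ] ∃[ ε ] (0ℚ <ℚ ε × Eventually (λ n → ε ≤ℚ signed σ (z n)))
    sign σ ε≤ = σ , ½ * ε , half-pos 0<ε , N , λ n N≤n →
      subst (λ w → ½ * ε ≤ℚ signed σ w) (cancel (z N) (z n))
        (signed-sum-≥ σ {z N} {z n - z N} {½ * ε} {½ * ε}
          (subst (_≤ℚ signed σ (z N)) (sym (halves ε)) ε≤)
          (subst (_≤ℚ ½ * ε) (swap (z N) (z n)) (close n N≤n)))
      where
      swap : ∀ a b → ∣ a - b ∣ ≡ ∣ b - a ∣
      swap a b = trans (sym (ℚ.∣-p∣≡∣p∣ (a - b))) (cong ∣_∣ (flip a b))
        where
        flip : ∀ a b → - (a - b) ≡ b - a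
        flip = solve-∀ ℚ-ring

-- A polynomial in h whose coefficients are polynomials in s.
ev₂ : List Poly → ℚ → ℚ → ℚ
ev₂ []       s h = 0ℚ
ev₂ (T ∷ Ts) s h = ev T s + h * ev₂ Ts s h

-- T + (s + h) · Us
horner : Poly → List Poly → List Poly
horner T []       = T ∷ []
horner T (U ∷ Us) = (T ⊕ (0ℚ ∷ U)) ∷ horner U Us

-- Entry k is the Taylor coefficient p⁽ᵏ⁾(s) / k! as a polynomial in s. Substituting s + h in Horner
-- form avoids derivatives and factorials.
taylor : Poly → List Poly
taylor []      = []
taylor (a ∷ p) = horner (a ∷ []) (taylor p)

ev₂-horner : ∀ T Us s h → ev₂ (horner T Us) s h ≡ ev T s + (s + h) * ev₂ Us s h
ev₂-horner T []       s h = expand (ev T s) s h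
  where
  expand : ∀ a s h → a + h * 0ℚ ≡ a + (s + h) * 0ℚ
  expand = solve-∀ ℚ-ring
ev₂-horner T (U ∷ Us) s h = trans
  (cong₂ (λ x y → x + h * y) (ev-⊕ T (0ℚ ∷ U) s) (ev₂-horner U Us s h))
  (expand (ev T s) (ev U s) s h (ev₂ Us s h))
  where
  expand : ∀ a u s h v → a + (0ℚ + s * u) + h * (u + (s + h) * v) ≡ a + (s + h) * (u + h * v)
  expand = solve-∀ ℚ-ring

ev₂-taylor : ∀ p s h → ev₂ (taylor p) s h ≡ ev p (s + h)
ev₂-taylor []      s h = refl
ev₂-taylor (a ∷ p) s h = trans (ev₂-horner (a ∷ []) (taylor p) s h)
  (trans (cong (λ v → a + s * 0ℚ + (s + h) * v) (ev₂-taylor p s h))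
         (expand a s h (ev p (s + h))))
  where
  expand : ∀ a s h v → a + s * 0ℚ + (s + h) * v ≡ a + (s + h) * v
  expand = solve-∀ ℚ-ring

norm₂ : List Poly → ℚ
norm₂ []       = 0ℚ
norm₂ (T ∷ Ts) = norm T + norm₂ Ts

norm₂-nonNeg : ∀ Ts → 0ℚ ≤ℚ norm₂ Ts
norm₂-nonNeg []       = ℚ.≤-refl
norm₂-nonNeg (T ∷ Ts) = +-nonNeg (norm-nonNeg T) (norm₂-nonNeg Ts)

∣ev₂∣≤norm₂ : ∀ Ts {s h} → ∣ s ∣ ≤ℚ 1ℚ → ∣ h ∣ ≤ℚ 1ℚ → ∣ ev₂ Ts s h ∣ ≤ℚ norm₂ Ts
∣ev₂∣≤norm₂ []       _ _ = ℚ.≤-refl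
∣ev₂∣≤norm₂ (T ∷ Ts) {s} {h} s≤1 h≤1 =
  subst (λ b → ∣ ev₂ (T ∷ Ts) s h ∣ ≤ℚ norm T + b) (ℚ.*-identityˡ (norm₂ Ts))
    (∣+∣≤ {ev T s} {h * ev₂ Ts s h} (∣ev∣≤norm T s≤1) (∣*∣≤ h≤1 (∣ev₂∣≤norm₂ Ts s≤1 h≤1)))

-- On the side ι of c, the sign of F is σ, uniformly away from c: F n h stands
-- for the value at distance h from the n-th approximation of c.
Side : Sign → Sign → (ℕ → ℚ → ℚ) → Set
Side ι σ F = ∃[ ρ ] (0ℚ <ℚ ρ × ∀ δ → 0ℚ <ℚ δ → ∃[ κ ] (0ℚ <ℚ κ ×
  Eventually (λ n → ∀ h → δ ≤ℚ h → h ≤ℚ ρ → κ ≤ℚ signed σ (F n (signed ι h)))))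

Vanishes : (ℕ → ℚ → ℚ) → Set
Vanishes F = ∀ ε → 0ℚ <ℚ ε → Eventually (λ n → ∀ h → ∣ h ∣ ≤ℚ 1ℚ → ∣ F n h ∣ ≤ℚ ε)

LocalSigns : (ℕ → ℚ → ℚ) → Set
LocalSigns F = Vanishes F ⊎ ∃[ σ ] ∃[ τ ] (Side Sign.- σ F × Side Sign.+ τ F)

module _ (z : Seq) (F : ℕ → ℚ → ℚ) where

  plus-times-h : ℕ → ℚ → ℚ
  plus-times-h n h = z n + h * F n h

  vanishes-step : Null z → Vanishes F → Vanishes plus-times-h
  vanishes-step null vanishes ε 0<ε =
    eventually-map (λ {n} (z≤ , F≤) h h≤1 → subst (∣ z n + h * F n h ∣ ≤ℚ_) (sum ε)
        (∣+∣≤ {z n} {h * F n h} z≤ (∣*∣≤ {h} {F n h} h≤1 (F≤ h h≤1))))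
      (eventually-× (null (½ * ε) (half-pos 0<ε)) (vanishes (½ * ε) (half-pos 0<ε)))
    where
    sum : ∀ ε → ½ * ε + 1ℚ * (½ * ε) ≡ ε
    sum = solve-∀ ℚ-ring

  -- At distance at least δ the product h F has size at least δ κ, and the null term z is eventually
  -- at most half of that. The radius need not shrink.
  side-shift : ∀ {ι σ} → Null z → Side ι σ F → Side ι (ι Sign.* σ) plus-times-h
  side-shift {ι} {σ} null (ρ , 0<ρ , side) = ρ , 0<ρ , λ δ 0<δ → bound δ 0<δ (side δ 0<δ)
    where
    bound : ∀ δ → 0ℚ <ℚ δ →
      ∃[ κ ] (0ℚ <ℚ κ × Eventually (λ n → ∀ h → δ ≤ℚ h → h ≤ℚ ρ → κ ≤ℚ signed σ (F n (signed ι h)))) →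
      ∃[ κ ] (0ℚ <ℚ κ × Eventually (λ n → ∀ h → δ ≤ℚ h → h ≤ℚ ρ →
        κ ≤ℚ signed (ι Sign.* σ) (plus-times-h n (signed ι h))))
    bound δ 0<δ (κ , 0<κ , far) = ½ * (δ * κ) , half-pos 0<δκ ,
      eventually-map (λ {n} (z≤ , F≥) h δ≤h h≤ρ →
          subst (λ w → ½ * (δ * κ) ≤ℚ signed (ι Sign.* σ) w)
            (ℚ.+-comm (signed ι h * F n (signed ι h)) (z n))
            (signed-sum-≥ (ι Sign.* σ) {signed ι h * F n (signed ι h)} {z n} {½ * (δ * κ)} {½ * (δ * κ)}
              (subst₂ _≤ℚ_ (sym (halves (δ * κ))) (sym (signed-* ι σ h (F n (signed ι h))))
                (*-mono {δ} {h} {κ} {signed σ (F n (signed ι h))} (ℚ.<⇒≤ 0<δ)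
                  (ℚ.≤-trans (ℚ.<⇒≤ 0<κ) (F≥ h δ≤h h≤ρ)) δ≤h (F≥ h δ≤h h≤ρ)))
              z≤))
        (eventually-× (null (½ * (δ * κ)) (half-pos 0<δκ)) far)
      where
      0<δκ : 0ℚ <ℚ δ * κ
      0<δκ = *-pos 0<δ 0<κ

  side-apart : ∀ {ι σ ε K} → 0ℚ ≤ℚ K → (∀ n h → ∣ h ∣ ≤ℚ 1ℚ → ∣ F n h ∣ ≤ℚ K) →
    0ℚ <ℚ ε → Eventually (λ n → ε ≤ℚ signed σ (z n)) → Side ι σ plus-times-h
  side-apart {ι} {σ} {ε} {K} 0≤K F≤ 0<ε far =
    -- The summand `K` keeps h F below ε / 2; the summand `ε` ensures ρ ≤ 1, where the bound `K` on
    -- F is available.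
    let ρ , 0<ρ , eq = scale-down {1ℚ + K + ε} {½ * ε} 0<S (half-pos 0<ε)
    in ρ , 0<ρ , λ δ 0<δ → ½ * ε , half-pos 0<ε , eventually-map (λ {n} z≥ h δ≤h h≤ρ →
         signed-sum-≥ σ {z n} {signed ι h * F n (signed ι h)} {½ * ε} {½ * ε}
           (subst (_≤ℚ signed σ (z n)) (sym (halves ε)) z≥)
           (small ρ 0<ρ eq n h (ℚ.≤-trans (ℚ.<⇒≤ 0<δ) δ≤h) h≤ρ)) far
    where
    0<S : 0ℚ <ℚ 1ℚ + K + ε
    0<S = +-pos-nonNeg (+-pos-nonNeg 0<1 0≤K) (ℚ.<⇒≤ 0<ε)

    small : ∀ ρ → 0ℚ <ℚ ρ → (1ℚ + K + ε) * ρ ≡ ½ * ε → ∀ n h → 0ℚ ≤ℚ h → h ≤ℚ ρ →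
      ∣ signed ι h * F n (signed ι h) ∣ ≤ℚ ½ * ε
    small ρ 0<ρ eq n h 0≤h h≤ρ = ℚ.≤-trans
      (∣*∣≤ {signed ι h} {F n (signed ι h)} {ρ} {K} ∣h∣≤ρ (F≤ n (signed ι h) (ℚ.≤-trans ∣h∣≤ρ ρ≤1)))
      (≤-cert (ρ + ε * ρ) (+-nonNeg (ℚ.<⇒≤ 0<ρ) (*-nonNeg (ℚ.<⇒≤ 0<ε) (ℚ.<⇒≤ 0<ρ)))
        (trans (sym eq) (expand K ε ρ)))
      where
      expand : ∀ K ε ρ → (1ℚ + K + ε) * ρ ≡ ρ * K + (ρ + ε * ρ)
      expand = solve-∀ ℚ-ring
      ∣h∣≤ρ : ∣ signed ι h ∣ ≤ℚ ρ
      ∣h∣≤ρ = subst (_≤ℚ ρ) (sym (trans (∣signed∣ ι h) (ℚ.0≤p⇒∣p∣≡p 0≤h))) h≤ρ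
      ρ≤1 : ρ ≤ℚ 1ℚ
      ρ≤1 = *-cancelˡ-≤ {1ℚ + K + ε} {ρ} {1ℚ} 0<S
        (subst (_≤ℚ (1ℚ + K + ε) * 1ℚ) (sym eq)
          (≤-cert (1ℚ + K + ½ * ε) (+-nonNeg (+-nonNeg 0≤1 0≤K) (ℚ.<⇒≤ (half-pos 0<ε)))
            (expand₁ K ε)))
        where
        expand₁ : ∀ K ε → (1ℚ + K + ε) * 1ℚ ≡ ½ * ε + (1ℚ + K + ½ * ε)
        expand₁ = solve-∀ ℚ-ring

module _ (c : Seq) (unit : ∀ n → Unit (c n)) (c-cauchy : IsCauchy c) where
  open AtPoint c unit c-cauchy

  -- Each null coefficient ahead of the first one apart from zero contributes a factor h, which
  -- flips the sign on the left and keeps it on the right.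
  local-signs : (∀ q → Decided (at q)) → ∀ Ts → LocalSigns (λ n h → ev₂ Ts (c n) h)
  local-signs decide []       = inj₁ (λ ε 0<ε → 0 , λ _ _ _ _ → ℚ.<⇒≤ 0<ε)
  local-signs decide (T ∷ Ts) = [ null-case (local-signs decide Ts) , apart-case ]′ (decide T)
    where
    F : ℕ → ℚ → ℚ
    F n h = ev₂ Ts (c n) h

    null-case : LocalSigns F → Null (at T) → LocalSigns (λ n h → ev₂ (T ∷ Ts) (c n) h)
    null-case (inj₁ vanishes)              null = inj₁ (vanishes-step (at T) F null vanishes)
    null-case (inj₂ (σ , τ , left , right)) null =
      inj₂ (Sign.- Sign.* σ , Sign.+ Sign.* τ ,
            side-shift (at T) F {Sign.-} {σ} null left , side-shift (at T) F {Sign.+} {τ} null right)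

    apart-case : Apart (at T) → LocalSigns (λ n h → ev₂ (T ∷ Ts) (c n) h)
    apart-case apart = same-sign (apart-signed (at T) (at-settles T) apart)
      where
      same-sign : ∃[ σ ] ∃[ ε ] (0ℚ <ℚ ε × Eventually (λ n → ε ≤ℚ signed σ (at T n))) →
        LocalSigns (λ n h → ev₂ (T ∷ Ts) (c n) h)
      same-sign (σ , ε , 0<ε , far) = inj₂ (σ , σ , side Sign.- , side Sign.+)
        where
        side : ∀ ι → Side ι σ (λ n h → ev₂ (T ∷ Ts) (c n) h)
        side ι = side-apart (at T) F {ι} {σ} {ε} {norm₂ Ts} (norm₂-nonNeg Ts)
          (λ n h h≤1 → ∣ev₂∣≤norm₂ Ts (Unit⇒∣∣≤1 (unit n)) h≤1) 0<ε far

-- The bisection root as a point of sign change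

module SignChange {p} (b₀ : Bracket p) where
  open Bisection b₀

  lower-unit : ∀ n → Unit (lower n)
  lower-unit n = unit-lo (bracket n)

  open AtPoint lower lower-unit lower-cauchy

  L : ℚ
  L = 1ℚ + lip p

  0<L : 0ℚ <ℚ L
  0<L = +-pos-nonNeg 0<1 (lip-nonNeg p)

  increment : ∀ {x y} → Unit x → Unit y → x ≤ℚ y → ev p y - ev p x ≤ℚ L * (y - x)
  increment {x} {y} ux uy x≤y = ℚ.≤-trans (≤∣∣ (ev p y - ev p x)) (ℚ.≤-trans (lipschitz p ux uy)
    (subst (λ d → lip p * d ≤ℚ L * (y - x)) (sym (ℚ.0≤p⇒∣p∣≡p 0≤y-x))
      (*-mono {lip p} {L} {y - x} {y - x} (lip-nonNeg p) 0≤y-x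
        (≤-cert 1ℚ 0≤1 (ℚ.+-comm 1ℚ (lip p))) ℚ.≤-refl)))
    where
    0≤y-x : 0ℚ ≤ℚ y - x
    0≤y-x = ≤⇒0≤- x≤y

  -- The values at the two ends of a bracket have opposite signs, so each is at most their
  -- difference in size, which is at most L times the width.
  p-null : Null (at p)
  p-null ε 0<ε = bound (scale-down {L} {ε} 0<L 0<ε)
    where
    drop : ∀ x y → y - x ≡ - x + y
    drop = solve-∀ ℚ-ring

    bound : ∃[ η ] (0ℚ <ℚ η × L * η ≡ ε) → Eventually (λ n → ∣ at p n ∣ ≤ℚ ε)
    bound (η , 0<η , Lη≡ε) = eventually-map (λ {n} gap≤ →
        ∣∣≤ (ℚ.≤-trans (ℚ.<⇒≤ (neg (bracket n))) (ℚ.<⇒≤ 0<ε))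
          (ℚ.≤-trans (≤-cert (ev p (upper n)) (ℚ.<⇒≤ (pos (bracket n))) (drop (at p n) (ev p (upper n))))
            (ℚ.≤-trans (increment (lower-unit n) (unit-hi (bracket n)) (ℚ.<⇒≤ (lo<hi (bracket n))))
              (subst (L * gap n ≤ℚ_) Lη≡ε (*-monoʳ {L} {gap n} {η} (ℚ.<⇒≤ 0<L) gap≤)))))
      (gap-small 0<η)

  p-nonzero : ¬ Zero p
  p-nonzero p-zero = ℚ.<-irrefl (ev-zero p-zero (lo b₀)) (neg b₀)

  -- All values at lower ends are negative while the value at `upper N` is a fixed positive number,
  -- so the Lipschitz bound keeps these points apart. A `Side` gives information only from some
  -- distance δ on.
  below-upper : ∀ N → ∃[ δ ] (0ℚ <ℚ δ × ∀ n → δ ≤ℚ upper N - lower n)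
  below-upper N = bound (scale-down {L} {ev p (upper N)} 0<L (pos (bracket N)))
    where
    drop : ∀ x y → y - x ≡ y + - x
    drop = solve-∀ ℚ-ring

    bound : ∃[ δ ] (0ℚ <ℚ δ × L * δ ≡ ev p (upper N)) → ∃[ δ ] (0ℚ <ℚ δ × ∀ n → δ ≤ℚ upper N - lower n)
    bound (δ , 0<δ , Lδ≡) = δ , 0<δ , λ n → *-cancelˡ-≤ {L} {δ} {upper N - lower n} 0<L
      (subst (_≤ℚ L * (upper N - lower n)) (sym Lδ≡)
        (ℚ.≤-trans (≤-cert (- at p n) (ℚ.<⇒≤ (ℚ.neg-antimono-< (neg (bracket n)))) (drop (at p n) (ev p (upper N))))
          (increment (lower-unit n) (unit-hi (bracket N)) (ℚ.<⇒≤ (lower<upper n N)))))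

  -- Here the values at later lower ends merely tend to 0, so half of |p| at `lower N` is given up
  -- and the bound holds eventually.
  above-lower : ∀ N → ∃[ δ ] (0ℚ <ℚ δ × Eventually (λ n → δ ≤ℚ lower n - lower N))
  above-lower N = bound (scale-down {L} {½ * a} 0<L (half-pos 0<a))
    where
    a : ℚ
    a = - at p N

    0<a : 0ℚ <ℚ a
    0<a = ℚ.neg-antimono-< (neg (bracket N))

    expand : ∀ a v w → v - - a ≡ ½ * a + (½ * a - w + (w - - v))
    expand = solve-∀ ℚ-ring

    -a≡ : - a ≡ at p N
    -a≡ = neg-neg (at p N)
      where
      neg-neg : ∀ x → - (- x) ≡ x
      neg-neg = solve-∀ ℚ-ring

    bound : ∃[ δ ] (0ℚ <ℚ δ × L * δ ≡ ½ * a) → ∃[ δ ] (0ℚ <ℚ δ × Eventually (λ n → δ ≤ℚ lower n - lower N))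
    bound (δ , 0<δ , Lδ≡) = δ , 0<δ , eventually-map (λ {n} (p≤ , N≤n) →
        *-cancelˡ-≤ {L} {δ} {lower n - lower N} 0<L
          (subst (_≤ℚ L * (lower n - lower N)) (sym Lδ≡)
            (ℚ.≤-trans
              (≤-cert (½ * a - ∣ at p n ∣ + (∣ at p n ∣ - - at p n))
                (+-nonNeg (≤⇒0≤- p≤) (≤⇒0≤- (-≤∣∣ (at p n))))
                (trans (cong (λ v → at p n - v) (sym -a≡)) (expand a (at p n) (∣ at p n ∣))))
              (increment (lower-unit N) (lower-unit n) (lower-mono N≤n)))))
      (eventually-× (p-null (½ * a) (half-pos 0<a)) (N , λ _ N≤n → N≤n))

  Fₚ : ℕ → ℚ → ℚ
  Fₚ n h = ev₂ (taylor p) (lower n) h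

  Fₚ-at : ∀ n x → Fₚ n (x - lower n) ≡ ev p x
  Fₚ-at n x = trans (ev₂-taylor p (lower n) (x - lower n)) (cong (ev p) (cancel (lower n) x))
    where
    cancel : ∀ c x → c + (x - c) ≡ x
    cancel = solve-∀ ℚ-ring

  Fₚ-at-left : ∀ n x → Fₚ n (- (lower n - x)) ≡ ev p x
  Fₚ-at-left n x = trans (cong (Fₚ n) (flip (lower n) x)) (Fₚ-at n x)
    where
    flip : ∀ c x → - (c - x) ≡ x - c
    flip = solve-∀ ℚ-ring

  gap-below : ∀ {ρ} → 0ℚ <ℚ ρ → ∃[ N ] gap N ≤ℚ ρ
  gap-below 0<ρ = let N , small = gap-small 0<ρ in N , small N ℕ.≤-refl

  -- Once `gap N` ≤ ρ, the point `upper N` lies in the range governed by the sign on the right, and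
  -- p is positive there.
  sign-on-right : ∀ {τ} → Side Sign.+ τ Fₚ → τ ≡ Sign.+
  sign-on-right {Sign.+} _ = refl
  sign-on-right {Sign.-} (ρ , 0<ρ , side) = ⊥-elim (at-upper (gap-below 0<ρ))
    where
    at-upper : ∃[ N ] gap N ≤ℚ ρ → ⊥
    at-upper (N , gap≤ρ) = absurd (below-upper N)
      where
      absurd : ∃[ δ ] (0ℚ <ℚ δ × ∀ n → δ ≤ℚ upper N - lower n) → ⊥
      absurd (δ , 0<δ , far) = evaluate (side δ 0<δ)
        where
        evaluate : ∃[ κ ] (0ℚ <ℚ κ × Eventually (λ n → ∀ h → δ ≤ℚ h → h ≤ℚ ρ → κ ≤ℚ - Fₚ n h)) → ⊥
        evaluate (κ , 0<κ , M , ≥κ) = ℚ.<-irrefl refl (ℚ.<-trans (ℚ.<-≤-trans 0<κ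
            (subst (λ v → κ ≤ℚ - v) (Fₚ-at n (upper N))
              (≥κ n (ℕ.m≤m⊔n M N) (upper N - lower n) (far n)
                (ℚ.≤-trans (ℚ.+-monoʳ-≤ (upper N) (ℚ.neg-antimono-≤ (lower-mono (ℕ.m≤n⊔m M N)))) gap≤ρ))))
            (ℚ.neg-antimono-< (pos (bracket N))))
          where
          n : ℕ
          n = M ℕ.⊔ N

  sign-on-left : ∀ {σ} → Side Sign.- σ Fₚ → σ ≡ Sign.-
  sign-on-left {Sign.-} _ = refl
  sign-on-left {Sign.+} (ρ , 0<ρ , side) = ⊥-elim (at-lower (gap-below 0<ρ))
    where
    at-lower : ∃[ N ] gap N ≤ℚ ρ → ⊥
    at-lower (N , gap≤ρ) = absurd (above-lower N)
      where
      absurd : ∃[ δ ] (0ℚ <ℚ δ × Eventually (λ n → δ ≤ℚ lower n - lower N)) → ⊥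
      absurd (δ , 0<δ , far) = evaluate (side δ 0<δ)
        where
        evaluate : ∃[ κ ] (0ℚ <ℚ κ × Eventually (λ n → ∀ h → δ ≤ℚ h → h ≤ℚ ρ → κ ≤ℚ Fₚ n (- h))) → ⊥
        evaluate (κ , 0<κ , ≥κ) = contradict (eventually-× far ≥κ)
          where
          contradict : Eventually (λ n → δ ≤ℚ lower n - lower N ×
                         (∀ h → δ ≤ℚ h → h ≤ℚ ρ → κ ≤ℚ Fₚ n (- h))) → ⊥
          contradict (M , both) = ℚ.<-irrefl refl (ℚ.<-trans (ℚ.<-≤-trans 0<κ
              (subst (κ ≤ℚ_) (Fₚ-at-left M (lower N))
                (proj₂ (both M ℕ.≤-refl) (lower M - lower N) (proj₁ (both M ℕ.≤-refl))
                  (ℚ.≤-trans (ℚ.+-monoˡ-≤ (- lower N) (ℚ.<⇒≤ (lower<upper M N))) gap≤ρ))))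
              (neg (bracket N)))

  -- The fixed negative value at `lower 0` is one of the `Fₚ M h` with |h| ≤ 1, since the first
  -- bracket has width at most 1.
  ¬vanishes : ¬ Vanishes Fₚ
  ¬vanishes vanishes = absurd (vanishes (½ * a) (half-pos 0<a))
    where
    a : ℚ
    a = - at p 0

    0<a : 0ℚ <ℚ a
    0<a = ℚ.neg-antimono-< (neg b₀)

    ∣diff∣≤1 : ∀ n → ∣ lower 0 - lower n ∣ ≤ℚ 1ℚ
    ∣diff∣≤1 n = ℚ.≤-trans (lower-close 0 {0} ℕ.z≤n {n} ℕ.z≤n)
      (≤-cert (1ℚ - hi b₀ + lo b₀) (+-nonNeg (≤⇒0≤- (hi≤1 b₀)) (0≤lo b₀)) (split (lo b₀) (hi b₀)))
      where
      split : ∀ x z → 1ℚ ≡ z - x + (1ℚ - z + x)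
      split = solve-∀ ℚ-ring

    absurd : Eventually (λ n → ∀ h → ∣ h ∣ ≤ℚ 1ℚ → ∣ Fₚ n h ∣ ≤ℚ ½ * a) → ⊥
    absurd (M , small) = ℚ.<-irrefl refl (ℚ.<-≤-trans
      (<-cert (½ * a) (half-pos 0<a) (sym (halves a)))
      (ℚ.≤-trans (-≤∣∣ (at p 0))
        (subst (λ v → ∣ v ∣ ≤ℚ ½ * a) (Fₚ-at M (lower 0))
          (small M ℕ.≤-refl (lower 0 - lower M) (∣diff∣≤1 M)))))

  0<root : 0ℝ <ℝ root
  0<root = from (above-lower 0)
    where
    from : ∃[ δ ] (0ℚ <ℚ δ × Eventually (λ n → δ ≤ℚ lower n - lower 0)) → 0ℝ <ℝ root
    from (δ , 0<δ , far) = δ , 0<δ , eventually-map (λ {n} δ≤ →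
      ≤-cert (lower n - lower 0 - δ + lower 0) (+-nonNeg (≤⇒0≤- δ≤) (0≤lo b₀))
        (expand δ (lower n) (lower 0))) far
      where
      expand : ∀ δ x y → x ≡ 0ℚ + δ + (x - y - δ + y)
      expand = solve-∀ ℚ-ring

  root<1 : root <ℝ 1ℝ
  root<1 = from (below-upper 0)
    where
    from : ∃[ δ ] (0ℚ <ℚ δ × ∀ n → δ ≤ℚ upper 0 - lower n) → root <ℝ 1ℝ
    from (δ , 0<δ , far) = δ , 0<δ , 0 , λ n _ →
      ≤-cert (upper 0 - lower n - δ + (1ℚ - upper 0)) (+-nonNeg (≤⇒0≤- (far n)) (≤⇒0≤- (hi≤1 b₀)))
        (expand δ (lower n) (upper 0))
      where
      expand : ∀ δ x y → 1ℚ ≡ x + δ + (y - x - δ + (1ℚ - y))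
      expand = solve-∀ ℚ-ring

  -- The gap `δ₂` in x <ℝ root holds the points h eventually at or above `δ₂`, and the other
  -- hypothesis keeps them below ρ. The resulting κ is the gap required by the conclusion.
  left-of-root : (left : Side Sign.- Sign.- Fₚ) → ∀ x →
    (root +ℝ fromℚ (- proj₁ left)) <ℝ x → x <ℝ root → eval p x <ℝ 0ℝ
  left-of-root (ρ , _ , side) x (δ₁ , 0<δ₁ , a<x) (δ₂ , 0<δ₂ , x<c) = from (side δ₂ 0<δ₂)
    where
    within : ∀ ρ δ c x → ρ ≡ c - x + (x - (c + - ρ + δ) + δ)
    within = solve-∀ ℚ-ring
    beyond : ∀ δ c x → c - x ≡ δ + (c - (x + δ))
    beyond = solve-∀ ℚ-ring
    conclude : ∀ κ v → 0ℚ ≡ v + κ + (- v - κ)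
    conclude = solve-∀ ℚ-ring

    from : ∃[ κ ] (0ℚ <ℚ κ × Eventually (λ n → ∀ h → δ₂ ≤ℚ h → h ≤ℚ ρ → κ ≤ℚ - Fₚ n (- h))) →
           eval p x <ℝ 0ℝ
    from (κ , 0<κ , ≥κ) = κ , 0<κ , eventually-map (λ {n} ((a<x , x<c) , ≥κ) →
        ≤-cert (- seq (eval p x) n - κ)
          (≤⇒0≤- (subst (λ v → κ ≤ℚ - v) (trans (Fₚ-at-left n (seq x n)) (sym (eval-seq p x n)))
            (≥κ (lower n - seq x n)
              (≤-cert (lower n - (seq x n + δ₂)) (≤⇒0≤- x<c) (beyond δ₂ (lower n) (seq x n)))
              (≤-cert (seq x n - (lower n + - ρ + δ₁) + δ₁) (+-nonNeg (≤⇒0≤- a<x) (ℚ.<⇒≤ 0<δ₁))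
                (within ρ δ₁ (lower n) (seq x n))))))
          (conclude κ (seq (eval p x) n)))
      (eventually-× (eventually-× a<x x<c) ≥κ)

  right-of-root : (right : Side Sign.+ Sign.+ Fₚ) → ∀ x →
    root <ℝ x → x <ℝ (root +ℝ fromℚ (proj₁ right)) → 0ℝ <ℝ eval p x
  right-of-root (ρ , _ , side) x (δ₂ , 0<δ₂ , c<x) (δ₁ , 0<δ₁ , x<b) = from (side δ₂ 0<δ₂)
    where
    within : ∀ ρ δ c x → ρ ≡ x - c + (c + ρ - (x + δ) + δ)
    within = solve-∀ ℚ-ring
    beyond : ∀ δ c x → x - c ≡ δ + (x - (c + δ))
    beyond = solve-∀ ℚ-ring
    conclude : ∀ κ v → v ≡ 0ℚ + κ + (v - κ)
    conclude = solve-∀ ℚ-ring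

    from : ∃[ κ ] (0ℚ <ℚ κ × Eventually (λ n → ∀ h → δ₂ ≤ℚ h → h ≤ℚ ρ → κ ≤ℚ Fₚ n h)) →
           0ℝ <ℝ eval p x
    from (κ , 0<κ , ≥κ) = κ , 0<κ , eventually-map (λ {n} ((c<x , x<b) , ≥κ) →
        ≤-cert (seq (eval p x) n - κ)
          (≤⇒0≤- (subst (κ ≤ℚ_) (trans (Fₚ-at n (seq x n)) (sym (eval-seq p x n)))
            (≥κ (seq x n - lower n)
              (≤-cert (seq x n - (lower n + δ₂)) (≤⇒0≤- c<x) (beyond δ₂ (lower n) (seq x n)))
              (≤-cert (lower n + ρ - (seq x n + δ₁) + δ₁) (+-nonNeg (≤⇒0≤- x<b) (ℚ.<⇒≤ 0<δ₁))
                (within ρ δ₁ (lower n) (seq x n))))))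
          (conclude κ (seq (eval p x) n)))
      (eventually-× (eventually-× c<x x<b) ≥κ)

  changes-sign : LocalSigns Fₚ → ChangesSignAt (eval p) root
  changes-sign (inj₁ vanishes)               = contradiction vanishes ¬vanishes
  changes-sign (inj₂ (σ , τ , left , right)) =
    from (subst (λ σ → Side Sign.- σ Fₚ) (sign-on-left {σ} left) left)
         (subst (λ τ → Side Sign.+ τ Fₚ) (sign-on-right {τ} right) right)
    where
    from : Side Sign.- Sign.- Fₚ → Side Sign.+ Sign.+ Fₚ → ChangesSignAt (eval p) root
    from left right =
      root +ℝ fromℚ (- proj₁ left) , root +ℝ fromℚ (proj₁ right) ,
      (proj₁ left , proj₁ (proj₂ left) , 0 , λ n _ → ℚ.≤-reflexive (cancel (lower n) (proj₁ left))) ,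
      (proj₁ right , proj₁ (proj₂ right) , 0 , λ n _ → ℚ.≤-refl) ,
      inj₁ (left-of-root left , right-of-root right)
      where
      cancel : ∀ c ρ → c + - ρ + ρ ≡ c
      cancel = solve-∀ ℚ-ring

  sign-change : ∃[ c ] (0ℝ <ℝ c × c <ℝ 1ℝ × ChangesSignAt (eval p) c)
  sign-change = root , 0<root , root<1 ,
    changes-sign (local-signs lower lower-unit lower-cauchy (decide-at-root p-nonzero p-null) (taylor p))

-- Node reliability as a sum over all vertex subsets

total : ∀ n → (Subset n → ℚ) → ℚ
total zero    F = F []
total (suc n) F = total n (F ∘ (inside ∷_)) + total n (F ∘ (outside ∷_))

total-cong : ∀ n {F G : Subset n → ℚ} → (∀ C → F C ≡ G C) → total n F ≡ total n G
total-cong zero    F≗G = F≗G []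
total-cong (suc n) F≗G =
  cong₂ _+_ (total-cong n (F≗G ∘ (inside ∷_))) (total-cong n (F≗G ∘ (outside ∷_)))

total-+ : ∀ n (F G : Subset n → ℚ) → total n (λ C → F C + G C) ≡ total n F + total n G
total-+ zero    F G = refl
total-+ (suc n) F G = trans
  (cong₂ _+_ (total-+ n (F ∘ (inside ∷_)) (G ∘ (inside ∷_)))
             (total-+ n (F ∘ (outside ∷_)) (G ∘ (outside ∷_))))
  (interchange (total n (F ∘ (inside ∷_))) (total n (G ∘ (inside ∷_)))
               (total n (F ∘ (outside ∷_))) (total n (G ∘ (outside ∷_))))
  where
  interchange : ∀ a b c d → a + b + (c + d) ≡ a + c + (b + d)
  interchange = solve-∀ ℚ-ring

total-* : ∀ n a (F : Subset n → ℚ) → total n (λ C → a * F C) ≡ a * total n F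
total-* zero    a F = refl
total-* (suc n) a F = trans
  (cong₂ _+_ (total-* n a (F ∘ (inside ∷_))) (total-* n a (F ∘ (outside ∷_))))
  (sym (ℚ.*-distribˡ-+ a (total n (F ∘ (inside ∷_))) (total n (F ∘ (outside ∷_)))))

total-0 : ∀ n {F : Subset n → ℚ} → (∀ C → F C ≡ 0ℚ) → total n F ≡ 0ℚ
total-0 zero    F≗0 = F≗0 []
total-0 (suc n) F≗0 =
  cong₂ _+_ (total-0 n (F≗0 ∘ (inside ∷_))) (total-0 n (F≗0 ∘ (outside ∷_)))

total-nonNeg : ∀ n {F : Subset n → ℚ} → (∀ C → 0ℚ ≤ℚ F C) → 0ℚ ≤ℚ total n F
total-nonNeg zero    0≤F = 0≤F []
total-nonNeg (suc n) 0≤F =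
  +-nonNeg (total-nonNeg n (0≤F ∘ (inside ∷_))) (total-nonNeg n (0≤F ∘ (outside ∷_)))

term≤total : ∀ n {F : Subset n → ℚ} → (∀ C → 0ℚ ≤ℚ F C) → ∀ C → F C ≤ℚ total n F
term≤total zero    0≤F []            = ℚ.≤-refl
term≤total (suc n) {F} 0≤F (inside ∷ C)  =
  subst (_≤ℚ total (suc n) F) (ℚ.+-identityʳ (F (inside ∷ C)))
    (ℚ.+-mono-≤ (term≤total n (0≤F ∘ (inside ∷_)) C) (total-nonNeg n (0≤F ∘ (outside ∷_))))
term≤total (suc n) {F} 0≤F (outside ∷ C) =
  subst (_≤ℚ total (suc n) F) (ℚ.+-identityˡ (F (outside ∷ C)))
    (ℚ.+-mono-≤ (total-nonNeg n (0≤F ∘ (inside ∷_))) (term≤total n (0≤F ∘ (outside ∷_)) C))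

two-terms≤total : ∀ n {F : Subset n → ℚ} → (∀ C → 0ℚ ≤ℚ F C) → ∀ C D → C ≢ D →
  F C + F D ≤ℚ total n F
two-terms≤total zero    0≤F []            []            C≢D = contradiction refl C≢D
two-terms≤total (suc n) {F} 0≤F (inside ∷ C)  (inside ∷ D)  C≢D =
  subst (_≤ℚ total (suc n) F) (ℚ.+-identityʳ (F (inside ∷ C) + F (inside ∷ D)))
    (ℚ.+-mono-≤ (two-terms≤total n (0≤F ∘ (inside ∷_)) C D (C≢D ∘ cong (inside ∷_)))
                (total-nonNeg n (0≤F ∘ (outside ∷_))))
two-terms≤total (suc n) {F} 0≤F (inside ∷ C)  (outside ∷ D) C≢D =
  ℚ.+-mono-≤ (term≤total n (0≤F ∘ (inside ∷_)) C) (term≤total n (0≤F ∘ (outside ∷_)) D)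
two-terms≤total (suc n) {F} 0≤F (outside ∷ C) (inside ∷ D)  C≢D =
  subst (_≤ℚ total (suc n) F) (ℚ.+-comm (F (inside ∷ D)) (F (outside ∷ C)))
    (ℚ.+-mono-≤ (term≤total n (0≤F ∘ (inside ∷_)) D) (term≤total n (0≤F ∘ (outside ∷_)) C))
two-terms≤total (suc n) {F} 0≤F (outside ∷ C) (outside ∷ D) C≢D =
  subst (_≤ℚ total (suc n) F) (ℚ.+-identityˡ (F (outside ∷ C) + F (outside ∷ D)))
    (ℚ.+-mono-≤ (total-nonNeg n (0≤F ∘ (inside ∷_)))
                (two-terms≤total n (0≤F ∘ (outside ∷_)) C D (C≢D ∘ cong (outside ∷_))))

-- Weights of single vertex subsets and their derivatives

weight : ∀ {n} → Subset n → Poly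
weight {n} C = X ^ᵖ Subset.∣ C ∣ ⊗ 1-X ^ᵖ (n ℕ.∸ Subset.∣ C ∣)

-- The probability that a random set, keeping each vertex with probability t, equals C. As a product
-- over the vertices it admits induction along C, and `W′` is its derivative by the product rule.
W W′ : ∀ {n} → Subset n → ℚ → ℚ
W []            t = 1ℚ
W (inside ∷ C)  t = t * W C t
W (outside ∷ C) t = (1ℚ - t) * W C t

W′ []            t = 0ℚ
W′ (inside ∷ C)  t = W C t + t * W′ C t
W′ (outside ∷ C) t = - W C t + (1ℚ - t) * W′ C t

ev-X : ∀ t → ev X t ≡ t
ev-X = expand
  where
  expand : ∀ t → 0ℚ + t * (1ℚ + t * 0ℚ) ≡ t
  expand = solve-∀ ℚ-ring

ev-1-X : ∀ t → ev 1-X t ≡ 1ℚ - t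
ev-1-X = expand
  where
  expand : ∀ t → 1ℚ + t * (- 1ℚ + t * 0ℚ) ≡ 1ℚ - t
  expand = solve-∀ ℚ-ring

ev′-X : ∀ t → ev′ X t ≡ 1ℚ
ev′-X = expand
  where
  expand : ∀ t → 1ℚ + 0ℚ + t * (0ℚ + t * 0ℚ) ≡ 1ℚ
  expand = solve-∀ ℚ-ring

ev′-1-X : ∀ t → ev′ 1-X t ≡ - 1ℚ
ev′-1-X = expand
  where
  expand : ∀ t → - 1ℚ + 0ℚ + t * (0ℚ + t * 0ℚ) ≡ - 1ℚ
  expand = solve-∀ ℚ-ring

ev-Xp⊗q : ∀ p q t → ev ((X ⊗ p) ⊗ q) t ≡ t * ev (p ⊗ q) t
ev-Xp⊗q p q t = begin
  ev ((X ⊗ p) ⊗ q) t       ≡⟨ ev-⊗ (X ⊗ p) q t ⟩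
  ev (X ⊗ p) t * ev q t    ≡⟨ cong (_* ev q t) (trans (ev-⊗ X p t) (cong (_* ev p t) (ev-X t))) ⟩
  t * ev p t * ev q t      ≡⟨ ℚ.*-assoc t (ev p t) (ev q t) ⟩
  t * (ev p t * ev q t)    ≡⟨ cong (t *_) (ev-⊗ p q t) ⟨
  t * ev (p ⊗ q) t         ∎
  where open ≡-Reasoning

ev-p⊗1-Xq : ∀ p q t → ev (p ⊗ (1-X ⊗ q)) t ≡ (1ℚ - t) * ev (p ⊗ q) t
ev-p⊗1-Xq p q t = begin
  ev (p ⊗ (1-X ⊗ q)) t            ≡⟨ ev-⊗ p (1-X ⊗ q) t ⟩
  ev p t * ev (1-X ⊗ q) t         ≡⟨ cong (ev p t *_) (trans (ev-⊗ 1-X q t) (cong (_* ev q t) (ev-1-X t))) ⟩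
  ev p t * ((1ℚ - t) * ev q t)    ≡⟨ regroup t (ev p t) (ev q t) ⟩
  (1ℚ - t) * (ev p t * ev q t)    ≡⟨ cong ((1ℚ - t) *_) (ev-⊗ p q t) ⟨
  (1ℚ - t) * ev (p ⊗ q) t         ∎
  where
  open ≡-Reasoning
  regroup : ∀ t x y → x * ((1ℚ - t) * y) ≡ (1ℚ - t) * (x * y)
  regroup = solve-∀ ℚ-ring

ev′-Xp⊗q : ∀ p q t → ev′ ((X ⊗ p) ⊗ q) t ≡ ev (p ⊗ q) t + t * ev′ (p ⊗ q) t
ev′-Xp⊗q p q t = begin
  ev′ ((X ⊗ p) ⊗ q) t
    ≡⟨ ev′-⊗ (X ⊗ p) q t ⟩
  ev′ (X ⊗ p) t * ev q t + ev (X ⊗ p) t * ev′ q t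
    ≡⟨ cong₂ (λ u v → u * ev q t + v * ev′ q t)
         (trans (ev′-⊗ X p t) (cong₂ (λ u v → u * ev p t + v * ev′ p t) (ev′-X t) (ev-X t)))
         (trans (ev-⊗ X p t) (cong (_* ev p t) (ev-X t))) ⟩
  (1ℚ * ev p t + t * ev′ p t) * ev q t + t * ev p t * ev′ q t
    ≡⟨ regroup t (ev p t) (ev q t) (ev′ p t) (ev′ q t) ⟩
  ev p t * ev q t + t * (ev′ p t * ev q t + ev p t * ev′ q t)
    ≡⟨ cong₂ (λ u v → u + t * v) (ev-⊗ p q t) (ev′-⊗ p q t) ⟨
  ev (p ⊗ q) t + t * ev′ (p ⊗ q) t ∎
  where
  open ≡-Reasoning
  regroup : ∀ t x y u v → (1ℚ * x + t * u) * y + t * x * v ≡ x * y + t * (u * y + x * v)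
  regroup = solve-∀ ℚ-ring

ev′-p⊗1-Xq : ∀ p q t → ev′ (p ⊗ (1-X ⊗ q)) t ≡ - ev (p ⊗ q) t + (1ℚ - t) * ev′ (p ⊗ q) t
ev′-p⊗1-Xq p q t = begin
  ev′ (p ⊗ (1-X ⊗ q)) t
    ≡⟨ ev′-⊗ p (1-X ⊗ q) t ⟩
  ev′ p t * ev (1-X ⊗ q) t + ev p t * ev′ (1-X ⊗ q) t
    ≡⟨ cong₂ (λ u v → ev′ p t * u + ev p t * v)
         (trans (ev-⊗ 1-X q t) (cong (_* ev q t) (ev-1-X t)))
         (trans (ev′-⊗ 1-X q t) (cong₂ (λ u v → u * ev q t + v * ev′ q t) (ev′-1-X t) (ev-1-X t))) ⟩
  ev′ p t * ((1ℚ - t) * ev q t) + ev p t * (- 1ℚ * ev q t + (1ℚ - t) * ev′ q t)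
    ≡⟨ regroup t (ev p t) (ev q t) (ev′ p t) (ev′ q t) ⟩
  - (ev p t * ev q t) + (1ℚ - t) * (ev′ p t * ev q t + ev p t * ev′ q t)
    ≡⟨ cong₂ (λ u v → - u + (1ℚ - t) * v) (ev-⊗ p q t) (ev′-⊗ p q t) ⟨
  - ev (p ⊗ q) t + (1ℚ - t) * ev′ (p ⊗ q) t ∎
  where
  open ≡-Reasoning
  regroup : ∀ t x y u v →
    u * ((1ℚ - t) * y) + x * (- 1ℚ * y + (1ℚ - t) * v) ≡ - (x * y) + (1ℚ - t) * (u * y + x * v)
  regroup = solve-∀ ℚ-ring

-- Truncated subtraction commutes with the successor here because |C| ≤ n.
weight-outside : ∀ {n} (C : Subset n) →
  weight (outside ∷ C) ≡ X ^ᵖ Subset.∣ C ∣ ⊗ (1-X ⊗ 1-X ^ᵖ (n ℕ.∸ Subset.∣ C ∣))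
weight-outside C =
  cong (λ k → X ^ᵖ Subset.∣ C ∣ ⊗ 1-X ^ᵖ k) (ℕ.+-∸-assoc 1 (Subset.∣p∣≤n C))

ev-weight : ∀ {n} (C : Subset n) t → ev (weight C) t ≡ W C t
ev-weight []            t = expand t
  where
  expand : ∀ t → 1ℚ * 1ℚ + 0ℚ + t * 0ℚ ≡ 1ℚ
  expand = solve-∀ ℚ-ring
ev-weight {suc n} (inside ∷ C) t =
  trans (ev-Xp⊗q (X ^ᵖ Subset.∣ C ∣) (1-X ^ᵖ (n ℕ.∸ Subset.∣ C ∣)) t) (cong (t *_) (ev-weight C t))
ev-weight {suc n} (outside ∷ C) t =
  trans (cong (λ p → ev p t) (weight-outside C))
    (trans (ev-p⊗1-Xq (X ^ᵖ Subset.∣ C ∣) (1-X ^ᵖ (n ℕ.∸ Subset.∣ C ∣)) t)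
           (cong ((1ℚ - t) *_) (ev-weight C t)))

ev′-weight : ∀ {n} (C : Subset n) t → ev′ (weight C) t ≡ W′ C t
ev′-weight []            t = expand t
  where
  expand : ∀ t → 0ℚ + t * 0ℚ ≡ 0ℚ
  expand = solve-∀ ℚ-ring
ev′-weight {suc n} (inside ∷ C) t =
  trans (ev′-Xp⊗q (X ^ᵖ Subset.∣ C ∣) (1-X ^ᵖ (n ℕ.∸ Subset.∣ C ∣)) t)
        (cong₂ (λ u v → u + t * v) (ev-weight C t) (ev′-weight C t))
ev′-weight {suc n} (outside ∷ C) t =
  trans (cong (λ p → ev′ p t) (weight-outside C))
    (trans (ev′-p⊗1-Xq (X ^ᵖ Subset.∣ C ∣) (1-X ^ᵖ (n ℕ.∸ Subset.∣ C ∣)) t)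
           (cong₂ (λ u v → - u + (1ℚ - t) * v) (ev-weight C t) (ev′-weight C t)))

-- From the filtered list of connected sets to an indicator sum

restrict : {A : Set} → Dec A → ℚ → ℚ
restrict d v = if does d then v else 0ℚ

restrict-yes : {A : Set} (d : Dec A) {v : ℚ} → A → restrict d v ≡ v
restrict-yes (yes _) _ = refl
restrict-yes (no ¬a) a = contradiction a ¬a

restrict-no : {A : Set} (d : Dec A) {v : ℚ} → ¬ A → restrict d v ≡ 0ℚ
restrict-no (yes a) ¬a = contradiction a ¬a
restrict-no (no _)  _  = refl

restrict-elim : {A : Set} (R : ℚ → Set) (d : Dec A) {v : ℚ} → (A → R v) → (¬ A → R 0ℚ) →
  R (restrict d v)
restrict-elim R (yes a) yes-case _ = yes-case a
restrict-elim R (no ¬a) _ no-case  = no-case ¬a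

-- The value at t and the value of the derivative at t are both additive in the polynomial, so one
-- rearrangement serves both.
module _ (φ : Poly → ℚ) (φ-[] : φ [] ≡ 0ℚ) (φ-⊕ : ∀ p q → φ (p ⊕ q) ≡ φ p + φ q)
         {A : Set} {P : A → Set} (P? : ∀ x → Dec (P x)) (w : A → Poly) where

  sumList : List A → ℚ
  sumList []       = 0ℚ
  sumList (x ∷ xs) = restrict (P? x) (φ (w x)) + sumList xs

  φ-sumᵖ-filter : ∀ xs → φ (sumᵖ (map w (filter P? xs))) ≡ sumList xs
  φ-sumᵖ-filter []       = φ-[]
  φ-sumᵖ-filter (x ∷ xs) with P? x
  ... | yes _ = trans (φ-⊕ (w x) _) (cong (φ (w x) +_) (φ-sumᵖ-filter xs))
  ... | no  _ = trans (φ-sumᵖ-filter xs) (sym (ℚ.+-identityˡ (sumList xs)))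

  sumList-++ : ∀ xs ys → sumList (xs ++ ys) ≡ sumList xs + sumList ys
  sumList-++ []       ys = sym (ℚ.+-identityˡ (sumList ys))
  sumList-++ (x ∷ xs) ys =
    trans (cong (restrict (P? x) (φ (w x)) +_) (sumList-++ xs ys))
          (sym (ℚ.+-assoc (restrict (P? x) (φ (w x))) (sumList xs) (sumList ys)))

  -- A general `f` is needed for the induction, because `allSubsets` puts a new first entry in front
  -- of every smaller subset.
  sumList-subsets : ∀ n (f : Subset n → A) →
    sumList (map f (allSubsets n)) ≡ total n (λ C → restrict (P? (f C)) (φ (w (f C))))
  sumList-subsets zero    f = ℚ.+-identityʳ (restrict (P? (f [])) (φ (w (f []))))
  sumList-subsets (suc n) f = begin
    sumList (map f (map (inside ∷_) (allSubsets n) ++ map (outside ∷_) (allSubsets n)))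
      ≡⟨ cong sumList (List.map-++ f (map (inside ∷_) (allSubsets n)) (map (outside ∷_) (allSubsets n))) ⟩
    sumList (map f (map (inside ∷_) (allSubsets n)) ++ map f (map (outside ∷_) (allSubsets n)))
      ≡⟨ sumList-++ (map f (map (inside ∷_) (allSubsets n))) (map f (map (outside ∷_) (allSubsets n))) ⟩
    sumList (map f (map (inside ∷_) (allSubsets n))) + sumList (map f (map (outside ∷_) (allSubsets n)))
      ≡⟨ cong₂ (λ xs ys → sumList xs + sumList ys) (List.map-∘ (allSubsets n)) (List.map-∘ (allSubsets n)) ⟨
    sumList (map (f ∘ (inside ∷_)) (allSubsets n)) + sumList (map (f ∘ (outside ∷_)) (allSubsets n))
      ≡⟨ cong₂ _+_ (sumList-subsets n (f ∘ (inside ∷_))) (sumList-subsets n (f ∘ (outside ∷_))) ⟩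
    total (suc n) (λ C → restrict (P? (f C)) (φ (w (f C)))) ∎
    where open ≡-Reasoning

module _ {n} (G : Graph n) where

  nRel-functional : ∀ φ → φ [] ≡ 0ℚ → (∀ p q → φ (p ⊕ q) ≡ φ p + φ q) →
    φ (nRel G) ≡ total n (λ C → restrict (connectedSet? G C) (φ (weight C)))
  nRel-functional φ φ-[] φ-⊕ = trans
    (φ-sumᵖ-filter φ φ-[] φ-⊕ (connectedSet? G) weight (allSubsets n))
    (trans (cong (sumList φ φ-[] φ-⊕ (connectedSet? G) weight) (sym (List.map-id (allSubsets n))))
           (sumList-subsets φ φ-[] φ-⊕ (connectedSet? G) weight n id))

  ev-nRel : ∀ t → ev (nRel G) t ≡ total n (λ C → restrict (connectedSet? G C) (W C t))
  ev-nRel t = trans (nRel-functional (λ p → ev p t) refl (λ p q → ev-⊕ p q t))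
    (total-cong n (λ C → cong (restrict (connectedSet? G C)) (ev-weight C t)))

  ev′-nRel : ∀ t → ev′ (nRel G) t ≡ total n (λ C → restrict (connectedSet? G C) (W′ C t))
  ev′-nRel t = trans (nRel-functional (λ p → ev′ p t) refl (λ p q → ev′-⊕ p q t))
    (total-cong n (λ C → cong (restrict (connectedSet? G C)) (ev′-weight C t)))

-- Values at 0, ½ and 1

-- Splitting on the first vertex gives the factors t and 1 - t, which add up to 1.
total-W : ∀ n t → total n (λ C → W C t) ≡ 1ℚ
total-W zero    t = refl
total-W (suc n) t = trans
  (cong₂ _+_ (trans (total-* n t (λ C → W C t)) (cong (t *_) (total-W n t)))
             (trans (total-* n (1ℚ - t) (λ C → W C t)) (cong ((1ℚ - t) *_) (total-W n t))))
  (expand t)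
  where
  expand : ∀ t → t * 1ℚ + (1ℚ - t) * 1ℚ ≡ 1ℚ
  expand = solve-∀ ℚ-ring

-- The derivative of the constant total weight: keeping and dropping the first vertex contribute
-- opposite terms `W C t`.
total-W′ : ∀ n t → total n (λ C → W′ C t) ≡ 0ℚ
total-W′ zero    t = refl
total-W′ (suc n) t = trans (sym (total-+ n (λ C → W C t + t * W′ C t) (λ C → - W C t + (1ℚ - t) * W′ C t)))
  (trans (total-cong n (λ C → collapse t (W C t) (W′ C t))) (total-W′ n t))
  where
  collapse : ∀ t w v → w + t * v + (- w + (1ℚ - t) * v) ≡ v
  collapse = solve-∀ ℚ-ring

total-containing : ∀ n (w : Fin n) t → total n (λ C → restrict (w Subset.∈? C) (W C t)) ≡ t
total-containing (suc n) zero    t = begin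
  total n (λ C → t * W C t) + total n (λ C → 0ℚ)
    ≡⟨ cong₂ _+_ (trans (total-* n t (λ C → W C t)) (cong (t *_) (total-W n t))) (total-0 n (λ _ → refl)) ⟩
  t * 1ℚ + 0ℚ
    ≡⟨ expand t ⟩
  t ∎
  where
  open ≡-Reasoning
  expand : ∀ t → t * 1ℚ + 0ℚ ≡ t
  expand = solve-∀ ℚ-ring
total-containing (suc n) (suc w) t = trans
  (cong₂ _+_ (branch inside t (λ _ → refl)) (branch outside (1ℚ - t) (λ _ → refl)))
  (expand t)
  where
  expand : ∀ t → t * t + (1ℚ - t) * t ≡ t
  expand = solve-∀ ℚ-ring

  branch : ∀ s a → (∀ C → W (s ∷ C) t ≡ a * W C t) →
    total n (λ C → restrict (suc w Subset.∈? (s ∷ C)) (W (s ∷ C) t)) ≡ a * t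
  branch s a eq = trans (total-cong n (λ C → factor (does (w Subset.∈? C)) (eq C)))
    (trans (total-* n a (λ C → restrict (w Subset.∈? C) (W C t))) (cong (a *_) (total-containing n w t)))
    where
    factor : ∀ b {u v} → u ≡ a * v → (if b then u else 0ℚ) ≡ a * (if b then v else 0ℚ)
    factor true  eq = eq
    factor false _  = sym (ℚ.*-zeroʳ a)

W-nonNeg : ∀ {n} (C : Subset n) {t} → Unit t → 0ℚ ≤ℚ W C t
W-nonNeg []            _ = 0≤1
W-nonNeg (inside ∷ C)  u@(0≤t , _) = *-nonNeg 0≤t (W-nonNeg C u)
W-nonNeg (outside ∷ C) u@(_ , t≤1) = *-nonNeg (≤⇒0≤- t≤1) (W-nonNeg C u)

unit-0 : Unit 0ℚ
unit-0 = ℚ.≤-refl , 0≤1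

unit-1 : Unit 1ℚ
unit-1 = 0≤1 , ℚ.≤-refl

½<1 : ½ <ℚ 1ℚ
½<1 = <-cert ½ 0<½ refl

W-½-pos : ∀ {n} (C : Subset n) → 0ℚ <ℚ W C ½
W-½-pos []            = 0<1
W-½-pos (inside ∷ C)  = *-pos 0<½ (W-½-pos C)
W-½-pos (outside ∷ C) = *-pos 0<½ (W-½-pos C)

W-0-nonempty : ∀ {n} (C : Subset n) → Nonempty C → W C 0ℚ ≡ 0ℚ
W-0-nonempty (inside ∷ C)  _                     = ℚ.*-zeroˡ (W C 0ℚ)
W-0-nonempty (outside ∷ C) (suc x , there x∈C) = cong (1ℚ *_) (W-0-nonempty C (x , x∈C))

W-0-⊥ : ∀ n → W (Subset.⊥ {n}) 0ℚ ≡ 1ℚ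
W-0-⊥ zero    = refl
W-0-⊥ (suc n) = cong (1ℚ *_) (W-0-⊥ n)

-- The derivative of tᵏ (1 - t)ⁿ⁻ᵏ at 0 is 1 for k = 1 and 0 for k > 1; only the empty set gives a
-- negative value.
W′-0-nonNeg : ∀ {n} (C : Subset n) → Nonempty C → 0ℚ ≤ℚ W′ C 0ℚ
W′-0-nonNeg (inside ∷ C)  _                     =
  subst (0ℚ ≤ℚ_) (expand (W C 0ℚ) (W′ C 0ℚ)) (W-nonNeg C unit-0)
  where
  expand : ∀ w v → w ≡ w + 0ℚ * v
  expand = solve-∀ ℚ-ring
W′-0-nonNeg (outside ∷ C) (suc x , there x∈C) =
  subst (0ℚ ≤ℚ_) (trans (expand (W′ C 0ℚ)) (cong (λ w → - w + 1ℚ * W′ C 0ℚ) (sym (W-0-nonempty C (x , x∈C)))))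
    (W′-0-nonNeg C (x , x∈C))
  where
  expand : ∀ v → v ≡ - 0ℚ + 1ℚ * v
  expand = solve-∀ ℚ-ring

W′-0-singleton : ∀ {n} (v : Fin n) → W′ ⁅ v ⁆ 0ℚ ≡ 1ℚ
W′-0-singleton {suc n} zero    = trans (cong (_+ 0ℚ * W′ (Subset.⊥ {n}) 0ℚ) (W-0-⊥ n))
  (cong (1ℚ +_) (ℚ.*-zeroˡ (W′ (Subset.⊥ {n}) 0ℚ)))
W′-0-singleton (suc v) = cong₂ (λ u w → - u + 1ℚ * w)
  (W-0-nonempty ⁅ v ⁆ (v , Subset.x∈⁅x⁆ v)) (W′-0-singleton v)

W-1-⊤ : ∀ n → W (⊤ {n}) 1ℚ ≡ 1ℚ
W-1-⊤ zero    = refl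
W-1-⊤ (suc n) = cong (1ℚ *_) (W-1-⊤ n)

W-1-proper : ∀ {n} (C : Subset n) → C ≢ ⊤ → W C 1ℚ ≡ 0ℚ
W-1-proper []            C≢⊤ = contradiction refl C≢⊤
W-1-proper (inside ∷ C)  C≢⊤ = cong (1ℚ *_) (W-1-proper C (C≢⊤ ∘ cong (inside ∷_)))
W-1-proper (outside ∷ C) _    = ℚ.*-zeroˡ (W C 1ℚ)

-- At 1 the derivative of the weight is -1 if exactly one vertex is missing and 0 if more are.
W′-1-proper : ∀ {n} (C : Subset n) → C ≢ ⊤ → 0ℚ ≤ℚ - W′ C 1ℚ
W′-1-proper []            C≢⊤ = contradiction refl C≢⊤
W′-1-proper (inside ∷ C)  C≢⊤ =
  subst (0ℚ ≤ℚ_) (trans (expand (W′ C 1ℚ)) (cong (λ w → - (w + 1ℚ * W′ C 1ℚ)) (sym (W-1-proper C C≢⊤′))))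
    (W′-1-proper C C≢⊤′)
  where
  C≢⊤′ : C ≢ ⊤
  C≢⊤′ = C≢⊤ ∘ cong (inside ∷_)
  expand : ∀ v → - v ≡ - (0ℚ + 1ℚ * v)
  expand = solve-∀ ℚ-ring
W′-1-proper (outside ∷ C) _    =
  subst (0ℚ ≤ℚ_) (expand (W C 1ℚ) (W′ C 1ℚ)) (W-nonNeg C unit-1)
  where
  expand : ∀ w v → w ≡ - (- w + 0ℚ * v)
  expand = solve-∀ ℚ-ring

∁⊥≡⊤ : ∀ n → ∁ (Subset.⊥ {n}) ≡ ⊤
∁⊥≡⊤ zero    = refl
∁⊥≡⊤ (suc n) = cong (inside ∷_) (∁⊥≡⊤ n)

v∉∁⁅v⁆ : ∀ {n} (v : Fin n) → v Subset.∉ ∁ ⁅ v ⁆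
v∉∁⁅v⁆ v = Subset.x∈p⇒x∉∁p (Subset.x∈⁅x⁆ v)

∁⁅⁆≢⊤ : ∀ {n} (v : Fin n) → ∁ ⁅ v ⁆ ≢ ⊤
∁⁅⁆≢⊤ v eq = v∉∁⁅v⁆ v (subst (v Subset.∈_) (sym eq) Subset.∈⊤)

W′-1-co-singleton : ∀ {n} (v : Fin n) → - W′ (∁ ⁅ v ⁆) 1ℚ ≡ 1ℚ
W′-1-co-singleton {suc n} zero    = trans (cong (λ C → - (- W C 1ℚ + 0ℚ * W′ C 1ℚ)) (∁⊥≡⊤ n))
  (trans (cong (λ w → - (- w + 0ℚ * W′ (⊤ {n}) 1ℚ)) (W-1-⊤ n)) (expand (W′ (⊤ {n}) 1ℚ)))
  where
  expand : ∀ v → - (- 1ℚ + 0ℚ * v) ≡ 1ℚ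
  expand = solve-∀ ℚ-ring
W′-1-co-singleton (suc v) =
  trans (cong (λ w → - (w + 1ℚ * W′ (∁ ⁅ v ⁆) 1ℚ)) (W-1-proper (∁ ⁅ v ⁆) (∁⁅⁆≢⊤ v)))
    (trans (expand (W′ (∁ ⁅ v ⁆) 1ℚ)) (W′-1-co-singleton v))
  where
  expand : ∀ v → - (0ℚ + 1ℚ * v) ≡ - v
  expand = solve-∀ ℚ-ring

⁅⁆-injective : ∀ {n} {u v : Fin n} → ⁅ u ⁆ ≡ ⁅ v ⁆ → u ≡ v
⁅⁆-injective {u = u} {v} eq = Subset.x∈⁅y⁆⇒x≡y v (subst (u Subset.∈_) eq (Subset.x∈⁅x⁆ u))

∁⁅⁆-injective : ∀ {n} {u v : Fin n} → ∁ ⁅ u ⁆ ≡ ∁ ⁅ v ⁆ → u ≡ v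
∁⁅⁆-injective {u = u} {v} eq = Subset.x∈⁅y⁆⇒x≡y v
  (Subset.x∉∁p⇒x∈p (λ u∈ → v∉∁⁅v⁆ u (subst (u Subset.∈_) (sym eq) u∈)))

singleton-connected : ∀ {n} (G : Graph n) v → ConnectedSet G ⁅ v ⁆
singleton-connected G v = (v , Subset.x∈⁅x⁆ v) , λ x y x∈ y∈ →
  subst (Star (InducedAdj G ⁅ v ⁆) x)
    (trans (Subset.x∈⁅y⁆⇒x≡y v x∈) (sym (Subset.x∈⁅y⁆⇒x≡y v y∈))) Star.ε

module _ {n} (G : Graph n) where

  private
    connected? : ∀ C → Dec (ConnectedSet G C)
    connected? = connectedSet? G

  ev-nRel-0 : ev (nRel G) 0ℚ ≡ 0ℚ
  ev-nRel-0 = trans (ev-nRel G 0ℚ) (total-0 n (λ C →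
    restrict-elim (_≡ 0ℚ) (connected? C) (λ conn → W-0-nonempty C (proj₁ conn)) (λ _ → refl)))

  -- Each singleton is connected and contributes 1, and no connected set contributes a negative
  -- amount.
  ev′-nRel-0 : ∀ {u v} → u ≢ v → 1ℚ + 1ℚ ≤ℚ ev′ (nRel G) 0ℚ
  ev′-nRel-0 {u} {v} u≢v = subst₂ _≤ℚ_ (cong₂ _+_ (term u) (term v)) (sym (ev′-nRel G 0ℚ))
    (two-terms≤total n nonNeg ⁅ u ⁆ ⁅ v ⁆ (u≢v ∘ ⁅⁆-injective))
    where
    nonNeg : ∀ C → 0ℚ ≤ℚ restrict (connected? C) (W′ C 0ℚ)
    nonNeg C = restrict-elim (0ℚ ≤ℚ_) (connected? C)
      (λ conn → W′-0-nonNeg C (proj₁ conn)) (λ _ → ℚ.≤-refl)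

    term : ∀ v → restrict (connected? ⁅ v ⁆) (W′ ⁅ v ⁆ 0ℚ) ≡ 1ℚ
    term v = trans (restrict-yes (connected? ⁅ v ⁆) (singleton-connected G v)) (W′-0-singleton v)

  -- The sets through `w` have total weight exactly ½. The singleton of `u` is connected, avoids
  -- `w`, and comes on top.
  ev-nRel-½ : ∀ w u → u ≢ w → (∀ C → w Subset.∈ C → ConnectedSet G C) → ½ <ℚ ev (nRel G) ½
  ev-nRel-½ w u u≢w star = subst₂ _<ℚ_ (total-containing n w ½) (sym (ev-nRel G ½))
    (<-cert (total n excess) (ℚ.<-≤-trans (W-½-pos ⁅ u ⁆) (subst (_≤ℚ total n excess) excess-u
        (term≤total n nonNeg ⁅ u ⁆)))
      (trans (total-cong n (λ C → split (through C) (whole C))) (total-+ n through excess)))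
    where
    through whole excess : Subset n → ℚ
    through C = restrict (w Subset.∈? C) (W C ½)
    whole   C = restrict (connected? C) (W C ½)
    excess  C = whole C - through C

    split : ∀ a b → b ≡ a + (b - a)
    split = solve-∀ ℚ-ring

    cancel : ∀ a → a - a ≡ 0ℚ
    cancel = solve-∀ ℚ-ring

    drop : ∀ a → a - 0ℚ ≡ a
    drop = solve-∀ ℚ-ring

    nonNeg : ∀ C → 0ℚ ≤ℚ excess C
    nonNeg C = restrict-elim (λ v → 0ℚ ≤ℚ whole C - v) (w Subset.∈? C)
      (λ w∈C → ℚ.≤-reflexive (sym (trans
        (cong (_- W C ½) (restrict-yes (connected? C) (star C w∈C))) (cancel (W C ½)))))
      (λ _ → subst (0ℚ ≤ℚ_) (sym (drop (whole C)))
        (restrict-elim (0ℚ ≤ℚ_) (connected? C) (λ _ → ℚ.<⇒≤ (W-½-pos C)) (λ _ → ℚ.≤-refl)))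

    excess-u : excess ⁅ u ⁆ ≡ W ⁅ u ⁆ ½
    excess-u = trans
      (cong₂ _-_ (restrict-yes (connected? ⁅ u ⁆) (singleton-connected G u))
                 (restrict-no (w Subset.∈? ⁅ u ⁆) (λ w∈ → u≢w (sym (Subset.x∈⁅y⁆⇒x≡y u w∈)))))
      (drop (W ⁅ u ⁆ ½))

  module _ (G-connected : ConnectedSet G ⊤) where

    disconnected⇒proper : ∀ {C} → ¬ ConnectedSet G C → C ≢ ⊤
    disconnected⇒proper ¬conn refl = ¬conn G-connected

    ev-nRel-1 : ev (nRel G) 1ℚ ≡ 1ℚ
    ev-nRel-1 = trans (ev-nRel G 1ℚ)
      (trans (total-cong n (λ C → restrict-elim (_≡ W C 1ℚ) (connected? C) (λ _ → refl)
                (λ ¬conn → sym (W-1-proper C (disconnected⇒proper ¬conn)))))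
             (total-W n 1ℚ))

    -- Equal to 1 on the disconnected complements of single vertices and to 0 on all other sets, so
    -- that its total counts the cut vertices.
    loss : Subset n → ℚ
    loss C = restrict (connected? C) (W′ C 1ℚ) + - W′ C 1ℚ

    loss-nonNeg : ∀ C → 0ℚ ≤ℚ loss C
    loss-nonNeg C = restrict-elim (λ v → 0ℚ ≤ℚ v + - W′ C 1ℚ) (connected? C)
      (λ _ → ℚ.≤-reflexive (sym (ℚ.+-inverseʳ (W′ C 1ℚ))))
      (λ ¬conn → subst (0ℚ ≤ℚ_) (sym (ℚ.+-identityˡ (- W′ C 1ℚ)))
        (W′-1-proper C (disconnected⇒proper ¬conn)))

    loss-cut : ∀ {v} → ¬ ConnectedSet G (∁ ⁅ v ⁆) → loss (∁ ⁅ v ⁆) ≡ 1ℚ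
    loss-cut {v} ¬conn = trans (cong (_+ - W′ (∁ ⁅ v ⁆) 1ℚ) (restrict-no (connected? (∁ ⁅ v ⁆)) ¬conn))
      (trans (ℚ.+-identityˡ (- W′ (∁ ⁅ v ⁆) 1ℚ)) (W′-1-co-singleton v))

    -- Summed over all subsets, W′ vanishes, so only the disconnected sets contribute.
    ev′-nRel-1 : ev′ (nRel G) 1ℚ ≡ total n loss
    ev′-nRel-1 = begin
      ev′ (nRel G) 1ℚ                                    ≡⟨ ev′-nRel G 1ℚ ⟩
      total n restricted                                 ≡⟨ ℚ.+-identityʳ (total n restricted) ⟨
      total n restricted + 0ℚ                            ≡⟨ cong (total n restricted +_) negated ⟨
      total n restricted + total n (λ C → - W′ C 1ℚ)     ≡⟨ total-+ n restricted (λ C → - W′ C 1ℚ) ⟨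
      total n loss                                       ∎
      where
      open ≡-Reasoning
      restricted : Subset n → ℚ
      restricted C = restrict (connected? C) (W′ C 1ℚ)
      minus : ∀ v → - v ≡ - 1ℚ * v
      minus = solve-∀ ℚ-ring
      negated : total n (λ C → - W′ C 1ℚ) ≡ 0ℚ
      negated = trans (total-cong n (λ C → minus (W′ C 1ℚ)))
        (trans (total-* n (- 1ℚ) (λ C → W′ C 1ℚ)) (cong (- 1ℚ *_) (total-W′ n 1ℚ)))

    cut-vertex : ∀ {u} → ¬ ConnectedSet G (∁ ⁅ u ⁆) → 1ℚ ≤ℚ ev′ (nRel G) 1ℚ
    cut-vertex {u} cut-u = subst₂ _≤ℚ_ (loss-cut cut-u) (sym ev′-nRel-1)
      (term≤total n loss-nonNeg (∁ ⁅ u ⁆))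

    two-cut-vertices : ∀ {u v} → u ≢ v → ¬ ConnectedSet G (∁ ⁅ u ⁆) → ¬ ConnectedSet G (∁ ⁅ v ⁆) →
      1ℚ + 1ℚ ≤ℚ ev′ (nRel G) 1ℚ
    two-cut-vertices {u} {v} u≢v cut-u cut-v =
      subst₂ _≤ℚ_ (cong₂ _+_ (loss-cut cut-u) (loss-cut cut-v)) (sym ev′-nRel-1)
        (two-terms≤total n loss-nonNeg (∁ ⁅ u ⁆) (∁ ⁅ v ⁆) (u≢v ∘ ∁⁅⁆-injective))

-- Trees

module _ {n} (G : Graph n) where
  open Graph G

  -- An inductive form of `ys ∷ʳ y` that survives adding or removing a vertex at the front.
  data EndsIn (y : Fin n) : List (Fin n) → Set where
    end  : EndsIn y (y ∷ [])
    next : ∀ {x xs} → EndsIn y xs → EndsIn y (x ∷ xs)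

  ends-in⇒∷ʳ : ∀ {y xs} → EndsIn y xs → ∃[ ys ] xs ≡ ys ∷ʳ y
  ends-in⇒∷ʳ end              = [] , refl
  ends-in⇒∷ʳ (next {x} e) = let ys , eq = ends-in⇒∷ʳ e in x ∷ ys , cong (x ∷_) eq

  record PathAvoiding (v x y : Fin n) : Set where
    field
      rest   : List (Fin n)
      linked : Linked Adj (x ∷ rest)
      unique : Unique (x ∷ rest)
      ends   : EndsIn y (x ∷ rest)
      avoids : All (v ≢_) (x ∷ rest)

  from-member : ∀ {v x y z zs} → x ∈ z ∷ zs → Linked Adj (z ∷ zs) → Unique (z ∷ zs) →
    EndsIn y (z ∷ zs) → All (v ≢_) (z ∷ zs) → PathAvoiding v x y
  from-member (Any.here refl) linked unique ends avoids =
    record { rest = _ ; linked = linked ; unique = unique ; ends = ends ; avoids = avoids }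
  from-member (Any.there x∈) (_ ∷ linked) (_ ∷ unique) (next ends) (_ ∷ avoids) =
    from-member x∈ linked unique ends avoids

  -- Loop erasure: if `x` already lies on the path, the part from `x` onwards is taken instead.
  prepend : ∀ {v x z y} → v ≢ x → Adj x z → PathAvoiding v z y → PathAvoiding v x y
  prepend {x = x} {z} v≢x x∼z path = go (Any.any? (x Fin.≟_) (z ∷ rest))
    where
    open PathAvoiding path
    go : Dec (x ∈ z ∷ rest) → PathAvoiding _ x _
    go (yes x∈) = from-member x∈ linked unique ends avoids
    go (no x∉)  = record
      { rest = z ∷ rest ; linked = x∼z ∷ linked ; unique = All.¬Any⇒All¬ _ x∉ ∷ unique
      ; ends = next ends ; avoids = v≢x ∷ avoids }

  path-avoiding : ∀ {v x y} → v ≢ x → Star (InducedAdj G (∁ ⁅ v ⁆)) x y → PathAvoiding v x y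
  path-avoiding v≢x Star.ε = record
    { rest = [] ; linked = [-] ; unique = [] ∷ [] ; ends = end ; avoids = v≢x ∷ [] }
  path-avoiding {v} v≢x (_◅_ {j = z} (_ , z∈ , x∼z) zs) =
    prepend v≢x x∼z (path-avoiding (λ { refl → v∉∁⁅v⁆ v z∈ }) zs)

  close-cycle : ∀ {v x y} → Adj v x → Adj v y → x ≢ y → PathAvoiding v x y → Cycle G
  close-cycle {v} {x} {y} v∼x v∼y x≢y path = close (ends-in⇒∷ʳ ends)
    where
    open PathAvoiding path
    close : ∃[ ys ] x ∷ rest ≡ ys ∷ʳ y → Cycle G
    close (ys , eq) = record
      { first = v ; last = y ; interior = ys
      -- With an empty interior the path would consist of `y` alone, forcing x = y.
      ; interior≢[] = λ { refl → x≢y (List.∷-injectiveˡ eq) }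
      ; distinct = subst Unique (cong (v ∷_) eq) (avoids ∷ unique)
      ; path = subst (Linked Adj) (cong (v ∷_) eq) (v∼x ∷ linked)
      ; closing = adj-sym v∼y }

  adj⇒≢ : ∀ {x y} → Adj x y → x ≢ y
  adj⇒≢ x∼y x≡y = adj-irrefl x≡y x∼y

  ≢⇒∈∁ : ∀ {x v : Fin n} → x ≢ v → x Subset.∈ ∁ ⁅ v ⁆
  ≢⇒∈∁ x≢v = Subset.x∉p⇒x∈∁p (Subset.x≢y⇒x∉⁅y⁆ x≢v)

  module StarShaped (tree : IsTree G) (w : Fin n)
                    (rest-connected : ∀ v → v ≢ w → ConnectedSet G (∁ ⁅ v ⁆)) where
    open IsTree tree

    -- Two different neighbours of `v` would be joined by a path avoiding `v`, since `v` is not a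
    -- cut vertex, and the path would close up to a cycle through `v`.
    unique-neighbour : ∀ {v x y} → v ≢ w → Adj v x → Adj v y → x ≡ y
    unique-neighbour {v} {x} {y} v≢w v∼x v∼y = decide (x Fin.≟ y)
      where
      decide : Dec (x ≡ y) → x ≡ y
      decide (yes x≡y) = x≡y
      decide (no x≢y)  = contradiction
        (close-cycle v∼x v∼y x≢y (path-avoiding (adj⇒≢ v∼x)
          (proj₂ (rest-connected v v≢w) x y (≢⇒∈∁ (adj⇒≢ v∼x ∘ sym)) (≢⇒∈∁ (adj⇒≢ v∼y ∘ sym)))))
        acyclic

    -- A walk from `v` to `w` can only go back and forth between `v` and neighbours of `v`: a
    -- neighbour other than `w` has `v` as its sole neighbour. So `w` is met as a neighbour of `v`.
    adjacent-to-centre : ∀ {v} → v ≢ w → Adj v w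
    adjacent-to-centre {v} v≢w = walk (proj₂ connected v w Subset.∈⊤ Subset.∈⊤) (inj₁ refl)
      where
      walk : ∀ {u} → Star (InducedAdj G ⊤) u w → u ≡ v ⊎ Adj u v → Adj v w
      walk Star.ε                     (inj₁ w≡v) = contradiction (sym w≡v) v≢w
      walk Star.ε                     (inj₂ w∼v) = adj-sym w∼v
      walk ((_ , _ , v∼z) ◅ zs)  (inj₁ refl) = walk zs (inj₂ (adj-sym v∼z))
      walk {u} ((_ , _ , u∼z) ◅ zs) (inj₂ u∼v) = decide (u Fin.≟ w)
        where
        decide : Dec (u ≡ w) → Adj v w
        decide (yes refl) = adj-sym u∼v
        decide (no u≢w)   = walk zs (inj₁ (unique-neighbour u≢w u∼z u∼v))

    containing-centre : ∀ C → w Subset.∈ C → ConnectedSet G C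
    containing-centre C w∈C = (w , w∈C) , λ x y x∈C y∈C → to-centre x∈C ◅◅ from-centre y∈C
      where
      to-centre : ∀ {x} → x Subset.∈ C → Star (InducedAdj G C) x w
      to-centre {x} x∈C = decide (x Fin.≟ w)
        where
        decide : Dec (x ≡ w) → Star (InducedAdj G C) x w
        decide (yes refl) = Star.ε
        decide (no x≢w)   = (x∈C , w∈C , adjacent-to-centre x≢w) ◅ Star.ε

      from-centre : ∀ {x} → x Subset.∈ C → Star (InducedAdj G C) w x
      from-centre {x} x∈C = decide (x Fin.≟ w)
        where
        decide : Dec (x ≡ w) → Star (InducedAdj G C) w x
        decide (yes refl) = Star.ε
        decide (no x≢w)   = (w∈C , x∈C , adj-sym (adjacent-to-centre x≢w)) ◅ Star.ε

    -- Without `w` the vertex `u` is isolated, so it cannot reach `v`. This supplies the cut vertex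
    -- behind f′(1) ≥ 1.
    centre-cut : ∀ {u v} → u ≢ w → v ≢ w → u ≢ v → ¬ ConnectedSet G (∁ ⁅ w ⁆)
    centre-cut {u} {v} u≢w v≢w u≢v (_ , path) = stuck (path u v (≢⇒∈∁ u≢w) (≢⇒∈∁ v≢w))
      where
      stuck : Star (InducedAdj G (∁ ⁅ w ⁆)) u v → ⊥
      stuck Star.ε                    = u≢v refl
      stuck ((_ , z∈ , u∼z) ◅ _) =
        v∉∁⁅v⁆ w (subst (Subset._∈ ∁ ⁅ w ⁆) (unique-neighbour u≢w u∼z (adjacent-to-centre u≢w)) z∈)

  TwoCuts OneCutAtMost : Set
  TwoCuts      = ∃[ u ] ∃[ v ] (u ≢ v × ¬ ConnectedSet G (∁ ⁅ u ⁆) × ¬ ConnectedSet G (∁ ⁅ v ⁆))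
  OneCutAtMost = ∃[ w ] (∀ v → v ≢ w → ConnectedSet G (∁ ⁅ v ⁆))

  cut? : ∀ v → Dec (¬ ConnectedSet G (∁ ⁅ v ⁆))
  cut? v = ¬? (connectedSet? G (∁ ⁅ v ⁆))

  ¬cut⇒connected : ∀ {v} → ¬ ¬ ConnectedSet G (∁ ⁅ v ⁆) → ConnectedSet G (∁ ⁅ v ⁆)
  ¬cut⇒connected {v} = decidable-stable (connectedSet? G (∁ ⁅ v ⁆))

  count-cuts : Fin n → TwoCuts ⊎ OneCutAtMost
  count-cuts default = first (Fin.any? cut?)
    where
    second : ∀ u → ¬ ConnectedSet G (∁ ⁅ u ⁆) →
      Dec (∃[ v ] (u ≢ v × ¬ ConnectedSet G (∁ ⁅ v ⁆))) → TwoCuts ⊎ OneCutAtMost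
    second u cut-u (yes (v , u≢v , cut-v)) = inj₁ (u , v , u≢v , cut-u , cut-v)
    second u cut-u (no none) =
      inj₂ (u , λ v v≢u → ¬cut⇒connected (λ cut-v → none (v , v≢u ∘ sym , cut-v)))

    first : Dec (∃[ v ] ¬ ConnectedSet G (∁ ⁅ v ⁆)) → TwoCuts ⊎ OneCutAtMost
    first (yes (u , cut-u)) = second u cut-u (Fin.any? (λ v → ¬? (u Fin.≟ v) ×-dec cut? v))
    -- Without a cut vertex every choice of centre meets the condition.
    first (no none)         = inj₂ (default , λ v _ → ¬cut⇒connected (λ cut-v → none (v , cut-v)))

-- From slopes of f to signs of f″

two-others : ∀ {n} (w : Fin (3 ℕ.+ n)) → ∃[ u ] ∃[ v ] (u ≢ w × v ≢ w × u ≢ v)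
two-others zero          = suc zero , suc (suc zero) , (λ ()) , (λ ()) , (λ ())
two-others (suc zero)    = zero , suc (suc zero) , (λ ()) , (λ ()) , (λ ())
two-others (suc (suc w)) = zero , suc zero , (λ ()) , (λ ()) , (λ ())

-- As s X - f increases on [x₀, 1], some b has f′(b) < s. So f′ is smaller at b than at 0 and at 1,
-- and the same search applied to -f′ on [0, b] and to f′ on [b, 1] finds the two signs of f″.
second-derivative-bracket : ∀ f {s x₀} → 0ℚ ≤ℚ x₀ → x₀ <ℚ 1ℚ → s ≤ℚ ev′ f 0ℚ → s ≤ℚ ev′ f 1ℚ →
  ev f 1ℚ - ev f x₀ <ℚ s * (1ℚ - x₀) → Bracket (deriv (deriv f))
second-derivative-bracket f {s} {x₀} 0≤x₀ x₀<1 s≤f′0 s≤f′1 flat =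
  from-flat (increase⇒0<ev′ tilted 0≤x₀ x₀<1 ℚ.≤-refl tilted-increases)
  where
  tilted : Poly
  tilted = s · X ⊕ - 1ℚ · f

  ev-tilted : ∀ t → ev tilted t ≡ s * t - ev f t
  ev-tilted t = trans (ev-⊕ (s · X) (- 1ℚ · f) t)
    (trans (cong₂ _+_ (trans (ev-· s X t) (cong (s *_) (ev-X t))) (ev-· (- 1ℚ) f t))
           (expand (s * t) (ev f t)))
    where
    expand : ∀ x y → x + - 1ℚ * y ≡ x - y
    expand = solve-∀ ℚ-ring

  ev′-tilted : ∀ t → ev′ tilted t ≡ s - ev′ f t
  ev′-tilted t = trans (ev′-⊕ (s · X) (- 1ℚ · f) t)
    (trans (cong₂ _+_ (trans (ev′-· s X t) (cong (s *_) (ev′-X t))) (ev′-· (- 1ℚ) f t))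
           (expand s (ev′ f t)))
    where
    expand : ∀ x y → x * 1ℚ + - 1ℚ * y ≡ x - y
    expand = solve-∀ ℚ-ring

  tilted-increases : ev tilted x₀ <ℚ ev tilted 1ℚ
  tilted-increases = subst₂ _<ℚ_ (sym (ev-tilted x₀)) (sym (ev-tilted 1ℚ))
    (<-cert (s * (1ℚ - x₀) - (ev f 1ℚ - ev f x₀)) (<⇒0<- flat) (expand s x₀ (ev f x₀) (ev f 1ℚ)))
    where
    expand : ∀ s x u v → s * 1ℚ - v ≡ s * x - u + (s * (1ℚ - x) - (v - u))
    expand = solve-∀ ℚ-ring

  -f′ : Poly
  -f′ = - 1ℚ · deriv f

  minus : ∀ y → - 1ℚ * y ≡ - y
  minus = solve-∀ ℚ-ring

  from-flat : ∃[ b ] (x₀ ≤ℚ b × b ≤ℚ 1ℚ × 0ℚ <ℚ ev′ tilted b) → Bracket (deriv (deriv f))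
  from-flat (b , x₀≤b , b≤1 , 0<) =
    bracket (increase⇒0<ev′ -f′ ℚ.≤-refl 0<b b≤1 descends) (increase⇒0<ev′ (deriv f) 0≤b b<1 ℚ.≤-refl ascends)
    where
    f′b<s : ev′ f b <ℚ s
    f′b<s = <-cert (s - ev′ f b) (subst (0ℚ <ℚ_) (ev′-tilted b) 0<) (expand s (ev′ f b))
      where
      expand : ∀ s y → s ≡ y + (s - y)
      expand = solve-∀ ℚ-ring

    ascends : ev′ f b <ℚ ev′ f 1ℚ
    ascends = ℚ.<-≤-trans f′b<s s≤f′1

    f′b<f′0 : ev′ f b <ℚ ev′ f 0ℚ
    f′b<f′0 = ℚ.<-≤-trans f′b<s s≤f′0

    descends : ev -f′ 0ℚ <ℚ ev -f′ b
    descends = subst₂ _<ℚ_ (sym (trans (ev-· (- 1ℚ) (deriv f) 0ℚ) (minus (ev′ f 0ℚ))))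
      (sym (trans (ev-· (- 1ℚ) (deriv f) b) (minus (ev′ f b)))) (ℚ.neg-antimono-< f′b<f′0)

    0≤b : 0ℚ ≤ℚ b
    0≤b = ℚ.≤-trans 0≤x₀ x₀≤b

    ≤∧≢⇒< : ∀ {x y} → x ≤ℚ y → x ≢ y → x <ℚ y
    ≤∧≢⇒< x≤y x≢y = ℚ.≰⇒> (λ y≤x → x≢y (ℚ.≤-antisym x≤y y≤x))

    0<b : 0ℚ <ℚ b
    0<b = ≤∧≢⇒< 0≤b (λ 0≡b → ℚ.<-irrefl (cong (ev′ f) (sym 0≡b)) f′b<f′0)

    b<1 : b <ℚ 1ℚ
    b<1 = ≤∧≢⇒< b≤1 (λ b≡1 → ℚ.<-irrefl (cong (ev′ f) b≡1) ascends)

    bracket : ∃[ a ] (0ℚ ≤ℚ a × a ≤ℚ b × 0ℚ <ℚ ev′ -f′ a) →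
              ∃[ d ] (b ≤ℚ d × d ≤ℚ 1ℚ × 0ℚ <ℚ ev′ (deriv f) d) → Bracket (deriv (deriv f))
    bracket (a , 0≤a , a≤b , concave) (d , b≤d , d≤1 , convex) = record
      { lo = a ; hi = d ; 0≤lo = 0≤a ; hi≤1 = d≤1 ; neg = neg-a ; pos = convex
      ; lo<hi = ≤∧≢⇒< (ℚ.≤-trans a≤b b≤d)
          (λ a≡d → ℚ.<-irrefl (cong (ev′ (deriv f)) a≡d) (ℚ.<-trans neg-a convex)) }
      where
      neg-a : ev′ (deriv f) a <ℚ 0ℚ
      neg-a = <-cert (- ev′ (deriv f) a)
        (subst (0ℚ <ℚ_) (trans (ev′-· (- 1ℚ) (deriv f) a) (minus (ev′ (deriv f) a))) concave)
        (sym (ℚ.+-inverseʳ (ev′ (deriv f) a)))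

module _ {n} (T : Graph (3 ℕ.+ n)) (tree : IsTree T) where
  open IsTree tree

  1≤1+1 : 1ℚ ≤ℚ 1ℚ + 1ℚ
  1≤1+1 = ≤-cert 1ℚ 0≤1 refl

  f : Poly
  f = nRel T

  2≤f′0 : 1ℚ + 1ℚ ≤ℚ ev′ f 0ℚ
  2≤f′0 = ev′-nRel-0 T {zero} {suc zero} (λ ())

  non-star-bracket : TwoCuts T → Bracket (deriv (deriv f))
  non-star-bracket (u , v , u≢v , cut-u , cut-v) =
    second-derivative-bracket f {1ℚ + 1ℚ} {0ℚ} ℚ.≤-refl 0<1 2≤f′0
      (two-cut-vertices T connected u≢v cut-u cut-v)
      (subst₂ (λ y x → y - x <ℚ (1ℚ + 1ℚ) * (1ℚ - 0ℚ)) (sym (ev-nRel-1 T connected)) (sym (ev-nRel-0 T))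
        (<-cert 1ℚ 0<1 refl))

  star-bracket : OneCutAtMost T → Bracket (deriv (deriv f))
  star-bracket (w , rest-connected) = from (two-others w)
    where
    open StarShaped T tree w rest-connected

    from : ∃[ u ] ∃[ v ] (u ≢ w × v ≢ w × u ≢ v) → Bracket (deriv (deriv f))
    from (u , v , u≢w , v≢w , u≢v) =
      -- Only f′(1) ≥ 1 is at hand, and 1 is also the mean slope on [0, 1]; strictness is gained by
      -- starting at ½.
      second-derivative-bracket f {1ℚ} {½} (ℚ.<⇒≤ 0<½) ½<1 (ℚ.≤-trans 1≤1+1 2≤f′0)
        (cut-vertex T connected (centre-cut u≢w v≢w u≢v))
        (subst (λ y → y - ev f ½ <ℚ 1ℚ * (1ℚ - ½)) (sym (ev-nRel-1 T connected))
          (ℚ.+-monoʳ-< 1ℚ (ℚ.neg-antimono-< (ev-nRel-½ T w u u≢w containing-centre))))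

  tree-bracket : Bracket (deriv (deriv f))
  tree-bracket = [ non-star-bracket , star-bracket ]′ (count-cuts T zero)

theorem3p2 : ∀ (n : ℕ) → 4 ≤ n → (T : Graph n) → IsTree T →
    ∃[ c ] (0ℝ <ℝ c × c <ℝ 1ℝ × InflectionPoint (nRel T) c)
theorem3p2 _ (ℕ.s≤s (ℕ.s≤s (ℕ.s≤s (ℕ.s≤s _)))) T tree = SignChange.sign-change (tree-bracket T tree)
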